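{- Let $G$ be a cubic, cyclically four-connected graph with $|V(G)|\ge 8$. Let $F$ be a subgraph of $G$ such that every vertex of $F$ has degree at least $2$ in $F$. Let $C$ be a circuit of $G$ of length $4$, vertex-disjoint from $F$. Let $\mathcal{L}$ be a set of cubic graphs each of which has $F$ as a subgraph. Suppose that every $C$-leap of $G$ $F$-contains a member of $\mathcal{L}$. Let $H$ be a cyclically five-connected cubic graph containing $F$ as a subgraph that does not $F$-contain any member of $\mathcal{L}$. Then $H$ does not $F$-contain $G$.
   Context: All graphs finite and simple. $\delta_G(X)$ is the set of edges with exactly one end in $X$; a cubic graph is cyclically $k$-connected if it has girth $\ge k$ and $|\delta_G(X)|\ge k$ for all $X$ such that both $X$ and $V(G)\setminus X$ contain the vertex set of a circuit. A homeomorphic embedding of $G$ in $H$ is a map $\eta$: injective on vertices; each edge $e=v_1v_2$ maps to a path $\eta(e)$ with ends $\eta(v_1),\eta(v_2)$; for distinct edges $e_1,e_2$ no edge or internal vertex of $\eta(e_1)$ lies in $\eta(e_2)$; $\eta(v)\in V(\eta(e))$ iff $v$ is an end of $e$. If $F$ is a subgraph of both $G$ and $H$, $\eta$ fixes $F$ if $\eta(e)=e$ and $\eta(v)=v$ for all $e\in E(F)$, $v\in V(F)$; and $H$ $F$-contains $G$ if there is a homeomorphic embedding of $G$ in $H$ fixing $F$. For distinct edges $ab,cd$ of $G$, $G+(ab,cd)$ is obtained by deleting $ab,cd$ and adding two new vertices $x,y$ and edges $xa,xb,yc,yd,xy$. A $C$-leap of $G$ is a graph $G+(e,f)$ where $e\in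 E(C)$ and $f\in E(G)\setminus E(F)$ has no end in $V(C)$. -}

module Defs where

open import Data.Nat using (ℕ; zero; suc; _+_; _≤_; _⊔_; _≡ᵇ_)
open import Data.Bool using (Bool; true; false; _∧_; _∨_; not; if_then_else_)
open import Data.List using (List; []; _∷_; _++_; length; foldr; reverse; head; last; take)
open import Data.List.Membership.Propositional using (_∈_)
open import Data.List.Relation.Unary.Unique.Propositional using (Unique)
open import Data.List.Relation.Unary.All using (All)
open import Data.Maybe using (just)
open import Data.Product using (Σ; _×_; _,_)
open import Data.Sum using (_⊎_)
open import Data.Unit using (⊤)
open import Data.Empty using (⊥)
open import Relation.Nullary using (¬_)
open import Relation.Binary.PropositionalEquality using (_≡_; _≢_)
open import Function.Bundles using (_⇔_)

-- A (raw) finite simple graph whose vertices are natural-number labels.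
-- Labels are shared between graphs, so "F is a subgraph of G and of H" is literal.
-- Edges are determined by their ends (simple graph): adj u v ≡ true.
record Graph : Set where
  constructor mkGraph
  field
    V   : List ℕ
    adj : ℕ → ℕ → Bool
open Graph public

E : Graph → ℕ → ℕ → Set
E G u v = adj G u v ≡ true

record WellFormed (G : Graph) : Set where
  field
    uniqueV : Unique (V G)
    symm    : ∀ u v → adj G u v ≡ adj G v u
    irrefl  : ∀ v → adj G v v ≡ false
    closed  : ∀ u v → E G u v → u ∈ V G

countB : (ℕ → Bool) → List ℕ → ℕ
countB p []       = 0
countB p (x ∷ xs) = (if p x then 1 else 0) + countB p xs

deg : Graph → ℕ → ℕ
deg G v = countB (adj G v) (V G)

Cubic : Graph → Set
Cubic G = WellFormed G × (∀ v → v ∈ V G → deg G v ≡ 3)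

Subgraph : Graph → Graph → Set
Subgraph F G = (∀ v → v ∈ V F → v ∈ V G) × (∀ u v → E F u v → E G u v)

Consec : (ℕ → ℕ → Set) → List ℕ → Set
Consec R []           = ⊤
Consec R (x ∷ [])     = ⊤
Consec R (x ∷ y ∷ xs) = R x y × Consec R (y ∷ xs)

IsCircuit : Graph → List ℕ → Set
IsCircuit G cs = Unique cs × (3 ≤ length cs) × (∀ v → v ∈ cs → v ∈ V G)
                 × Consec (E G) (cs ++ take 1 cs)

SeqEdge : List ℕ → ℕ → ℕ → Set
SeqEdge []           u v = ⊥
SeqEdge (x ∷ [])     u v = ⊥
SeqEdge (x ∷ y ∷ xs) u v = ((x ≡ u × y ≡ v) ⊎ (x ≡ v × y ≡ u)) ⊎ SeqEdge (y ∷ xs) u v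

CircuitEdge : List ℕ → ℕ → ℕ → Set
CircuitEdge cs = SeqEdge (cs ++ take 1 cs)

cut : Graph → (ℕ → Bool) → ℕ
cut G X = foldr (λ u acc → (if X u then countB (λ v → adj G u v ∧ not (X v)) (V G) else 0) + acc) 0 (V G)

CyclicallyConnected : ℕ → Graph → Set
CyclicallyConnected k G =
  (∀ cs → IsCircuit G cs → k ≤ length cs) ×
  (∀ (X : ℕ → Bool) →
     Σ (List ℕ) (λ cs → IsCircuit G cs × All (λ v → X v ≡ true) cs) →
     Σ (List ℕ) (λ cs → IsCircuit G cs × All (λ v → X v ≡ false) cs) →
     k ≤ cut G X)

IsPath : Graph → ℕ → ℕ → List ℕ → Set
IsPath H s t p = Unique p × Consec (E H) p × head p ≡ just s × last p ≡ just t

Inner : ℕ → ℕ → List ℕ → ℕ → Set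
Inner s t p v = v ∈ p × v ≢ s × v ≢ t

DistinctEdges : ℕ → ℕ → ℕ → ℕ → Set
DistinctEdges a b c d = ¬ (a ≡ c × b ≡ d) × ¬ (a ≡ d × b ≡ c)

-- homeomorphic embedding of G in H fixing F; P a b is the path η(ab)
record Embedding (F G H : Graph) : Set where
  field
    η      : ℕ → ℕ
    P      : ℕ → ℕ → List ℕ
    η-in   : ∀ v → v ∈ V G → η v ∈ V H
    η-inj  : ∀ u v → u ∈ V G → v ∈ V G → η u ≡ η v → u ≡ v
    P-path : ∀ a b → E G a b → IsPath H (η a) (η b) (P a b)
    P-sym  : ∀ a b → E G a b → P b a ≡ reverse (P a b)
    disjV  : ∀ a b c d → E G a b → E G c d → DistinctEdges a b c d →
               ∀ v → Inner (η a) (η b) (P a b) v → ¬ (v ∈ P c d)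
    disjE  : ∀ a b c d → E G a b → E G c d → DistinctEdges a b c d →
               ∀ u v → SeqEdge (P a b) u v → ¬ SeqEdge (P c d) u v
    ends   : ∀ v a b → v ∈ V G → E G a b → (η v ∈ P a b) ⇔ (v ≡ a ⊎ v ≡ b)
    fixV   : ∀ v → v ∈ V F → η v ≡ v
    fixE   : ∀ a b → E F a b → P a b ≡ a ∷ b ∷ []

FContains : Graph → Graph → Graph → Set
FContains F H G = Embedding F G H

isPair : ℕ → ℕ → ℕ → ℕ → Bool
isPair a b u v = ((u ≡ᵇ a) ∧ (v ≡ᵇ b)) ∨ ((u ≡ᵇ b) ∧ (v ≡ᵇ a))

freshX : Graph → ℕ
freshX G = suc (foldr _⊔_ 0 (V G))

plus : Graph → ℕ → ℕ → ℕ → ℕ → Graph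
plus G a b c d = mkGraph (x ∷ y ∷ V G) adj'
  where
  x = freshX G
  y = suc x
  adj' : ℕ → ℕ → Bool
  adj' u v = (adj G u v ∧ not (isPair a b u v) ∧ not (isPair c d u v))
             ∨ isPair x a u v ∨ isPair x b u v ∨ isPair y c u v ∨ isPair y d u v
             ∨ isPair x y u v

{-# OPTIONS --safe #-}
module Submission where

-- Let η embed G in H, and let Z be the image of G \ V(C), which is never changed.  The image of C
-- and of the four edges leaving it forms a "sun": a circuit of H with four legs ending in Z.
-- If no path of the residual graph of the legs led from the circuit to Z, the vertices that reach
-- Z in it would be cut off by at most four edges, one per leg; since Z contains a circuit (G \ V(C)
-- has at least as many edges as vertices, because |V(G)| ≥ 8), this contradicts cyclic
-- five-connection.  So a residual trail exists, and it enters Z at an inner vertex of the image of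
-- some edge f, since H is cubic.  If the trail first meets a leg, the sun is rerouted through that
-- initial segment so that the four legs keep their cyclic order and a shorter trail remains.
-- Once the trail misses the legs, it completes the sun and the image of G \ V(C) to an embedding
-- of a C-leap G + (e, f), and composition with the embedding of a member of 𝓛 finishes the proof.

open import Defs
open import Data.Nat using (ℕ; zero; suc; _+_; _*_; _⊔_; _≡ᵇ_; _≤_; _<_; z≤n; s≤s; _≟_; _<?_; _≤?_; s≤s⁻¹)
open import Data.Nat.Properties using (≤-refl; ≤-trans; ≤-reflexive; +-mono-≤; +-monoʳ-≤; +-monoˡ-≤; n≤1+n; m≤m+n; m≤n+m; <-irrefl; <-cmp; <-asym; ≰⇒>; +-comm; +-assoc; +-suc; m≤m⊔n; m≤n⊔m; ≡ᵇ⇒≡; +-cancelˡ-≤; +-cancelʳ-≤; <⇒≢; <-≤-trans)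
open import Data.Nat.Tactic.RingSolver using (solve-∀)
open import Data.Bool using (Bool; true; false; _∧_; _∨_; not; if_then_else_; T)
import Data.Bool.Properties as Bool
open import Data.List using (List; []; _∷_; _++_; [_]; length; map; filter; reverse; head; last; take; foldr; cartesianProduct)
open import Data.List.Properties using (++-assoc; length-++; length-map; reverse-++; unfold-reverse; reverse-involutive)
open import Data.List.Membership.Propositional using (_∈_; _∉_; find; lose)
open import Data.List.Membership.Propositional.Properties using (∈-++⁺ˡ; ∈-++⁺ʳ; ∈-++⁻; ∈-map⁺; ∈-map⁻; ∈-∃++; ∈-filter⁺; ∈-filter⁻; ∈-cartesianProduct⁺; ∈-cartesianProduct⁻)
open import Data.List.Membership.DecPropositional _≟_ using (_∈?_)
open import Data.List.Relation.Unary.Any using (Any; here; there; any?)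
open import Data.List.Relation.Unary.All using (All; []; _∷_)
import Data.List.Relation.Unary.All as All
import Data.List.Relation.Unary.All.Properties as All
open import Data.List.Relation.Unary.AllPairs using (AllPairs; []; _∷_)
import Data.List.Relation.Unary.AllPairs as AllPairs
import Data.List.Relation.Unary.AllPairs.Properties as AllPairs
open import Data.List.Relation.Unary.Unique.Propositional using (Unique)
import Data.List.Relation.Unary.Unique.Propositional.Properties as Unique
open import Data.List.Relation.Binary.Disjoint.Propositional using (Disjoint)
open import Data.List.Relation.Binary.Subset.Propositional using (_⊆_)
open import Data.List.Relation.Binary.Permutation.Propositional using (_↭_; ↭-refl; ↭-sym; ↭-trans; ↭⇒↭ₛ; prep; swap)
import Data.List.Relation.Binary.Permutation.Propositional as Perm
open import Data.List.Relation.Binary.Permutation.Propositional.Properties using (∈-resp-↭; ++⁺ˡ; ++⁺ʳ; ++⁺; shift; map⁺; ↭-reverse; ↭-length; ++-commutativeMonoid)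
import Data.List.Relation.Binary.Permutation.Setoid.Properties as PermSetoid
open import Data.Maybe using (just)
open import Data.Product using (Σ; ∃₂; ∃-syntax; _×_; _,_; proj₁; proj₂; uncurry)
open import Data.Sum using (_⊎_; inj₁; inj₂; [_,_]′)
import Data.Sum as Sum
open import Data.Unit using (tt)
open import Data.Empty using (⊥; ⊥-elim)
open import Relation.Nullary using (¬_; Dec; yes; no; contradiction)
open import Relation.Nullary.Decidable using (_×-dec_; _⊎-dec_; ¬?; dec-true; dec-false; decidable-stable; does)
open import Relation.Binary.PropositionalEquality using (_≡_; _≢_; refl; sym; trans; cong; cong₂; subst; subst₂; setoid; ≢-sym; module ≡-Reasoning)
open import Function using (_∘_; id)
open import Function.Bundles using (mk⇔; Equivalence)
open import Relation.Binary.Definitions using (tri<; tri≈; tri>)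
open import Algebra.Solver.CommutativeMonoid (++-commutativeMonoid {A = ℕ}) using (solve; _⊜_; _⊕_)

-- Lists and walks

-- The legs form a flow of value four from the circuit to Z, and a residual trail is an augmenting
-- path. Augmenting along all of it at once could permute the ends of the legs, whereas an embedding
-- of a leap needs them in the cyclic order of C. Hence only the part up to the first leg is used.
-- For a trail leaving side 12, a hit on leg 1 slides the first corner outwards and a hit on leg 3
-- replaces side 23; the reflection exchanging 1 with 2 and 3 with 4 covers legs 2 and 4. The leg
-- pieces given up end on the new circuit, so the trail after its last visit there stays residual.
-- The leap is one to which the hypothesis applies: Z is the image of G minus V(C), so f has no end
-- in V(C), and f is not in F because its image has an inner vertex while edges of F are fixed. The
-- bound 8 comes from a count: with n vertices G has 3n/2 edges, at most 8 of them meet C, and 3n/2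
-- - 8 ≥ n - 4 exactly when n ≥ 8.

unique-resp-↭ : ∀ {A : Set} {xs ys : List A} → xs ↭ ys → Unique xs → Unique ys
unique-resp-↭ {A} σ = PermSetoid.Unique-resp-↭ (setoid A) (↭⇒↭ₛ σ)

unique-∷⁻ : ∀ {A : Set} {x : A} {xs} → Unique (x ∷ xs) → Unique xs
unique-∷⁻ (_ ∷ u) = u

unique-++⁻ : ∀ {A : Set} (xs : List A) {ys} → Unique (xs ++ ys) → Unique xs × Unique ys × Disjoint xs ys
unique-++⁻ [] u = [] , u , λ { (() , _) }
unique-++⁻ (x ∷ xs) (x∉ ∷ u) with unique-++⁻ xs u
... | uxs , uys , dj = All.++⁻ˡ xs x∉ ∷ uxs , uys , λ
  { (here refl , y) → All.lookup (All.++⁻ʳ xs x∉) y refl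
  ; (there x′ , y) → dj (x′ , y) }

unique-∷⁺ : ∀ {A : Set} {x : A} {xs} → x ∉ xs → Unique xs → Unique (x ∷ xs)
unique-∷⁺ {x = x} {xs} x∉ u = All.tabulate (λ y∈ → λ { refl → x∉ y∈ }) ∷ u

unique-reverse : ∀ {A : Set} {xs : List A} → Unique xs → Unique (reverse xs)
unique-reverse {xs = xs} = unique-resp-↭ (↭-sym (↭-reverse xs))

unique-⊆⇒length≤ : ∀ {A : Set} {xs ys : List A} → Unique xs → xs ⊆ ys → length xs ≤ length ys
unique-⊆⇒length≤ {xs = []} _ _ = z≤n
unique-⊆⇒length≤ {xs = x ∷ xs} (x∉ ∷ u) sub with ∈-∃++ (sub (here refl))
... | ls , rs , refl = ≤-trans (s≤s (unique-⊆⇒length≤ u sub′)) (≤-reflexive (sym (↭-length (shift x ls rs))))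
  where
  sub′ : xs ⊆ ls ++ rs
  sub′ y∈ with ∈-resp-↭ (shift x ls rs) (sub (there y∈))
  ... | here refl = contradiction refl (All.lookup x∉ y∈)
  ... | there z = z

∈-reverse : ∀ {A : Set} {x : A} {xs} → x ∈ xs → x ∈ reverse xs
∈-reverse {xs = xs} = ∈-resp-↭ (↭-sym (↭-reverse xs))

∈-reverse⁻ : ∀ {A : Set} {x : A} {xs} → x ∈ reverse xs → x ∈ xs
∈-reverse⁻ {xs = xs} = ∈-resp-↭ (↭-reverse xs)

-- Only inner vertices are listed; the ends are indices. Paths with a common end can then be
-- disjoint as plain lists, and the empty list is a single edge.
data Chain (R : ℕ → ℕ → Set) : ℕ → List ℕ → ℕ → Set where
  edge : ∀ {x y} → R x y → Chain R x [] y
  _◅_ : ∀ {x i is y} → R x i → Chain R i is y → Chain R x (i ∷ is) y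

infixr 5 _◅_

module _ {R : ℕ → ℕ → Set} where

  join : ∀ {x is y js z} → Chain R x is y → Chain R y js z → Chain R x (is ++ y ∷ js) z
  join (edge r) c = r ◅ c
  join (r ◅ c) c′ = r ◅ join c c′

  split : ∀ {x} is {y js z} → Chain R x (is ++ y ∷ js) z → Chain R x is y × Chain R y js z
  split [] (r ◅ c) = edge r , c
  split (i ∷ is) (r ◅ c) with split is c
  ... | c₁ , c₂ = r ◅ c₁ , c₂

  chain-map : ∀ {S : ℕ → ℕ → Set} → (∀ {u v} → R u v → S u v) → ∀ {x is y} → Chain R x is y → Chain S x is y
  chain-map f (edge r) = edge (f r)
  chain-map f (r ◅ c) = f r ◅ chain-map f c

  chain-reverse : (∀ {u v} → R u v → R v u) → ∀ {x is y} → Chain R x is y → Chain R y (reverse is) x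
  chain-reverse s (edge r) = edge (s r)
  chain-reverse s {x} {i ∷ is} {y} (r ◅ c) rewrite unfold-reverse i is = join (chain-reverse s c) (edge (s r))

  chain⇒consec : ∀ {x is y} → Chain R x is y → Consec R (x ∷ is ++ [ y ])
  chain⇒consec (edge r) = r , tt
  chain⇒consec (r ◅ c) = r , chain⇒consec c

  consec⇒chain : ∀ {x} is {y} → Consec R (x ∷ is ++ [ y ]) → Chain R x is y
  consec⇒chain [] (r , _) = edge r
  consec⇒chain (i ∷ is) (r , c) = r ◅ consec⇒chain is c

  consec-++ : ∀ xs {y zs} → Consec R (xs ++ [ y ]) → Consec R (y ∷ zs) → Consec R (xs ++ y ∷ zs)
  consec-++ [] _ c = c
  consec-++ (x ∷ []) (r , _) c = r , c
  consec-++ (x ∷ x′ ∷ xs) (r , c) c′ = r , consec-++ (x′ ∷ xs) c c′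

-- Directed from `k` to `e`, unlike `SeqEdge`: the residual graph must tell the two traversals of a
-- leg edge apart.
Link : ℕ → List ℕ → ℕ → ℕ → ℕ → Set
Link k [] e u v = k ≡ u × e ≡ v
Link k (i ∷ l) e u v = (k ≡ u × i ≡ v) ⊎ Link i l e u v

link? : ∀ k l e u v → Dec (Link k l e u v)
link? k [] e u v = (k ≟ u) ×-dec (e ≟ v)
link? k (i ∷ l) e u v = ((k ≟ u) ×-dec (i ≟ v)) ⊎-dec link? i l e u v

link-++⁺ˡ : ∀ {k} l {p l′ e u v} → Link k l p u v → Link k (l ++ p ∷ l′) e u v
link-++⁺ˡ [] q = inj₁ q
link-++⁺ˡ (i ∷ l) (inj₁ q) = inj₁ q
link-++⁺ˡ (i ∷ l) (inj₂ q) = inj₂ (link-++⁺ˡ l q)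

link-++⁺ʳ : ∀ {k} l {p l′ e u v} → Link p l′ e u v → Link k (l ++ p ∷ l′) e u v
link-++⁺ʳ [] q = inj₂ q
link-++⁺ʳ (i ∷ l) q = inj₂ (link-++⁺ʳ l q)

link-++⁻ : ∀ {k} l {p l′ e u v} → Link k (l ++ p ∷ l′) e u v → Link k l p u v ⊎ Link p l′ e u v
link-++⁻ [] (inj₁ q) = inj₁ q
link-++⁻ [] (inj₂ q) = inj₂ q
link-++⁻ (i ∷ l) (inj₁ q) = inj₁ (inj₁ q)
link-++⁻ (i ∷ l) (inj₂ q) with link-++⁻ l q
... | inj₁ a = inj₁ (inj₂ a)
... | inj₂ b = inj₂ b

link-src : ∀ {k} l {e u v} → Link k l e u v → u ∈ k ∷ l
link-src [] (refl , _) = here refl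
link-src (i ∷ l) (inj₁ (refl , _)) = here refl
link-src (i ∷ l) (inj₂ q) = there (link-src l q)

link-tgt : ∀ {k} l {e u v} → Link k l e u v → v ∈ l ++ [ e ]
link-tgt [] (_ , refl) = here refl
link-tgt (i ∷ l) (inj₁ (_ , refl)) = here refl
link-tgt (i ∷ l) (inj₂ q) = there (link-tgt l q)

-- The vertex after the start on a path with interior `l` and last vertex `e`; the default `e` is
-- the case of a single edge.
first : List ℕ → ℕ → ℕ
first [] e = e
first (i ∷ _) e = i

chain-first : ∀ {R x l e} → Chain R x l e → R x (first l e)
chain-first (edge r) = r
chain-first (r ◅ _) = r

link-first : ∀ k l e → Link k l e k (first l e)
link-first k [] e = refl , refl
link-first k (i ∷ l) e = inj₁ (refl , refl)

first-∈ : ∀ l e → first l e ∈ l ++ [ e ]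
first-∈ [] e = here refl
first-∈ (i ∷ l) e = here refl

-- Circuits and cuts in cubic graphs

E-dec : ∀ G u v → Dec (E G u v)
E-dec G u v = adj G u v Bool.≟ true

module WF {G : Graph} (wf : WellFormed G) where
  open WellFormed wf public

  E-sym : ∀ {u v} → E G u v → E G v u
  E-sym {u} {v} e = trans (symm v u) e

  E-irrefl : ∀ {u v} → E G u v → u ≢ v
  E-irrefl {u} e refl with trans (sym (irrefl u)) e
  ... | ()

  E-src : ∀ {u v} → E G u v → u ∈ V G
  E-src = closed _ _

  E-tgt : ∀ {u v} → E G u v → v ∈ V G
  E-tgt = E-src ∘ E-sym

  chain-V : ∀ {x is y} → Chain (E G) x is y → All (_∈ V G) (x ∷ is)
  chain-V (edge e) = E-src e ∷ []
  chain-V (e ◅ c) = E-src e ∷ chain-V c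

countB≡length-filter : ∀ p xs → countB p xs ≡ length (filter (λ x → p x Bool.≟ true) xs)
countB≡length-filter p [] = refl
countB≡length-filter p (x ∷ xs) with p x
... | true = cong suc (countB≡length-filter p xs)
... | false = countB≡length-filter p xs

module _ {p : ℕ → Bool} {xs : List ℕ} (ux : Unique xs) where

  private
    p? = λ x → p x Bool.≟ true
    N = filter p? xs

  countB-≥ : ∀ {ys} → Unique ys → (∀ {y} → y ∈ ys → y ∈ xs × p y ≡ true) → length ys ≤ countB p xs
  countB-≥ uys sub = ≤-trans (unique-⊆⇒length≤ uys (λ y∈ → uncurry (∈-filter⁺ p?) (sub y∈)))
                             (≤-reflexive (sym (countB≡length-filter p xs)))

  countB-escape : ∀ ys → length ys < countB p xs → ∃[ y ] (y ∈ xs × p y ≡ true × y ∉ ys)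
  countB-escape ys lt with any? (λ y → ¬? (y ∈? ys)) N
  ... | yes w with find w
  ...   | y , y∈N , y∉ with ∈-filter⁻ p? {xs = xs} y∈N
  ...     | y∈ , py = y , y∈ , py , y∉
  countB-escape ys lt | no none = contradiction (<-≤-trans lt (≤-trans (≤-reflexive (countB≡length-filter p xs))
    (unique-⊆⇒length≤ (Unique.filter⁺ p? ux) λ y∈ → decidable-stable (_ ∈? ys) λ y∉ → none (lose y∈ y∉)))) (<-irrefl refl)

module _ {G : Graph} (cub : Cubic G) where
  open WF (proj₁ cub)

  cubic-saturated : ∀ {v a b c w} → E G v a → E G v b → E G v c → a ≢ b → a ≢ c → b ≢ c →
                    E G v w → w ≡ a ⊎ w ≡ b ⊎ w ≡ c
  cubic-saturated {v} {a} {b} {c} {w} va vb vc ab ac bc vw with w ≟ a | w ≟ b | w ≟ c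
  ... | yes r | _ | _ = inj₁ r
  ... | no _ | yes r | _ = inj₂ (inj₁ r)
  ... | no _ | no _ | yes r = inj₂ (inj₂ r)
  ... | no wa | no wb | no wc = contradiction (countB-≥ uniqueV {w ∷ a ∷ b ∷ c ∷ []}
        ((wa ∷ wb ∷ wc ∷ []) ∷ (ab ∷ ac ∷ []) ∷ (bc ∷ []) ∷ [] ∷ [])
        λ { (here refl) → E-tgt vw , vw ; (there (here refl)) → E-tgt va , va
          ; (there (there (here refl))) → E-tgt vb , vb ; (there (there (there (here refl)))) → E-tgt vc , vc })
      λ le → <-irrefl refl (≤-trans le (≤-reflexive (proj₂ cub v (E-src va))))

  cubic-third : ∀ {v a b} → E G v a → E G v b → a ≢ b →
                ∃[ c ] (E G v c × c ≢ a × c ≢ b × (∀ w → E G v w → w ≡ a ⊎ w ≡ b ⊎ w ≡ c))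
  cubic-third {v} {a} {b} va vb ab with countB-escape {adj G v} uniqueV (a ∷ b ∷ []) (≤-reflexive (sym (proj₂ cub v (E-src va))))
  ... | c , _ , vc , c∉ = c , vc , c∉ ∘ here , (λ { refl → c∉ (there (here refl)) }) ,
        λ w → cubic-saturated va vb vc ab (c∉ ∘ here ∘ sym) (λ { refl → c∉ (there (here refl)) })

-- Extending a path at its head inside W must end, since W is finite; when it stops, a second neighbour of the head lies on the path and closes a circuit.
module _ {H : Graph} (wf : WellFormed H) {W : List ℕ}
         (two : ∀ {v} → v ∈ W → ∃₂ λ n₁ n₂ → n₁ ≢ n₂ × E H v n₁ × E H v n₂ × n₁ ∈ W × n₂ ∈ W) where
  open WF wf

  other-neighbour : ∀ {v} y → v ∈ W → ∃[ n ] (n ≢ y × E H v n × n ∈ W)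
  other-neighbour y v∈ with two v∈
  ... | n₁ , n₂ , n≢ , e₁ , e₂ , m₁ , m₂ with n₁ ≟ y
  ...   | no r = n₁ , r , e₁ , m₁
  ...   | yes refl = n₂ , n≢ ∘ sym , e₂ , m₂

  close-circuit : ∀ {x y} pre {n post} → Unique (x ∷ y ∷ pre ++ n ∷ post) → All (_∈ W) (x ∷ y ∷ pre ++ n ∷ post) →
                  Consec (E H) (x ∷ y ∷ pre ++ n ∷ post) → E H x n →
                  IsCircuit H (x ∷ y ∷ pre ++ [ n ]) × All (_∈ W) (x ∷ y ∷ pre ++ [ n ])
  close-circuit {x} {y} pre {n} {post} u al c e =
    (u′ , long pre , (λ v v∈ → closed′ v∈) , closedWalk) , al′
    where
    eq : x ∷ y ∷ pre ++ n ∷ post ≡ (x ∷ y ∷ pre ++ [ n ]) ++ post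
    eq = cong (λ l → x ∷ y ∷ l) (sym (++-assoc pre [ n ] post))
    u′ = proj₁ (unique-++⁻ (x ∷ y ∷ pre ++ [ n ]) (subst Unique eq u))
    al′ = All.++⁻ˡ (x ∷ y ∷ pre ++ [ n ]) (subst (All (_∈ W)) eq al)
    long : ∀ pre → 3 ≤ length (x ∷ y ∷ pre ++ [ n ])
    long [] = ≤-refl
    long (_ ∷ []) = s≤s (s≤s (s≤s z≤n))
    long (_ ∷ _ ∷ _) = s≤s (s≤s (s≤s z≤n))
    closed′ : ∀ {v} → v ∈ x ∷ y ∷ pre ++ [ n ] → v ∈ V H
    closed′ v∈ = E-src (proj₁ (proj₂ (proj₂ (proj₂ (two (All.lookup al′ v∈))))))
    prefix : ∀ xs {zs} → Consec (E H) (xs ++ n ∷ zs) → Consec (E H) (xs ++ [ n ])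
    prefix [] _ = tt
    prefix (_ ∷ []) (r , _) = r , tt
    prefix (_ ∷ x′ ∷ xs) (r , c) = r , prefix (x′ ∷ xs) c
    closedWalk : Consec (E H) ((x ∷ y ∷ pre ++ [ n ]) ++ [ x ])
    closedWalk = subst (Consec (E H)) (cong (λ l → x ∷ y ∷ l) (sym (++-assoc pre [ n ] [ x ])))
                   (consec-++ (x ∷ y ∷ pre) (prefix (x ∷ y ∷ pre) c) (E-sym e , tt))

  grow-path : ∀ fuel x y xs → length W < fuel + length (x ∷ y ∷ xs) → Unique (x ∷ y ∷ xs) → All (_∈ W) (x ∷ y ∷ xs) →
              Consec (E H) (x ∷ y ∷ xs) → ∃[ cs ] (IsCircuit H cs × All (_∈ W) cs)
  grow-path zero x y xs lt u al c = contradiction (unique-⊆⇒length≤ u (All.lookup al)) (λ le → <-irrefl refl (≤-trans lt le))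
  grow-path (suc fuel) x y xs lt u al c with other-neighbour y (All.lookup al (here refl))
  ... | n , n≢y , e , n∈ with n ∈? (x ∷ y ∷ xs)
  ...   | no n∉ = grow-path fuel n x (y ∷ xs) (≤-trans lt (≤-reflexive (sym (+-suc fuel _)))) (unique-∷⁺ n∉ u) (n∈ ∷ al) (E-sym e , c)
  ...   | yes (here refl) = contradiction refl (E-irrefl e)
  ...   | yes (there (here refl)) = contradiction refl n≢y
  ...   | yes (there (there n∈xs)) with ∈-∃++ n∈xs
  ...     | pre , post , refl = _ , close-circuit pre u al c e

  min-degree-two⇒circuit : ∀ {v} → v ∈ W → ∃[ cs ] (IsCircuit H cs × All (_∈ W) cs)
  min-degree-two⇒circuit {v} v∈ with two v∈
  ... | n , _ , _ , e , _ , n∈ , _ = grow-path (length W) v n [] (≤-trans (≤-reflexive (+-comm 1 _)) (+-monoʳ-≤ (length W) (s≤s z≤n)))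
        ((E-irrefl e ∷ []) ∷ [] ∷ []) (v∈ ∷ n∈ ∷ []) (e , tt)

-- Counting the edges inside a vertex set

countB-↭ : ∀ p {xs ys} → xs ↭ ys → countB p xs ≡ countB p ys
countB-↭ p Perm.refl = refl
countB-↭ p (prep x σ) = cong (_ +_) (countB-↭ p σ)
countB-↭ p {x ∷ y ∷ xs} {_ ∷ _ ∷ ys} (swap x y σ) = trans (sym (+-assoc (bit x) (bit y) (countB p xs)))
  (trans (cong₂ _+_ (+-comm (bit x) (bit y)) (countB-↭ p σ)) (+-assoc (bit y) (bit x) (countB p ys)))
  where
  bit : ℕ → ℕ
  bit z = if p z then 1 else 0
countB-↭ p (Perm.trans σ τ) = trans (countB-↭ p σ) (countB-↭ p τ)

countB-true : ∀ p {x} xs → p x ≡ true → countB p (x ∷ xs) ≡ suc (countB p xs)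
countB-true p xs px rewrite px = refl

countB-hit : ∀ p x xs {k} → p x ≡ true → countB p (x ∷ xs) ≤ suc k → countB p xs ≤ k
countB-hit p x xs px le = s≤s⁻¹ (≤-trans (≤-reflexive (sym (countB-true p xs px))) le)

countB-skip : ∀ p x xs {k} → countB p (x ∷ xs) ≤ k → countB p xs ≤ k
countB-skip p x xs = ≤-trans (m≤n+m _ _)

module _ {G : Graph} (wf : WellFormed G) where
  open WF wf

  -- Each edge is counted once, at whichever of its ends comes first in the list.
  edgesIn : List ℕ → ℕ
  edgesIn [] = 0
  edgesIn (v ∷ vs) = countB (adj G v) vs + edgesIn vs

  edgesIn-↭ : ∀ {xs ys} → xs ↭ ys → edgesIn xs ≡ edgesIn ys
  edgesIn-↭ Perm.refl = refl
  edgesIn-↭ (prep x σ) = cong₂ _+_ (countB-↭ (adj G x) σ) (edgesIn-↭ σ)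
  edgesIn-↭ {_ ∷ _ ∷ xs} {_ ∷ _ ∷ ys} (swap x y σ)
    rewrite symm x y | countB-↭ (adj G x) σ | countB-↭ (adj G y) σ | edgesIn-↭ σ =
      rearrange (if adj G y x then 1 else 0) (countB (adj G x) ys) (countB (adj G y) ys) (edgesIn ys)
    where
    rearrange : ∀ a b c d → a + b + (c + d) ≡ a + c + (b + d)
    rearrange = solve-∀
  edgesIn-↭ (Perm.trans σ τ) = trans (edgesIn-↭ σ) (edgesIn-↭ τ)

  -- The two lists are separate so that the handshake induction can lengthen them one at a time.
  degreesIn : List ℕ → List ℕ → ℕ
  degreesIn Y [] = 0
  degreesIn Y (v ∷ vs) = countB (adj G v) Y + degreesIn Y vs

  degreesIn-∷ : ∀ y Y xs → degreesIn (y ∷ Y) xs ≡ countB (adj G y) xs + degreesIn Y xs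
  degreesIn-∷ y Y [] = refl
  degreesIn-∷ y Y (x ∷ xs) rewrite degreesIn-∷ y Y xs | symm x y =
    rearrange (if adj G y x then 1 else 0) (countB (adj G x) Y) (countB (adj G y) xs) (degreesIn Y xs)
    where
    rearrange : ∀ a b c d → a + b + (c + d) ≡ a + c + (b + d)
    rearrange = solve-∀

  handshake : ∀ xs → degreesIn xs xs ≡ edgesIn xs + edgesIn xs
  handshake [] = refl
  handshake (x ∷ xs) rewrite irrefl x | degreesIn-∷ x xs xs | handshake xs = rearrange (countB (adj G x) xs) (edgesIn xs)
    where
    rearrange : ∀ a b → a + (a + (b + b)) ≡ a + b + (a + b)
    rearrange = solve-∀

  -- A forest has fewer edges than vertices: deleting a vertex of degree at most one keeps the inequality, so a nonempty core of minimum degree two is left.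
  core : ∀ n Y → length Y ≤ n → Unique Y → 1 ≤ length Y → length Y ≤ edgesIn Y →
         ∃[ K ] (K ⊆ Y × (∃[ v ] v ∈ K) × (∀ {v} → v ∈ K → ∃₂ λ n₁ n₂ → n₁ ≢ n₂ × E G v n₁ × E G v n₂ × n₁ ∈ K × n₂ ∈ K))
  core zero [] _ _ () _
  core (suc n) Y le u ne dense with any? (λ v → countB (adj G v) Y ≤? 1) Y
  core (suc n) (v ∷ Y) le u ne dense | no none = v ∷ Y , id , (v , here refl) , two
    where
    two : ∀ {w} → w ∈ v ∷ Y → ∃₂ λ n₁ n₂ → n₁ ≢ n₂ × E G w n₁ × E G w n₂ × n₁ ∈ v ∷ Y × n₂ ∈ v ∷ Y
    two w∈ with ≰⇒> (λ le₁ → none (lose w∈ le₁))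
    ... | lt with countB-escape u [] (≤-trans (s≤s z≤n) lt)
    ...   | n₁ , m₁ , e₁ , _ with countB-escape u (n₁ ∷ []) lt
    ...     | n₂ , m₂ , e₂ , n₂∉ = n₁ , n₂ , (λ { refl → n₂∉ (here refl) }) , e₁ , e₂ , m₁ , m₂
  ... | yes w with find w
  ...   | v , v∈ , dv with ∈-∃++ v∈
  ...     | ls , rs , refl with core n (ls ++ rs) (s≤s⁻¹ (≤-trans (≤-reflexive (sym (↭-length σ))) le))
                                  (unique-∷⁻ (unique-resp-↭ σ u)) (nonempty (ls ++ rs) dense″) dense′
    where
    σ = shift v ls rs
    dv′ : countB (adj G v) (ls ++ rs) ≤ 1
    dv′ = ≤-trans (m≤n+m _ _) (≤-trans (≤-reflexive (sym (countB-↭ (adj G v) σ))) dv)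
    dense″ : suc (length (ls ++ rs)) ≤ countB (adj G v) (ls ++ rs) + edgesIn (ls ++ rs)
    dense″ = ≤-trans (≤-reflexive (sym (↭-length σ))) (≤-trans dense (≤-reflexive (edgesIn-↭ σ)))
    dense′ : length (ls ++ rs) ≤ edgesIn (ls ++ rs)
    dense′ = s≤s⁻¹ (≤-trans dense″ (+-monoˡ-≤ _ dv′))
    nonempty : ∀ Z → suc (length Z) ≤ countB (adj G v) Z + edgesIn Z → 1 ≤ length Z
    nonempty [] ()
    nonempty (_ ∷ _) _ = s≤s z≤n
  ...       | K , K⊆ , ne′ , two = K , (λ k∈ → ∈-resp-↭ (↭-sym σ) (there (K⊆ k∈))) , ne′ , two
    where σ = shift v ls rs

  module _ (cub : ∀ v → v ∈ V G → deg G v ≡ 3) where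

    degreesIn-cubic : ∀ xs → xs ⊆ V G → degreesIn (V G) xs ≡ 3 * length xs
    degreesIn-cubic [] _ = refl
    degreesIn-cubic (x ∷ xs) sub rewrite cub x (sub (here refl)) | degreesIn-cubic xs (sub ∘ there) = rearrange (length xs)
      where
      rearrange : ∀ a → 3 + 3 * a ≡ 3 * (1 + a)
      rearrange = solve-∀

    -- The corners account for at most 3 + 2 + 2 + 1 = 8 edges, since an edge to an earlier corner
    -- has been counted already. With m vertices and e edges off the square, the handshake identity
    -- gives 3(4 + m) ≤ 2(8 + e), that is 3m ≤ 2e + 4, whereas e < m and m ≥ 4 would give 3m ≥ 2e +
    -- 6.
    off-square-dense : ∀ {c₁ c₂ c₃ c₄ W} → V G ↭ c₁ ∷ c₂ ∷ c₃ ∷ c₄ ∷ W →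
      E G c₁ c₂ → E G c₂ c₃ → E G c₃ c₄ → E G c₄ c₁ → 8 ≤ length (V G) → length W ≤ edgesIn W × 1 ≤ length W
    off-square-dense {c₁} {c₂} {c₃} {c₄} {W} σ e₁₂ e₂₃ e₃₄ e₄₁ big = dense , nonempty W (subst (8 ≤_) (↭-length σ) big)
      where
      bounded : ∀ {v} → v ∈ V G → countB (adj G v) (c₁ ∷ c₂ ∷ c₃ ∷ c₄ ∷ W) ≤ 3
      bounded {v} v∈ = ≤-reflexive (trans (sym (countB-↭ (adj G v) σ)) (cub v v∈))
      m = length W
      W₄ = c₄ ∷ W
      W₃ = c₃ ∷ W₄
      W₂ = c₂ ∷ W₃
      a₁ : countB (adj G c₁) W₂ ≤ 3
      a₁ = countB-skip (adj G c₁) c₁ W₂ (bounded (E-src e₁₂))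
      a₂ : countB (adj G c₂) W₃ ≤ 2
      a₂ = countB-skip (adj G c₂) c₂ W₃ (countB-hit (adj G c₂) c₁ W₂ (E-sym e₁₂) (bounded (E-src e₂₃)))
      a₃ : countB (adj G c₃) W₄ ≤ 2
      a₃ = countB-skip (adj G c₃) c₃ W₄ (countB-hit (adj G c₃) c₂ W₃ (E-sym e₂₃)
             (countB-skip (adj G c₃) c₁ W₂ (bounded (E-src e₃₄))))
      a₄ : countB (adj G c₄) W ≤ 1
      a₄ = countB-skip (adj G c₄) c₄ W (countB-hit (adj G c₄) c₃ W₄ (E-sym e₃₄) (countB-skip (adj G c₄) c₂ W₃
             (countB-hit (adj G c₄) c₁ W₂ e₄₁ (bounded (E-src e₄₁)))))
      total : edgesIn (V G) ≤ 8 + edgesIn W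
      total = ≤-trans (≤-reflexive (edgesIn-↭ σ)) (+-mono-≤ a₁ (+-mono-≤ a₂ (+-mono-≤ a₃ (+-monoˡ-≤ (edgesIn W) a₄))))
      twice : 3 * (4 + m) ≤ (8 + edgesIn W) + (8 + edgesIn W)
      twice = ≤-trans (≤-reflexive (trans (cong (3 *_) (sym (↭-length σ))) (trans (sym (degreesIn-cubic (V G) id)) (handshake (V G)))))
                (+-mono-≤ total total)
      dense : m ≤ edgesIn W
      dense with m ≤? edgesIn W
      ... | yes le = le
      ... | no gt = contradiction (≤-trans step twice′) (<-irrefl refl)
        where
        e = edgesIn W
        4≤m : 4 ≤ m
        4≤m = +-cancelˡ-≤ 4 4 m (subst (8 ≤_) (↭-length σ) big)
        lhs : ∀ m → 3 * (4 + m) ≡ m + m + m + 12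
        lhs = solve-∀
        rhs : ∀ e → (8 + e) + (8 + e) ≡ e + e + 4 + 12
        rhs = solve-∀
        twice′ : m + m + m ≤ e + e + 4
        twice′ = +-cancelʳ-≤ 12 _ _ (subst₂ _≤_ (lhs m) (rhs e) twice)
        step : suc (e + e + 4) ≤ m + m + m
        step = +-mono-≤ (≤-trans (≤-trans (n≤1+n _) (≤-reflexive (sym (cong suc (+-suc e e))))) (+-mono-≤ (≰⇒> gt) (≰⇒> gt))) 4≤m
      nonempty : ∀ W → 8 ≤ 4 + length W → 1 ≤ length W
      nonempty [] (s≤s (s≤s (s≤s (s≤s ()))))
      nonempty (_ ∷ _) _ = s≤s z≤n

-- Bounding a cut

module _ {H : Graph} (wf : WellFormed H) (X : ℕ → Bool) where
  open WellFormed wf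

  private
    leaves? : ∀ u v → Dec (adj H u v ∧ not (X v) ≡ true)
    leaves? u v = (adj H u v ∧ not (X v)) Bool.≟ true

    cutAt : ℕ → List (ℕ × ℕ)
    cutAt u = if X u then map (u ,_) (filter (leaves? u) (V H)) else []

    cutPairs : List ℕ → List (ℕ × ℕ)
    cutPairs [] = []
    cutPairs (u ∷ us) = cutAt u ++ cutPairs us

    cutAt-∈ : ∀ {u a b} → (a , b) ∈ cutAt u → a ≡ u × X u ≡ true × E H u b × X b ≡ false
    cutAt-∈ {u} p∈ with X u
    ... | true with ∈-map⁻ (u ,_) p∈
    ...   | b , b∈ , refl with ∈-filter⁻ (leaves? u) {xs = V H} b∈
    ...     | _ , r = refl , refl , ∧-split r
      where
      ∧-split : ∀ {x y} → x ∧ not y ≡ true → x ≡ true × y ≡ false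
      ∧-split {true} {false} _ = refl , refl

    cutPairs-∈ : ∀ us {a b} → (a , b) ∈ cutPairs us → a ∈ us × X a ≡ true × E H a b × X b ≡ false
    cutPairs-∈ (u ∷ us) p∈ with ∈-++⁻ (cutAt u) p∈
    ... | inj₁ q with cutAt-∈ q
    ...   | refl , r = here refl , r
    cutPairs-∈ (u ∷ us) p∈ | inj₂ q with cutPairs-∈ us q
    ... | m , r = there m , r

    cutAt-unique : ∀ u → Unique (cutAt u)
    cutAt-unique u with X u
    ... | true = Unique.map⁺ (λ { refl → refl }) (Unique.filter⁺ (leaves? u) uniqueV)
    ... | false = []

    cutPairs-unique : ∀ {us} → Unique us → Unique (cutPairs us)
    cutPairs-unique [] = []
    cutPairs-unique {u ∷ us} (u∉ ∷ uus) = Unique.++⁺ (cutAt-unique u) (cutPairs-unique uus)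
      λ { {a , b} (p , q) → All.lookup u∉ (subst (_∈ us) (proj₁ (cutAt-∈ p)) (proj₁ (cutPairs-∈ us q))) refl }

    cutAt-length : ∀ u → (if X u then countB (λ v → adj H u v ∧ not (X v)) (V H) else 0) ≡ length (cutAt u)
    cutAt-length u with X u
    ... | true = trans (countB≡length-filter _ (V H)) (sym (length-map (u ,_) (filter (leaves? u) (V H))))
    ... | false = refl

    cutPairs-length : ∀ us → foldr (λ u acc → (if X u then countB (λ v → adj H u v ∧ not (X v)) (V H) else 0) + acc) 0 us ≡ length (cutPairs us)
    cutPairs-length [] = refl
    cutPairs-length (u ∷ us) = trans (cong₂ _+_ (cutAt-length u) (cutPairs-length us)) (sym (length-++ (cutAt u)))

  -- `cut` is the length of a duplicate-free list of the edges leaving `X`, each directed outwards,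
  -- so every list containing them all is at least as long.
  cut-≤ : ∀ ps → (∀ {u v} → X u ≡ true → X v ≡ false → E H u v → (u , v) ∈ ps) → cut H X ≤ length ps
  cut-≤ ps cover = ≤-trans (≤-reflexive (cutPairs-length (V H)))
    (unique-⊆⇒length≤ (cutPairs-unique uniqueV) λ { {u , v} p∈ → let _ , xu , e , xv = cutPairs-∈ (V H) p∈ in cover xu xv e })

-- Paths of an embedding

dropLast : List ℕ → List ℕ
dropLast [] = []
dropLast (x ∷ []) = []
dropLast (x ∷ y ∷ xs) = x ∷ dropLast (y ∷ xs)

inside : List ℕ → List ℕ
inside [] = []
inside (x ∷ xs) = dropLast xs

dropLast-snoc : ∀ xs {t} → dropLast (xs ++ [ t ]) ≡ xs
dropLast-snoc [] = refl
dropLast-snoc (x ∷ []) = refl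
dropLast-snoc (x ∷ y ∷ xs) = cong (x ∷_) (dropLast-snoc (y ∷ xs))

last⇒snoc : ∀ (xs : List ℕ) {t} → last xs ≡ just t → xs ≡ dropLast xs ++ [ t ]
last⇒snoc (x ∷ []) refl = refl
last⇒snoc (x ∷ y ∷ xs) eq = cong (x ∷_) (last⇒snoc (y ∷ xs) eq)

last-snoc : ∀ (xs : List ℕ) {t} → last (xs ++ [ t ]) ≡ just t
last-snoc [] = refl
last-snoc (x ∷ []) = refl
last-snoc (x ∷ y ∷ xs) = last-snoc (y ∷ xs)

path-shape : ∀ {H s t p} → s ≢ t → IsPath H s t p → p ≡ s ∷ inside p ++ [ t ]
path-shape {p = x ∷ []} s≢t (_ , _ , refl , refl) = contradiction refl s≢t
path-shape {p = x ∷ y ∷ p} _ (_ , _ , refl , l) = cong (x ∷_) (last⇒snoc (y ∷ p) l)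

reverse-shape : ∀ (s : ℕ) is t → reverse (s ∷ is ++ [ t ]) ≡ t ∷ reverse is ++ [ s ]
reverse-shape s is t = trans (unfold-reverse s (is ++ [ t ])) (cong (_++ [ s ]) (reverse-++ is [ t ]))

distinct-sym : ∀ {a b c d} → DistinctEdges a b c d → DistinctEdges c d a b
distinct-sym (p , q) = (λ { (refl , refl) → p (refl , refl) }) , λ { (refl , refl) → q (refl , refl) }

distinct? : ∀ a b c d → DistinctEdges a b c d ⊎ ((a ≡ c × b ≡ d) ⊎ (a ≡ d × b ≡ c))
distinct? a b c d with (a ≟ c) ×-dec (b ≟ d) | (a ≟ d) ×-dec (b ≟ c)
... | yes p | _ = inj₂ (inj₁ p)
... | no _ | yes q = inj₂ (inj₂ q)
... | no p | no q = inj₁ (p , q)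

seqEdge-∈ : ∀ p {u v} → SeqEdge p u v → u ∈ p × v ∈ p
seqEdge-∈ (x ∷ y ∷ p) (inj₁ (inj₁ (refl , refl))) = here refl , there (here refl)
seqEdge-∈ (x ∷ y ∷ p) (inj₁ (inj₂ (refl , refl))) = there (here refl) , here refl
seqEdge-∈ (x ∷ y ∷ p) (inj₂ s) = let a , b = seqEdge-∈ (y ∷ p) s in there a , there b

seqEdge-≢ : ∀ p {u v} → Unique p → SeqEdge p u v → u ≢ v
seqEdge-≢ (x ∷ y ∷ p) ((x≢y ∷ _) ∷ _) (inj₁ (inj₁ (refl , refl))) = x≢y
seqEdge-≢ (x ∷ y ∷ p) ((x≢y ∷ _) ∷ _) (inj₁ (inj₂ (refl , refl))) = x≢y ∘ sym
seqEdge-≢ (x ∷ y ∷ p) (_ ∷ u) (inj₂ s) = seqEdge-≢ (y ∷ p) u s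

seqEdge-sym : ∀ p {u v} → SeqEdge p u v → SeqEdge p v u
seqEdge-sym (x ∷ y ∷ p) (inj₁ s) = inj₁ (Sum.swap s)
seqEdge-sym (x ∷ y ∷ p) (inj₂ s) = inj₂ (seqEdge-sym (y ∷ p) s)

-- An edge shared by two thread paths has no inner vertex among its ends, hence joins the same two branch vertices.
module _ {G : Graph} (wfG : WellFormed G) {η : ℕ → ℕ} {P : ℕ → ℕ → List ℕ}
  (η-inj : ∀ u v → u ∈ V G → v ∈ V G → η u ≡ η v → u ≡ v)
  (unique : ∀ a b → E G a b → Unique (P a b))
  (disjV : ∀ a b c d → E G a b → E G c d → DistinctEdges a b c d → ∀ v → Inner (η a) (η b) (P a b) v → ¬ (v ∈ P c d)) where
  open WF wfG

  private
    end : ∀ {a b c d v} → E G a b → E G c d → DistinctEdges a b c d → v ∈ P a b → v ∈ P c d → v ≡ η a ⊎ v ≡ η b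
    end {a} {b} {c} {d} {v} e f ne v∈ v∈′ with v ≟ η a | v ≟ η b
    ... | yes p | _ = inj₁ p
    ... | no _ | yes q = inj₂ q
    ... | no p | no q = contradiction v∈′ (disjV a b c d e f ne v (v∈ , p , q))

    two-ends : ∀ {a b u v : ℕ} → u ≢ v → u ≡ a ⊎ u ≡ b → v ≡ a ⊎ v ≡ b → (u ≡ a × v ≡ b) ⊎ (u ≡ b × v ≡ a)
    two-ends u≢v (inj₁ p) (inj₂ q) = inj₁ (p , q)
    two-ends u≢v (inj₂ p) (inj₁ q) = inj₂ (p , q)
    two-ends u≢v (inj₁ refl) (inj₁ refl) = contradiction refl u≢v
    two-ends u≢v (inj₂ refl) (inj₂ refl) = contradiction refl u≢v

  edge-disjoint : ∀ a b c d → E G a b → E G c d → DistinctEdges a b c d → ∀ u v → SeqEdge (P a b) u v → ¬ SeqEdge (P c d) u v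
  edge-disjoint a b c d e f ne u v s t with seqEdge-∈ (P a b) s | seqEdge-∈ (P c d) t | seqEdge-≢ (P a b) (unique a b e) s
  ... | u∈ , v∈ | u∈′ , v∈′ | u≢v
    with two-ends u≢v (end e f ne u∈ u∈′) (end e f ne v∈ v∈′)
       | two-ends u≢v (end f e (distinct-sym ne) u∈′ u∈) (end f e (distinct-sym ne) v∈′ v∈)
  ... | inj₁ (p , q) | inj₁ (r , s) = proj₁ ne (η-inj a c (E-src e) (E-src f) (trans (sym p) r) , η-inj b d (E-tgt e) (E-tgt f) (trans (sym q) s))
  ... | inj₁ (p , q) | inj₂ (r , s) = proj₂ ne (η-inj a d (E-src e) (E-tgt f) (trans (sym p) r) , η-inj b c (E-tgt e) (E-src f) (trans (sym q) s))
  ... | inj₂ (p , q) | inj₁ (r , s) = proj₂ ne (η-inj a d (E-src e) (E-tgt f) (trans (sym q) s) , η-inj b c (E-tgt e) (E-src f) (trans (sym p) r))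
  ... | inj₂ (p , q) | inj₂ (r , s) = proj₁ ne (η-inj a c (E-src e) (E-src f) (trans (sym q) s) , η-inj b d (E-tgt e) (E-tgt f) (trans (sym p) r))

module Emb {F G H : Graph} (wfG : WellFormed G) (e : Embedding F G H) where
  open Embedding e public
  open WF wfG

  I : ℕ → ℕ → List ℕ
  I a b = inside (P a b)

  η-≢ : ∀ {a b} → E G a b → η a ≢ η b
  η-≢ ab eq = E-irrefl ab (η-inj _ _ (E-src ab) (E-tgt ab) eq)

  P-shape : ∀ {a b} → E G a b → P a b ≡ η a ∷ I a b ++ [ η b ]
  P-shape {a} {b} ab = path-shape {H} (η-≢ ab) (P-path a b ab)

  I-chain : ∀ {a b} → E G a b → Chain (E H) (η a) (I a b) (η b)
  I-chain {a} {b} ab = consec⇒chain (I a b) (subst (Consec (E H)) (P-shape ab) (proj₁ (proj₂ (P-path a b ab))))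

  P-unique : ∀ {a b} → E G a b → Unique (η a ∷ I a b ++ [ η b ])
  P-unique {a} {b} ab = subst Unique (P-shape ab) (proj₁ (P-path a b ab))

  I-unique : ∀ {a b} → E G a b → Unique (I a b)
  I-unique {a} {b} ab = proj₁ (unique-++⁻ (I a b) (unique-∷⁻ (P-unique ab)))

  I⊆P : ∀ {a b v} → E G a b → v ∈ I a b → v ∈ P a b
  I⊆P ab v∈ = subst (_ ∈_) (sym (P-shape ab)) (there (∈-++⁺ˡ v∈))

  I-inner : ∀ {a b v} → E G a b → v ∈ I a b → Inner (η a) (η b) (P a b) v
  I-inner {a} {b} ab v∈ = I⊆P ab v∈ , (λ { refl → Unique.Unique[x∷xs]⇒x∉xs (P-unique ab) (∈-++⁺ˡ v∈) }) ,
    λ { refl → proj₂ (proj₂ (unique-++⁻ (I a b) (unique-∷⁻ (P-unique ab)))) (v∈ , here refl) }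

  I-rev : ∀ {a b} → E G a b → I b a ≡ reverse (I a b)
  I-rev {a} {b} ab = trans (cong inside (trans (P-sym a b ab) (trans (cong reverse (P-shape ab)) (reverse-shape (η a) (I a b) (η b)))))
    (dropLast-snoc (reverse (I a b)))

  I-η : ∀ {a b w} → E G a b → w ∈ V G → η w ∉ I a b
  I-η {a} {b} {w} ab w∈ m with Equivalence.to (ends w a b w∈ ab) (I⊆P ab m) | I-inner ab m
  ... | inj₁ refl | _ , n , _ = n refl
  ... | inj₂ refl | _ , _ , n = n refl

  I-disjoint : ∀ {a b c d v} → E G a b → E G c d → DistinctEdges a b c d → v ∈ I a b → v ∉ I c d
  I-disjoint ab cd ne v∈ v∈′ = disjV _ _ _ _ ab cd ne _ (I-inner ab v∈) (I⊆P cd v∈′)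

  I-same : ∀ {a b c d v} → E G a b → E G c d → v ∈ I a b → v ∈ I c d → (a ≡ c × b ≡ d) ⊎ (a ≡ d × b ≡ c)
  I-same {a} {b} {c} {d} ab cd v∈ v∈′ with distinct? a b c d
  ... | inj₁ ne = contradiction v∈′ (I-disjoint ab cd ne v∈)
  ... | inj₂ same = same

  -- An inner vertex lies on the image of one edge only and is never a branch vertex. What remains
  -- is that both images are single edges, and there `η` is injective.
  first-injective : ∀ {w b c} → E G w b → E G w c → first (I w b) (η b) ≡ first (I w c) (η c) → b ≡ c
  first-injective {w} {b} {c} wb wc eq with ∈-++⁻ (I w b) (first-∈ (I w b) (η b)) | ∈-++⁻ (I w c) (first-∈ (I w c) (η c))
  ... | inj₁ m | inj₁ m′ with I-same wb wc m (subst (_∈ I w c) (sym eq) m′)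
  ...   | inj₁ (_ , r) = r
  ...   | inj₂ (refl , refl) = refl
  first-injective {w} {b} {c} wb wc eq | inj₁ m | inj₂ (here r) = contradiction (subst (_∈ I w b) (trans eq r) m) (I-η wb (E-tgt wc))
  first-injective {w} {b} {c} wb wc eq | inj₂ (here r) | inj₁ m = contradiction (subst (_∈ I w c) (trans (sym eq) r) m) (I-η wc (E-tgt wb))
  first-injective {w} {b} {c} wb wc eq | inj₂ (here r) | inj₂ (here s) = η-inj b c (E-tgt wb) (E-tgt wc) (trans (sym r) (trans eq s))

  -- The images of the three edges at `w` leave `η w` by three different edges, and a cubic `H` has
  -- no fourth.
  branch-neighbour : (∀ v → v ∈ V G → deg G v ≡ 3) → Cubic H → ∀ {w q} → w ∈ V G → E H (η w) q →
                     ∃[ b ] (E G w b × first (I w b) (η b) ≡ q)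
  branch-neighbour cub cubH {w} {q} w∈ wq
    with countB-escape {adj G w} uniqueV [] (≤-trans (s≤s z≤n) (≤-reflexive (sym (cub w w∈))))
  ... | a , _ , wa , _
    with countB-escape {adj G w} uniqueV [ a ] (≤-trans (s≤s (s≤s z≤n)) (≤-reflexive (sym (cub w w∈))))
  ... | b , _ , wb , b∉ with cubic-third {G} (wfG , cub) wa wb (λ { refl → b∉ (here refl) })
  ... | c , wc , c≢a , c≢b , _
    with cubic-saturated cubH (chain-first (I-chain wa)) (chain-first (I-chain wb)) (chain-first (I-chain wc))
           (λ eq → b∉ (here (sym (first-injective wa wb eq)))) (λ eq → c≢a (sym (first-injective wa wc eq)))
           (λ eq → c≢b (sym (first-injective wb wc eq))) wq
  ... | inj₁ r = a , wa , sym r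
  ... | inj₂ (inj₁ r) = b , wb , sym r
  ... | inj₂ (inj₂ r) = c , wc , sym r

-- Composition of embeddings

last-++ : ∀ (xs : List ℕ) {y ys} → last (xs ++ y ∷ ys) ≡ last (y ∷ ys)
last-++ [] = refl
last-++ (x ∷ []) = refl
last-++ (x ∷ x′ ∷ xs) = last-++ (x′ ∷ xs)

consec-seqEdge : ∀ {R : ℕ → ℕ → Set} → (∀ {u v} → R u v → R v u) → ∀ p {u v} → Consec R p → SeqEdge p u v → R u v
consec-seqEdge s (x ∷ y ∷ p) (r , c) (inj₁ (inj₁ (refl , refl))) = r
consec-seqEdge s (x ∷ y ∷ p) (r , c) (inj₁ (inj₂ (refl , refl))) = s r
consec-seqEdge s (x ∷ y ∷ p) (r , c) (inj₂ q) = consec-seqEdge s (y ∷ p) c q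

module Expand {F M H : Graph} (wfM : WellFormed M) (e : Embedding F M H) where
  open Emb wfM e
  open WF wfM

  expandFrom : ℕ → List ℕ → List ℕ
  expandFrom w [] = []
  expandFrom w (w′ ∷ ws) = I w w′ ++ η w′ ∷ expandFrom w′ ws

  expand : List ℕ → List ℕ
  expand [] = []
  expand (w ∷ ws) = η w ∷ expandFrom w ws

  ∈-expand⁻ : ∀ p {v} → v ∈ expand p → (∃[ w ] (w ∈ p × v ≡ η w)) ⊎ (∃₂ λ u w → SeqEdge p u w × v ∈ I u w)
  ∈-expand⁻ (w ∷ ws) = go w ws
    where
    go : ∀ w ws {v} → v ∈ expand (w ∷ ws) → (∃[ u ] (u ∈ w ∷ ws × v ≡ η u)) ⊎ (∃₂ λ u u′ → SeqEdge (w ∷ ws) u u′ × v ∈ I u u′)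
    go w ws (here refl) = inj₁ (w , here refl , refl)
    go w (w′ ∷ ws) (there m) with ∈-++⁻ (I w w′) m
    ... | inj₁ m′ = inj₂ (w , w′ , inj₁ (inj₁ (refl , refl)) , m′)
    ... | inj₂ m′ with go w′ ws m′
    ...   | inj₁ (u , u∈ , eq) = inj₁ (u , there u∈ , eq)
    ...   | inj₂ (u , u′ , s , i) = inj₂ (u , u′ , inj₂ s , i)

  ∈-expand⁺ : ∀ p {w} → w ∈ p → η w ∈ expand p
  ∈-expand⁺ (w ∷ ws) (here refl) = here refl
  ∈-expand⁺ (w ∷ w′ ∷ ws) (there m) = there (∈-++⁺ʳ (I w w′) (∈-expand⁺ (w′ ∷ ws) m))

  -- A repeated inner vertex would make the edge from `w` to `w′` recur along the path, and with it
  -- the vertex `w`.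
  expand-unique : ∀ p → All (_∈ V M) p → Unique p → Consec (E M) p → Unique (expand p)
  expand-unique [] _ _ _ = []
  expand-unique (w ∷ []) _ _ _ = [] ∷ []
  expand-unique (w ∷ w′ ∷ ws) (w∈ ∷ al) u@(_ ∷ u′) (r , c) =
    unique-∷⁺ fresh (Unique.++⁺ (I-unique r) (expand-unique (w′ ∷ ws) al u′ c) disjoint)
    where
    w∉ = Unique.Unique[x∷xs]⇒x∉xs u
    edge′ : ∀ {u v} → SeqEdge (w′ ∷ ws) u v → E M u v
    edge′ = consec-seqEdge E-sym (w′ ∷ ws) c
    fresh : η w ∉ I w w′ ++ expand (w′ ∷ ws)
    fresh m with ∈-++⁻ (I w w′) m
    ... | inj₁ i = I-η r w∈ i
    ... | inj₂ m′ with ∈-expand⁻ (w′ ∷ ws) m′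
    ...   | inj₁ (u , u∈ , eq) = w∉ (subst (_∈ w′ ∷ ws) (sym (η-inj w u w∈ (All.lookup al u∈) eq)) u∈)
    ...   | inj₂ (u , u′ , s , i) = I-η (edge′ s) w∈ i
    disjoint : Disjoint (I w w′) (expand (w′ ∷ ws))
    disjoint (i , m) with ∈-expand⁻ (w′ ∷ ws) m
    ... | inj₁ (u , u∈ , refl) = I-η r (All.lookup al u∈) i
    ... | inj₂ (u , u′ , s , j) with I-same r (edge′ s) i j
    ...   | inj₁ (refl , _) = w∉ (proj₁ (seqEdge-∈ (w′ ∷ ws) s))
    ...   | inj₂ (refl , _) = w∉ (proj₂ (seqEdge-∈ (w′ ∷ ws) s))

  expand-consec : ∀ p → Consec (E M) p → Consec (E H) (expand p)
  expand-consec [] _ = tt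
  expand-consec (w ∷ []) _ = tt
  expand-consec (w ∷ w′ ∷ ws) (r , c) = consec-++ (η w ∷ I w w′) (chain⇒consec (I-chain r)) (expand-consec (w′ ∷ ws) c)

  expand-head : ∀ p {s} → head p ≡ just s → head (expand p) ≡ just (η s)
  expand-head (_ ∷ _) refl = refl

  expand-last : ∀ p {t} → last p ≡ just t → last (expand p) ≡ just (η t)
  expand-last (w ∷ []) refl = refl
  expand-last (w ∷ w′ ∷ ws) eq = trans (last-++ (η w ∷ I w w′)) (expand-last (w′ ∷ ws) eq)

  -- `expand` recurses from the front, while reversing a path appends at its back.
  expand-snoc : ∀ xs w′ w → expand (xs ++ w′ ∷ w ∷ []) ≡ expand (xs ++ [ w′ ]) ++ I w′ w ++ [ η w ]
  expand-snoc [] w′ w = refl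
  expand-snoc (x ∷ xs) w′ w = cong (η x ∷_) (go x xs)
    where
    go : ∀ x xs → expandFrom x (xs ++ w′ ∷ w ∷ []) ≡ expandFrom x (xs ++ [ w′ ]) ++ I w′ w ++ [ η w ]
    go x [] = sym (++-assoc (I x w′) [ η w′ ] _)
    go x (y ∷ xs) = trans (cong (λ l → I x y ++ η y ∷ l) (go y xs)) (sym (++-assoc (I x y) (η y ∷ expandFrom y (xs ++ [ w′ ])) _))

  expand-reverse : ∀ p → Consec (E M) p → expand (reverse p) ≡ reverse (expand p)
  expand-reverse [] _ = refl
  expand-reverse (w ∷ []) _ = refl
  expand-reverse (w ∷ w′ ∷ ws) (r , c) = begin
    expand (reverse (w ∷ w′ ∷ ws))                                ≡⟨ cong expand (trans (unfold-reverse w (w′ ∷ ws)) (cong (_++ [ w ]) (unfold-reverse w′ ws))) ⟩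
    expand ((reverse ws ++ [ w′ ]) ++ [ w ])                      ≡⟨ cong expand (++-assoc (reverse ws) [ w′ ] [ w ]) ⟩
    expand (reverse ws ++ w′ ∷ w ∷ [])                            ≡⟨ expand-snoc (reverse ws) w′ w ⟩
    expand (reverse ws ++ [ w′ ]) ++ I w′ w ++ [ η w ]            ≡⟨ cong₂ (λ l i → expand l ++ i ++ [ η w ]) (sym (unfold-reverse w′ ws)) (I-rev r) ⟩
    expand (reverse (w′ ∷ ws)) ++ reverse (I w w′) ++ [ η w ]     ≡⟨ cong (_++ _) (expand-reverse (w′ ∷ ws) c) ⟩
    reverse (expand (w′ ∷ ws)) ++ reverse (I w w′) ++ [ η w ]     ≡⟨ sym (++-assoc (reverse (expand (w′ ∷ ws))) (reverse (I w w′)) [ η w ]) ⟩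
    (reverse (expand (w′ ∷ ws)) ++ reverse (I w w′)) ++ [ η w ]   ≡⟨ cong (_++ [ η w ]) (sym (reverse-++ (I w w′) (expand (w′ ∷ ws)))) ⟩
    reverse (I w w′ ++ expand (w′ ∷ ws)) ++ [ η w ]               ≡⟨ sym (unfold-reverse (η w) (I w w′ ++ expand (w′ ∷ ws))) ⟩
    reverse (expand (w ∷ w′ ∷ ws))                                ∎
    where open ≡-Reasoning

module _ {F L M H : Graph} (wfF : WellFormed F) (wfL : WellFormed L) (wfM : WellFormed M)
         (F⊆L : Subgraph F L) (inner : Embedding F L M) (outer : Embedding F M H) where

  private
    module A = Emb wfL inner
    module B = Emb wfM outer
    module L = WF wfL
    module M = WF wfM
    module F = WF wfF
  open Expand wfM outer

  private
    A-consec : ∀ {a b} → E L a b → Consec (E M) (A.P a b)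
    A-consec {a} {b} ab = proj₁ (proj₂ (A.P-path a b ab))

    A-V : ∀ {a b} → E L a b → All (_∈ V M) (A.P a b)
    A-V {a} {b} ab = subst (All (_∈ V M)) (sym (A.P-shape ab)) (go (A.I-chain ab))
      where
      go : ∀ {x is y} → Chain (E M) x is y → All (_∈ V M) (x ∷ is ++ [ y ])
      go (edge r) = M.E-src r ∷ M.E-tgt r ∷ []
      go (r ◅ c) = M.E-src r ∷ go c

    A-edge : ∀ {a b u v} → E L a b → SeqEdge (A.P a b) u v → E M u v
    A-edge {a} {b} ab = consec-seqEdge M.E-sym (A.P a b) (A-consec ab)

    Q : ℕ → ℕ → List ℕ
    Q a b = expand (A.P a b)

    Q-unique : ∀ a b → E L a b → Unique (Q a b)
    Q-unique a b ab = expand-unique (A.P a b) (A-V ab) (proj₁ (A.P-path a b ab)) (A-consec ab)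

    inj : ∀ u v → u ∈ V L → v ∈ V L → B.η (A.η u) ≡ B.η (A.η v) → u ≡ v
    inj u v u∈ v∈ eq = A.η-inj u v u∈ v∈ (B.η-inj _ _ (A.η-in u u∈) (A.η-in v v∈) eq)

    -- A common vertex is either the image of a vertex of `M`, where disjointness of the inner paths
    -- applies, or inner to the image of one edge of `M`. That edge would lie on both inner paths,
    -- which is excluded by their edge-disjointness.
    Q-disjV : ∀ a b c d → E L a b → E L c d → DistinctEdges a b c d → ∀ v → Inner (B.η (A.η a)) (B.η (A.η b)) (Q a b) v → ¬ (v ∈ Q c d)
    Q-disjV a b c d ab cd ne v (v∈ , v≢a , v≢b) v∈′ with ∈-expand⁻ (A.P a b) v∈ | ∈-expand⁻ (A.P c d) v∈′
    ... | inj₁ (w , w∈ , refl) | inj₁ (w′ , w∈′ , eq) with B.η-inj w w′ (All.lookup (A-V ab) w∈) (All.lookup (A-V cd) w∈′) eq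
    ...   | refl = A.disjV a b c d ab cd ne w (w∈ , (λ { refl → v≢a refl }) , (λ { refl → v≢b refl })) w∈′
    Q-disjV a b c d ab cd ne v _ _ | inj₁ (w , w∈ , refl) | inj₂ (x , y , s , i) = B.I-η (A-edge cd s) (All.lookup (A-V ab) w∈) i
    Q-disjV a b c d ab cd ne v _ _ | inj₂ (x , y , s , i) | inj₁ (w , w∈ , refl) = B.I-η (A-edge ab s) (All.lookup (A-V cd) w∈) i
    Q-disjV a b c d ab cd ne v _ _ | inj₂ (x , y , s , i) | inj₂ (x′ , y′ , s′ , i′) with B.I-same (A-edge ab s) (A-edge cd s′) i i′
    ... | inj₁ (refl , refl) = A.disjE a b c d ab cd ne x y s s′
    ... | inj₂ (refl , refl) = A.disjE a b c d ab cd ne x y s (seqEdge-sym (A.P c d) s′)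

  compose : Embedding F L H
  compose = record
    { η = B.η ∘ A.η
    ; P = Q
    ; η-in = λ v v∈ → B.η-in _ (A.η-in v v∈)
    ; η-inj = inj
    ; P-path = λ a b ab → let _ , c , h , l = A.P-path a b ab in
        Q-unique a b ab , expand-consec (A.P a b) c , expand-head (A.P a b) h , expand-last (A.P a b) l
    ; P-sym = λ a b ab → trans (cong expand (A.P-sym a b ab)) (expand-reverse (A.P a b) (A-consec ab))
    ; disjV = Q-disjV
    ; disjE = edge-disjoint wfL inj Q-unique Q-disjV
    ; ends = λ v a b v∈ ab → mk⇔ (to v a b v∈ ab) (λ s → ∈-expand⁺ (A.P a b) (Equivalence.from (A.ends v a b v∈ ab) s))
    ; fixV = λ v v∈ → trans (cong B.η (A.fixV v v∈)) (B.fixV v v∈)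
    ; fixE = fixed
    }
    where
    to : ∀ v a b → v ∈ V L → E L a b → B.η (A.η v) ∈ Q a b → v ≡ a ⊎ v ≡ b
    to v a b v∈ ab m with ∈-expand⁻ (A.P a b) m
    ... | inj₁ (w , w∈ , eq) = Equivalence.to (A.ends v a b v∈ ab) (subst (_∈ A.P a b) (sym (B.η-inj _ w (A.η-in v v∈) (All.lookup (A-V ab) w∈) eq)) w∈)
    ... | inj₂ (x , y , s , i) = contradiction i (B.I-η (A-edge ab s) (A.η-in v v∈))
    fixed : ∀ a b → E F a b → Q a b ≡ a ∷ b ∷ []
    fixed a b ab rewrite A.fixE a b ab | B.fixE a b ab | B.fixV a (F.E-src ab) | B.fixV b (F.E-tgt ab) = refl

-- Embeddings from threads

record Thread : Set where
  constructor thread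
  field
    src : ℕ
    mid : List ℕ
    tgt : ℕ
open Thread

mids : List Thread → List ℕ
mids [] = []
mids (t ∷ ts) = mid t ++ mids ts

mids-++ : ∀ ts us → mids (ts ++ us) ≡ mids ts ++ mids us
mids-++ [] us = refl
mids-++ (t ∷ ts) us = trans (cong (mid t ++_) (mids-++ ts us)) (sym (++-assoc (mid t) (mids ts) (mids us)))

∈-mids⁺ : ∀ {t ts v} → t ∈ ts → v ∈ mid t → v ∈ mids ts
∈-mids⁺ (here refl) v∈ = ∈-++⁺ˡ v∈
∈-mids⁺ {ts = t ∷ _} (there t∈) v∈ = ∈-++⁺ʳ (mid t) (∈-mids⁺ t∈ v∈)

∈-mids⁻ : ∀ ts {v} → v ∈ mids ts → ∃[ t ] (t ∈ ts × v ∈ mid t)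
∈-mids⁻ (t ∷ ts) v∈ with ∈-++⁻ (mid t) v∈
... | inj₁ m = t , here refl , m
... | inj₂ m with ∈-mids⁻ ts m
...   | u , u∈ , m′ = u , there u∈ , m′

mid-unique : ∀ {t ts} → Unique (mids ts) → t ∈ ts → Unique (mid t)
mid-unique {ts = t ∷ ts} u (here refl) = proj₁ (unique-++⁻ (mid t) u)
mid-unique {ts = t ∷ ts} u (there t∈) = mid-unique (proj₁ (proj₂ (unique-++⁻ (mid t) u))) t∈

mids-injective : ∀ {t t′ ts v} → Unique (mids ts) → t ∈ ts → t′ ∈ ts → v ∈ mid t → v ∈ mid t′ → t ≡ t′
mids-injective {ts = t ∷ ts} u (here refl) (here refl) _ _ = refl
mids-injective {ts = t ∷ ts} u (here refl) (there t′∈) v∈ v∈′ =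
  contradiction (v∈ , ∈-mids⁺ t′∈ v∈′) (proj₂ (proj₂ (unique-++⁻ (mid t) u)))
mids-injective {ts = t ∷ ts} u (there t∈) (here refl) v∈ v∈′ =
  contradiction (v∈′ , ∈-mids⁺ t∈ v∈) (proj₂ (proj₂ (unique-++⁻ (mid t) u)))
mids-injective {ts = t ∷ ts} u (there t∈) (there t′∈) v∈ v∈′ =
  mids-injective (proj₁ (proj₂ (unique-++⁻ (mid t) u))) t∈ t′∈ v∈ v∈′

map-unique⇒injective : ∀ (f : ℕ → ℕ) {xs u v} → Unique (map f xs) → u ∈ xs → v ∈ xs → f u ≡ f v → u ≡ v
map-unique⇒injective f (_ ∷ _) (here refl) (here refl) _ = refl
map-unique⇒injective f (n ∷ _) (here refl) (there v∈) eq = contradiction eq (All.lookup n (∈-map⁺ f v∈))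
map-unique⇒injective f (n ∷ _) (there u∈) (here refl) eq = contradiction (sym eq) (All.lookup n (∈-map⁺ f u∈))
map-unique⇒injective f (_ ∷ u) (there u∈) (there v∈) eq = map-unique⇒injective f u u∈ v∈ eq

-- A homeomorphic embedding given by one list of inner vertices per edge, in either orientation; disjointness is a single uniqueness condition.
record Model (F G H : Graph) : Set where
  field
    η       : ℕ → ℕ
    threads : List Thread
    unique  : Unique (map η (V G) ++ mids threads)
    chains  : ∀ {t} → t ∈ threads → Chain (E H) (η (src t)) (mid t) (η (tgt t))
    cover   : ∀ {a b} → E G a b → ∃[ l ] (thread a l b ∈ threads ⊎ thread b l a ∈ threads)
    η-in    : ∀ v → v ∈ V G → η v ∈ V H
    fixV    : ∀ v → v ∈ V F → η v ≡ v
    fixE    : ∀ {t} → t ∈ threads → E F (src t) (tgt t) → mid t ≡ []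

module _ {F G H : Graph} (wfF : WellFormed F) (wfG : WellFormed G) (wfH : WellFormed H) (F⊆G : Subgraph F G) (model : Model F G H) where
  open Model model

  private
    module F = WF wfF
    module G = WF wfG
    module H = WF wfH

    route : ∀ a b → E G a b → List ℕ
    route a b ab with cover ab
    ... | l , inj₁ _ = η a ∷ l ++ [ η b ]
    ... | l , inj₂ _ = η a ∷ reverse l ++ [ η b ]

    look : ℕ → ℕ → List ℕ
    look a b with E-dec G a b
    ... | yes ab = route a b ab
    -- A default off the edges of `G`; no condition on the paths of an embedding refers to it.
    ... | no _ = []

    -- `cover` may return unrelated threads for an edge and its reverse. Looking up only from the
    -- smaller label, and reversing otherwise, makes the two directions agree.
    path : ℕ → ℕ → List ℕ
    path a b with a <? b
    ... | yes _ = look a b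
    ... | no _ = reverse (look b a)

    record Follows (a b : ℕ) (p : List ℕ) : Set where
      field
        {t}    : Thread
        t∈     : t ∈ threads
        {js}   : List ℕ
        shape  : p ≡ η a ∷ js ++ [ η b ]
        sides  : (src t ≡ a × tgt t ≡ b × js ≡ mid t) ⊎ (src t ≡ b × tgt t ≡ a × js ≡ reverse (mid t))
    open Follows

    route-follows : ∀ {a b} ab → Follows a b (route a b ab)
    route-follows ab with cover ab
    ... | l , inj₁ m = record { t∈ = m ; shape = refl ; sides = inj₁ (refl , refl , refl) }
    ... | l , inj₂ m = record { t∈ = m ; shape = refl ; sides = inj₂ (refl , refl , refl) }

    look-follows : ∀ {a b} → E G a b → Follows a b (look a b)
    look-follows {a} {b} ab with E-dec G a b
    ... | yes e = route-follows e
    ... | no ne = contradiction ab ne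

    flip-follows : ∀ {a b p} → Follows a b p → Follows b a (reverse p)
    flip-follows {a} {b} f = record { t∈ = t∈ f ; shape = trans (cong reverse (shape f)) (reverse-shape (η a) (js f) (η b)) ; sides = turn (sides f) }
      where
      turn : _ → _
      turn (inj₁ (p , q , refl)) = inj₂ (p , q , refl)
      turn (inj₂ (p , q , refl)) = inj₁ (p , q , reverse-involutive _)

    path-follows : ∀ {a b} → E G a b → Follows a b (path a b)
    path-follows {a} {b} ab with a <? b
    ... | yes _ = look-follows ab
    ... | no _ = flip-follows (look-follows (G.E-sym ab))

    path-sym : ∀ a b → E G a b → path b a ≡ reverse (path a b)
    path-sym a b ab with a <? b | b <? a
    ... | yes p | yes q = contradiction q (<-asym p)
    ... | yes _ | no _ = refl
    ... | no _ | yes _ = sym (reverse-involutive _)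
    ... | no p | no q with <-cmp a b
    ...   | tri< r _ _ = contradiction r p
    ...   | tri≈ _ r _ = contradiction r (G.E-irrefl ab)
    ...   | tri> _ _ r = contradiction r q

    js⊆mid : ∀ {a b p} (f : Follows a b p) → js f ⊆ mid (t f)
    js⊆mid f v∈ with sides f
    ... | inj₁ (_ , _ , refl) = v∈
    ... | inj₂ (_ , _ , refl) = ∈-reverse⁻ v∈

    mids-part : Unique (mids threads)
    mids-part = proj₁ (proj₂ (unique-++⁻ (map η (V G)) unique))

    inj : ∀ u v → u ∈ V G → v ∈ V G → η u ≡ η v → u ≡ v
    inj u v u∈ v∈ = map-unique⇒injective η (proj₁ (unique-++⁻ (map η (V G)) unique)) u∈ v∈

    js-η : ∀ {a b p w} (f : Follows a b p) → w ∈ V G → η w ∉ js f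
    js-η f w∈ m = proj₂ (proj₂ (unique-++⁻ (map η (V G)) unique)) (∈-map⁺ η w∈ , ∈-mids⁺ (t∈ f) (js⊆mid f m))

    js-unique : ∀ {a b p} (f : Follows a b p) → Unique (js f)
    js-unique f with mid-unique mids-part (t∈ f) | sides f
    ... | u | inj₁ (_ , _ , refl) = u
    ... | u | inj₂ (_ , _ , refl) = unique-reverse u

    js-chain : ∀ {a b p} (f : Follows a b p) → Chain (E H) (η a) (js f) (η b)
    js-chain f with chains (t∈ f) | sides f
    ... | c | inj₁ (refl , refl , refl) = c
    ... | c | inj₂ (refl , refl , refl) = chain-reverse H.E-sym c

    js-same : ∀ {a b p c d q v} (f : Follows a b p) (g : Follows c d q) → v ∈ js f → v ∈ js g → (a ≡ c × b ≡ d) ⊎ (a ≡ d × b ≡ c)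
    js-same f g v∈ v∈′ with mids-injective mids-part (t∈ f) (t∈ g) (js⊆mid f v∈) (js⊆mid g v∈′)
    ... | refl with sides f | sides g
    ...   | inj₁ (refl , refl , _) | inj₁ (refl , refl , _) = inj₁ (refl , refl)
    ...   | inj₁ (refl , refl , _) | inj₂ (refl , refl , _) = inj₂ (refl , refl)
    ...   | inj₂ (refl , refl , _) | inj₁ (refl , refl , _) = inj₂ (refl , refl)
    ...   | inj₂ (refl , refl , _) | inj₂ (refl , refl , _) = inj₁ (refl , refl)

    ∈-follows : ∀ {a b p v} (f : Follows a b p) → v ∈ p → v ≡ η a ⊎ v ≡ η b ⊎ v ∈ js f
    ∈-follows f v∈ with subst (_ ∈_) (shape f) v∈
    ... | here r = inj₁ r
    ... | there m with ∈-++⁻ (js f) m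
    ...   | inj₁ m′ = inj₂ (inj₂ m′)
    ...   | inj₂ (here r) = inj₂ (inj₁ r)

    ends-to : ∀ v a b → v ∈ V G → E G a b → η v ∈ path a b → v ≡ a ⊎ v ≡ b
    ends-to v a b v∈ ab m with path-follows ab
    ... | f with ∈-follows f m
    ...   | inj₁ r = inj₁ (inj v a v∈ (G.E-src ab) r)
    ...   | inj₂ (inj₁ r) = inj₂ (inj v b v∈ (G.E-tgt ab) r)
    ...   | inj₂ (inj₂ m′) = contradiction m′ (js-η f v∈)

    ends-from : ∀ v a b → E G a b → v ≡ a ⊎ v ≡ b → η v ∈ path a b
    ends-from v a b ab s with path-follows ab
    ... | f with s
    ...   | inj₁ refl = subst (η v ∈_) (sym (shape f)) (here refl)
    ...   | inj₂ refl = subst (η v ∈_) (sym (shape f)) (there (∈-++⁺ʳ (js f) (here refl)))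

    disjV : ∀ a b c d → E G a b → E G c d → DistinctEdges a b c d → ∀ v → Inner (η a) (η b) (path a b) v → ¬ (v ∈ path c d)
    disjV a b c d ab cd ne v (v∈ , v≢a , v≢b) v∈′ with path-follows ab | path-follows cd
    ... | f | g with ∈-follows f v∈ | ∈-follows g v∈′
    ...   | inj₁ r | _ = v≢a r
    ...   | inj₂ (inj₁ r) | _ = v≢b r
    ...   | inj₂ (inj₂ m) | inj₁ refl = js-η f (G.E-src cd) m
    ...   | inj₂ (inj₂ m) | inj₂ (inj₁ refl) = js-η f (G.E-tgt cd) m
    ...   | inj₂ (inj₂ m) | inj₂ (inj₂ m′) = [ proj₁ ne , proj₂ ne ]′ (js-same f g m m′)

    path-unique : ∀ a b → E G a b → Unique (path a b)
    path-unique a b ab with path-follows ab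
    ... | f = subst Unique (sym (shape f)) (unique-∷⁺ fresh (Unique.++⁺ (js-unique f) ([] ∷ []) λ { (m , here refl) → js-η f (G.E-tgt ab) m }))
      where
      fresh : η a ∉ js f ++ [ η b ]
      fresh m with ∈-++⁻ (js f) m
      ... | inj₁ m′ = js-η f (G.E-src ab) m′
      ... | inj₂ (here r) = G.E-irrefl ab (inj a b (G.E-src ab) (G.E-tgt ab) r)

    path-isPath : ∀ a b → E G a b → IsPath H (η a) (η b) (path a b)
    path-isPath a b ab with path-follows ab | path-unique a b ab
    ... | f | u = u , subst (Consec (E H)) (sym (shape f)) (chain⇒consec (js-chain f)) ,
      trans (cong head (shape f)) refl , trans (cong last (shape f)) (last-snoc (η a ∷ js f))

    fixed : ∀ a b → E F a b → path a b ≡ a ∷ b ∷ []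
    fixed a b ab with path-follows (proj₂ F⊆G a b ab)
    ... | f = trans (shape f) (trans (cong (λ l → η a ∷ l ++ [ η b ]) (nil (sides f)))
                (cong₂ (λ x y → x ∷ y ∷ []) (fixV a (F.E-src ab)) (fixV b (F.E-tgt ab))))
      where
      nil : _ → js f ≡ []
      nil (inj₁ (refl , refl , eq)) = trans eq (fixE (t∈ f) ab)
      nil (inj₂ (refl , refl , eq)) = trans eq (cong reverse (fixE (t∈ f) (F.E-sym ab)))

  embed : Embedding F G H
  embed = record
    { η = η ; P = path ; η-in = η-in ; η-inj = inj ; P-path = path-isPath ; P-sym = path-sym ; disjV = disjV
    ; disjE = edge-disjoint wfG inj path-unique disjV
    ; ends = λ v a b v∈ ab → mk⇔ (ends-to v a b v∈ ab) (ends-from v a b ab)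
    ; fixV = fixV ; fixE = fixed }

-- The graph G + (ab, cd)

Pair : ℕ → ℕ → ℕ → ℕ → Set
Pair a b u v = (u ≡ a × v ≡ b) ⊎ (u ≡ b × v ≡ a)

∨-true : ∀ {x y} → x ∨ y ≡ true → x ≡ true ⊎ y ≡ true
∨-true {true} _ = inj₁ refl
∨-true {false} p = inj₂ p

∧-true : ∀ {x y} → x ∧ y ≡ true → x ≡ true × y ≡ true
∧-true {true} p = refl , p

≡ᵇ-true : ∀ {u a} → (u ≡ᵇ a) ≡ true → u ≡ a
≡ᵇ-true {u} {a} p = ≡ᵇ⇒≡ u a (subst T (sym p) tt)

≡ᵇ-refl : ∀ u → (u ≡ᵇ u) ≡ true
≡ᵇ-refl zero = refl
≡ᵇ-refl (suc u) = ≡ᵇ-refl u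

isPair⇒Pair : ∀ {a b u v} → isPair a b u v ≡ true → Pair a b u v
isPair⇒Pair p with ∨-true p
... | inj₁ q = let r , s = ∧-true q in inj₁ (≡ᵇ-true r , ≡ᵇ-true s)
... | inj₂ q = let r , s = ∧-true q in inj₂ (≡ᵇ-true r , ≡ᵇ-true s)

Pair⇒isPair : ∀ {a b u v} → Pair a b u v → isPair a b u v ≡ true
Pair⇒isPair {a} {b} (inj₁ (refl , refl)) rewrite ≡ᵇ-refl a | ≡ᵇ-refl b = refl
Pair⇒isPair {a} {b} (inj₂ (refl , refl)) rewrite ≡ᵇ-refl a | ≡ᵇ-refl b = Bool.∨-zeroʳ _

isPair-swap : ∀ a b u v → isPair a b u v ≡ isPair a b v u
isPair-swap a b u v = trans (Bool.∨-comm ((u ≡ᵇ a) ∧ (v ≡ᵇ b)) ((u ≡ᵇ b) ∧ (v ≡ᵇ a)))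
  (cong₂ _∨_ (Bool.∧-comm (u ≡ᵇ b) (v ≡ᵇ a)) (Bool.∧-comm (u ≡ᵇ a) (v ≡ᵇ b)))

module Plus {G : Graph} (wfG : WellFormed G) (a b c d : ℕ) (ab : E G a b) (cd : E G c d) where
  open WF wfG

  G⁺ : Graph
  G⁺ = plus G a b c d

  x y : ℕ
  x = freshX G
  y = suc x

  V<x : ∀ {v} → v ∈ V G → v < x
  V<x v∈ = s≤s (below (V G) v∈)
    where
    below : ∀ vs {v} → v ∈ vs → v ≤ foldr _⊔_ 0 vs
    below (v ∷ vs) (here refl) = m≤m⊔n v _
    below (v ∷ vs) (there m) = ≤-trans (below vs m) (m≤n⊔m v _)

  x-fresh : ∀ {v} → v ∈ V G → v ≢ x
  x-fresh v∈ = <⇒≢ (V<x v∈)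

  y-fresh : ∀ {v} → v ∈ V G → v ≢ y
  y-fresh v∈ = <⇒≢ (≤-trans (V<x v∈) (n≤1+n x))

  x≢y : x ≢ y
  x≢y = <⇒≢ ≤-refl

  data NewEdge (u v : ℕ) : Set where
    old : E G u v → ¬ Pair a b u v → ¬ Pair c d u v → NewEdge u v
    xa  : Pair x a u v → NewEdge u v
    xb  : Pair x b u v → NewEdge u v
    yc  : Pair y c u v → NewEdge u v
    yd  : Pair y d u v → NewEdge u v
    xy  : Pair x y u v → NewEdge u v

  plus-edge⁻ : ∀ {u v} → E G⁺ u v → NewEdge u v
  plus-edge⁻ {u} {v} e with ∨-true e
  ... | inj₁ p with ∧-true p
  ...   | q , r with ∧-true r
  ...     | s , t = old q (not-pair s) (not-pair t)
    where
    not-pair : ∀ {a b} → not (isPair a b u v) ≡ true → ¬ Pair a b u v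
    not-pair {a} {b} n pr with trans (sym (cong not (Pair⇒isPair {a} {b} {u} {v} pr))) n
    ... | ()
  plus-edge⁻ e | inj₂ p with ∨-true p
  ... | inj₁ q = xa (isPair⇒Pair q)
  ... | inj₂ p with ∨-true p
  ...   | inj₁ q = xb (isPair⇒Pair q)
  ...   | inj₂ p with ∨-true p
  ...     | inj₁ q = yc (isPair⇒Pair q)
  ...     | inj₂ p with ∨-true p
  ...       | inj₁ q = yd (isPair⇒Pair q)
  ...       | inj₂ q = xy (isPair⇒Pair q)

  plus-edge⁺ : ∀ {u v} → E G u v → ¬ Pair a b u v → ¬ Pair c d u v → E G⁺ u v
  plus-edge⁺ {u} {v} uv nab ncd with isPair a b u v in eq₁ | isPair c d u v in eq₂
  ... | true | _ = contradiction (isPair⇒Pair eq₁) nab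
  ... | false | true = contradiction (isPair⇒Pair eq₂) ncd
  ... | false | false rewrite uv = refl

  plus-symm : ∀ u v → adj G⁺ u v ≡ adj G⁺ v u
  plus-symm u v rewrite symm u v | isPair-swap a b u v | isPair-swap c d u v | isPair-swap x a u v
    | isPair-swap x b u v | isPair-swap y c u v | isPair-swap y d u v | isPair-swap x y u v = refl

  private
    pair-≢ : ∀ {p q v} → p ≢ q → ¬ Pair p q v v
    pair-≢ ne (inj₁ (refl , eq)) = ne eq
    pair-≢ ne (inj₂ (refl , eq)) = ne (sym eq)

    V⁺ : ∀ {v} → v ∈ V G → v ∈ V G⁺
    V⁺ = there ∘ there

    x∈ : x ∈ V G⁺
    x∈ = here refl

    y∈ : y ∈ V G⁺
    y∈ = there (here refl)

    pair-∈ : ∀ {p q u v} → p ∈ V G⁺ → q ∈ V G⁺ → Pair p q u v → u ∈ V G⁺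
    pair-∈ p∈ q∈ (inj₁ (refl , _)) = p∈
    pair-∈ p∈ q∈ (inj₂ (refl , _)) = q∈

  plus-loopless : ∀ {v} → ¬ E G⁺ v v
  plus-loopless e with plus-edge⁻ e
  ... | old p _ _ = E-irrefl p refl
  ... | xa p = pair-≢ (≢-sym (x-fresh (E-src ab))) p
  ... | xb p = pair-≢ (≢-sym (x-fresh (E-tgt ab))) p
  ... | yc p = pair-≢ (≢-sym (y-fresh (E-src cd))) p
  ... | yd p = pair-≢ (≢-sym (y-fresh (E-tgt cd))) p
  ... | xy p = pair-≢ x≢y p

  plus-closed : ∀ u v → E G⁺ u v → u ∈ V G⁺
  plus-closed u v e with plus-edge⁻ e
  ... | old p _ _ = V⁺ (E-src p)
  ... | xa p = pair-∈ x∈ (V⁺ (E-src ab)) p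
  ... | xb p = pair-∈ x∈ (V⁺ (E-tgt ab)) p
  ... | yc p = pair-∈ y∈ (V⁺ (E-src cd)) p
  ... | yd p = pair-∈ y∈ (V⁺ (E-tgt cd)) p
  ... | xy p = pair-∈ x∈ y∈ p

  plus-wellFormed : WellFormed G⁺
  plus-wellFormed = record
    { uniqueV = unique-∷⁺ (λ { (here eq) → x≢y eq ; (there m) → x-fresh m refl }) (unique-∷⁺ (λ m → y-fresh m refl) uniqueV)
    ; symm = plus-symm
    ; irrefl = λ v → Bool.¬-not plus-loopless
    ; closed = plus-closed }

-- Suns and their rerouting

-- The condition `T` is put on the targets of steps only: a trail starts on the circuit and avoids
-- it from then on.
chain-mapᵗ : ∀ {R S : ℕ → ℕ → Set} {T : ℕ → Set} {x is y} → (∀ {u v : ℕ} → T v → R u v → S u v) → All T is → T y → Chain R x is y → Chain S x is y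
chain-mapᵗ f [] t (edge r) = edge (f t r)
chain-mapᵗ f (i ∷ is) t (r ◅ c) = f i r ◅ chain-mapᵗ f is t c

-- `suffix` lets the remaining walk inherit simplicity, avoidance and the length bound from the
-- given one.
record LastVisit (R : ℕ → ℕ → Set) (A : List ℕ) (ws : List ℕ) (z : ℕ) : Set where
  field
    {start} : ℕ
    {rest}  : List ℕ
    start∈  : start ∈ A
    chain   : Chain R start rest z
    off     : All (_∉ A) rest
    {pre}   : List ℕ
    suffix  : ws ≡ pre ++ rest

last-visit : ∀ {R x ws z} A → Any (_∈ A) (x ∷ ws) → Chain R x ws z → LastVisit R A ws z
last-visit A (here x∈) (edge r) = record { start∈ = x∈ ; chain = edge r ; off = [] ; pre = [] ; suffix = refl }
last-visit {ws = w ∷ ws} A any-x (r ◅ c) with any? (_∈? A) (w ∷ ws)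
... | yes later = record { LastVisit v hiding (pre; suffix) ; pre = w ∷ LastVisit.pre v ; suffix = cong (w ∷_) (LastVisit.suffix v) }
  where v = last-visit A later c
... | no never with any-x
...   | here x∈ = record { start∈ = x∈ ; chain = r ◅ c ; off = All.¬Any⇒All¬ _ never ; pre = [] ; suffix = refl }
...   | there later = contradiction later never

module Suns {H : Graph} (cubH : Cubic H) (Z : List ℕ) where
  open WF (proj₁ cubH)

  -- A circuit of H with four corners kᵢ and disjoint legs from kᵢ to eᵢ ∈ Z: the image of the four-circuit of G together with the edges leaving it.
  record Sun (e₁ e₂ e₃ e₄ : ℕ) : Set where
    field
      {k₁ k₂ k₃ k₄} : ℕ
      {s₁₂ s₂₃ s₃₄ s₄₁} : List ℕ
      {l₁ l₂ l₃ l₄} : List ℕ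
      c₁₂ : Chain (E H) k₁ s₁₂ k₂
      c₂₃ : Chain (E H) k₂ s₂₃ k₃
      c₃₄ : Chain (E H) k₃ s₃₄ k₄
      c₄₁ : Chain (E H) k₄ s₄₁ k₁
      t₁ : Chain (E H) k₁ l₁ e₁
      t₂ : Chain (E H) k₂ l₂ e₂
      t₃ : Chain (E H) k₃ l₃ e₃
      t₄ : Chain (E H) k₄ l₄ e₄
      e₁∈ : e₁ ∈ Z
      e₂∈ : e₂ ∈ Z
      e₃∈ : e₃ ∈ Z
      e₄∈ : e₄ ∈ Z
    circ : List ℕ
    circ = k₁ ∷ s₁₂ ++ k₂ ∷ s₂₃ ++ k₃ ∷ s₃₄ ++ k₄ ∷ s₄₁
    legs : List ℕ
    legs = l₁ ++ l₂ ++ l₃ ++ l₄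
    field
      unique : Unique (circ ++ legs ++ Z)

    Fwd : ℕ → ℕ → Set
    Fwd u v = Link k₁ l₁ e₁ u v ⊎ Link k₂ l₂ e₂ u v ⊎ Link k₃ l₃ e₃ u v ⊎ Link k₄ l₄ e₄ u v

    -- Steps of the residual graph: an edge off the legs, or a leg edge traversed towards the circuit.
    Res : ℕ → ℕ → Set
    Res u v = E H u v × (Fwd v u ⊎ ¬ Fwd u v)

    fwd? : ∀ u v → Dec (Fwd u v)
    fwd? u v = link? k₁ l₁ e₁ u v ⊎-dec link? k₂ l₂ e₂ u v ⊎-dec link? k₃ l₃ e₃ u v ⊎-dec link? k₄ l₄ e₄ u v

    res? : ∀ u v → Dec (Res u v)
    res? u v = E-dec H u v ×-dec (fwd? v u ⊎-dec ¬? (fwd? u v))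

    circ∌legs : ∀ {v} → v ∈ circ → v ∉ legs
    circ∌legs v∈ m = proj₂ (proj₂ (unique-++⁻ circ unique)) (v∈ , ∈-++⁺ˡ m)

    circ∌Z : ∀ {v} → v ∈ circ → v ∉ Z
    circ∌Z v∈ m = proj₂ (proj₂ (unique-++⁻ circ unique)) (v∈ , ∈-++⁺ʳ legs m)

    legs∌Z : ∀ {v} → v ∈ legs → v ∉ Z
    legs∌Z v∈ m = proj₂ (proj₂ (unique-++⁻ legs (proj₁ (proj₂ (unique-++⁻ circ unique))))) (v∈ , m)

    fwd-tgt : ∀ {u v} → Fwd u v → v ∈ legs ⊎ v ∈ Z
    fwd-tgt (inj₁ q) with ∈-++⁻ l₁ (link-tgt l₁ q)
    ... | inj₁ m = inj₁ (∈-++⁺ˡ m)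
    ... | inj₂ (here refl) = inj₂ e₁∈
    fwd-tgt (inj₂ (inj₁ q)) with ∈-++⁻ l₂ (link-tgt l₂ q)
    ... | inj₁ m = inj₁ (∈-++⁺ʳ l₁ (∈-++⁺ˡ m))
    ... | inj₂ (here refl) = inj₂ e₂∈
    fwd-tgt (inj₂ (inj₂ (inj₁ q))) with ∈-++⁻ l₃ (link-tgt l₃ q)
    ... | inj₁ m = inj₁ (∈-++⁺ʳ l₁ (∈-++⁺ʳ l₂ (∈-++⁺ˡ m)))
    ... | inj₂ (here refl) = inj₂ e₃∈
    fwd-tgt (inj₂ (inj₂ (inj₂ q))) with ∈-++⁻ l₄ (link-tgt l₄ q)
    ... | inj₁ m = inj₁ (∈-++⁺ʳ l₁ (∈-++⁺ʳ l₂ (∈-++⁺ʳ l₃ m)))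
    ... | inj₂ (here refl) = inj₂ e₄∈

    fwd-src : ∀ {u v} → Fwd u v → u ∈ circ ⊎ u ∈ legs
    fwd-src (inj₁ q) with link-src l₁ q
    ... | here refl = inj₁ (here refl)
    ... | there m = inj₂ (∈-++⁺ˡ m)
    fwd-src (inj₂ (inj₁ q)) with link-src l₂ q
    ... | here refl = inj₁ (there (∈-++⁺ʳ s₁₂ (here refl)))
    ... | there m = inj₂ (∈-++⁺ʳ l₁ (∈-++⁺ˡ m))
    fwd-src (inj₂ (inj₂ (inj₁ q))) with link-src l₃ q
    ... | here refl = inj₁ (there (∈-++⁺ʳ s₁₂ (there (∈-++⁺ʳ s₂₃ (here refl)))))
    ... | there m = inj₂ (∈-++⁺ʳ l₁ (∈-++⁺ʳ l₂ (∈-++⁺ˡ m)))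
    fwd-src (inj₂ (inj₂ (inj₂ q))) with link-src l₄ q
    ... | here refl = inj₁ (there (∈-++⁺ʳ s₁₂ (there (∈-++⁺ʳ s₂₃ (there (∈-++⁺ʳ s₃₄ (here refl)))))))
    ... | there m = inj₂ (∈-++⁺ʳ l₁ (∈-++⁺ʳ l₂ (∈-++⁺ʳ l₃ m)))

  open Sun

  flip-chain : ∀ {x is y} → Chain (E H) x is y → Chain (E H) y (reverse is) x
  flip-chain = chain-reverse E-sym

  rotate : ∀ a b c d → a ++ b ++ c ++ d ↭ b ++ c ++ d ++ a
  rotate = solve 4 (λ a b c d → (a ⊕ b ⊕ c ⊕ d) ⊜ (b ⊕ c ⊕ d ⊕ a)) ↭-refl

  -- Together with `mirror` this generates the symmetries of the square, so that a trail may be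
  -- assumed to leave from side 12.
  rot : ∀ {e₁ e₂ e₃ e₄} → Sun e₁ e₂ e₃ e₄ → Sun e₂ e₃ e₄ e₁
  rot S = record
    { c₁₂ = c₂₃ S ; c₂₃ = c₃₄ S ; c₃₄ = c₄₁ S ; c₄₁ = c₁₂ S ; t₁ = t₂ S ; t₂ = t₃ S ; t₃ = t₄ S ; t₄ = t₁ S
    ; e₁∈ = e₂∈ S ; e₂∈ = e₃∈ S ; e₃∈ = e₄∈ S ; e₄∈ = e₁∈ S
    ; unique = unique-resp-↭ (++⁺ (rotate (k₁ S ∷ s₁₂ S) (k₂ S ∷ s₂₃ S) (k₃ S ∷ s₃₄ S) (k₄ S ∷ s₄₁ S))
                                  (++⁺ʳ Z (rotate (l₁ S) (l₂ S) (l₃ S) (l₄ S)))) (unique S) }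

  rot-circ : ∀ {e₁ e₂ e₃ e₄} (S : Sun e₁ e₂ e₃ e₄) → circ S ↭ circ (rot S)
  rot-circ S = rotate (k₁ S ∷ s₁₂ S) (k₂ S ∷ s₂₃ S) (k₃ S ∷ s₃₄ S) (k₄ S ∷ s₄₁ S)

  mirror-circ : ∀ {e₁ e₂ e₃ e₄} (S : Sun e₁ e₂ e₃ e₄) →
    circ S ↭ k₂ S ∷ reverse (s₁₂ S) ++ k₁ S ∷ reverse (s₄₁ S) ++ k₄ S ∷ reverse (s₃₄ S) ++ k₃ S ∷ reverse (s₂₃ S)
  mirror-circ S = ↭-trans (reflect [ k₁ S ] [ k₂ S ] [ k₃ S ] [ k₄ S ] (s₁₂ S) (s₂₃ S) (s₃₄ S) (s₄₁ S))
    (prep (k₂ S) (++⁺ (rev (s₁₂ S)) (prep (k₁ S) (++⁺ (rev (s₄₁ S)) (prep (k₄ S) (++⁺ (rev (s₃₄ S)) (prep (k₃ S) (rev (s₂₃ S)))))))))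
    where
    rev : ∀ xs → xs ↭ reverse xs
    rev xs = ↭-sym (↭-reverse xs)
    reflect : ∀ k₁ k₂ k₃ k₄ a b c d → k₁ ++ a ++ k₂ ++ b ++ k₃ ++ c ++ k₄ ++ d ↭ k₂ ++ a ++ k₁ ++ d ++ k₄ ++ c ++ k₃ ++ b
    reflect = solve 8 (λ k₁ k₂ k₃ k₄ a b c d → (k₁ ⊕ a ⊕ k₂ ⊕ b ⊕ k₃ ⊕ c ⊕ k₄ ⊕ d) ⊜ (k₂ ⊕ a ⊕ k₁ ⊕ d ⊕ k₄ ⊕ c ⊕ k₃ ⊕ b)) ↭-refl

  swaps : ∀ a b c d → a ++ b ++ c ++ d ↭ b ++ a ++ d ++ c
  swaps = solve 4 (λ a b c d → (a ⊕ b ⊕ c ⊕ d) ⊜ (b ⊕ a ⊕ d ⊕ c)) ↭-refl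

  -- Side 12 is kept but reversed, and legs 2 and 4 take the places of legs 1 and 3.
  mirror : ∀ {e₁ e₂ e₃ e₄} → Sun e₁ e₂ e₃ e₄ → Sun e₂ e₁ e₄ e₃
  mirror S = record
    { c₁₂ = flip-chain (c₁₂ S) ; c₂₃ = flip-chain (c₄₁ S) ; c₃₄ = flip-chain (c₃₄ S) ; c₄₁ = flip-chain (c₂₃ S)
    ; t₁ = t₂ S ; t₂ = t₁ S ; t₃ = t₄ S ; t₄ = t₃ S
    ; e₁∈ = e₂∈ S ; e₂∈ = e₁∈ S ; e₃∈ = e₄∈ S ; e₄∈ = e₃∈ S
    ; unique = unique-resp-↭ (++⁺ (mirror-circ S) (++⁺ʳ Z (swaps (l₁ S) (l₂ S) (l₃ S) (l₄ S)))) (unique S) }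
  -- The path from u on s₁₂ to p on l₁ takes over as part of the circuit, and p becomes the first corner.
  shift-corner : ∀ {e₁ e₂ e₃ e₄ s′ u s″ m p m′ qs} (S : Sun e₁ e₂ e₃ e₄) → s₁₂ S ≡ s′ ++ u ∷ s″ → l₁ S ≡ m ++ p ∷ m′ →
                 Chain (E H) u qs p → Unique (qs ++ circ S ++ legs S ++ Z) → Sun e₁ e₂ e₃ e₄
  shift-corner {s′ = s′} {u} {s″} {m} {p} {m′} {qs} record
    { k₁ = k₁ ; k₂ = k₂ ; k₃ = k₃ ; k₄ = k₄ ; s₁₂ = _ ; s₂₃ = s₂₃ ; s₃₄ = s₃₄ ; s₄₁ = s₄₁ ; l₁ = _ ; l₂ = l₂ ; l₃ = l₃ ; l₄ = l₄
    ; c₁₂ = c₁₂ ; c₂₃ = c₂₃ ; c₃₄ = c₃₄ ; c₄₁ = c₄₁ ; t₁ = t₁ ; t₂ = t₂ ; t₃ = t₃ ; t₄ = t₄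
    ; e₁∈ = e₁∈ ; e₂∈ = e₂∈ ; e₃∈ = e₃∈ ; e₄∈ = e₄∈ } refl refl q uq = record
    -- The old corner `k₁` and the piece `m` of leg 1 are absorbed into side 41; the piece `s′` of
    -- the circuit is discarded.
    { c₁₂ = join (flip-chain q) (proj₂ (split s′ c₁₂)) ; c₂₃ = c₂₃ ; c₃₄ = c₃₄ ; c₄₁ = join c₄₁ (proj₁ (split m t₁))
    ; t₁ = proj₂ (split m t₁) ; t₂ = t₂ ; t₃ = t₃ ; t₄ = t₄ ; e₁∈ = e₁∈ ; e₂∈ = e₂∈ ; e₃∈ = e₃∈ ; e₄∈ = e₄∈
    ; unique = proj₁ (proj₂ (unique-++⁻ s′ (unique-resp-↭
        (↭-trans (++⁺ʳ _ (↭-sym (↭-reverse qs)))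
                 (perm [ k₁ ] [ k₂ ] [ k₃ ] [ k₄ ] s′ [ u ] s″ s₂₃ s₃₄ s₄₁ m [ p ] m′ l₂ (l₃ ++ l₄) (reverse qs) Z)) uq))) }
    where
    perm : ∀ k₁ k₂ k₃ k₄ s′ u s″ s₂₃ s₃₄ s₄₁ m p m′ l₂ l q Z →
      q ++ (k₁ ++ (s′ ++ u ++ s″) ++ k₂ ++ s₂₃ ++ k₃ ++ s₃₄ ++ k₄ ++ s₄₁) ++ ((m ++ p ++ m′) ++ l₂ ++ l) ++ Z ↭
      s′ ++ (p ++ (q ++ u ++ s″) ++ k₂ ++ s₂₃ ++ k₃ ++ s₃₄ ++ k₄ ++ s₄₁ ++ k₁ ++ m) ++ (m′ ++ l₂ ++ l) ++ Z
    perm = solve 17 (λ k₁ k₂ k₃ k₄ s′ u s″ s₂₃ s₃₄ s₄₁ m p m′ l₂ l q Z →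
      (q ⊕ (k₁ ⊕ (s′ ⊕ u ⊕ s″) ⊕ k₂ ⊕ s₂₃ ⊕ k₃ ⊕ s₃₄ ⊕ k₄ ⊕ s₄₁) ⊕ ((m ⊕ p ⊕ m′) ⊕ l₂ ⊕ l) ⊕ Z) ⊜
      (s′ ⊕ (p ⊕ (q ⊕ u ⊕ s″) ⊕ k₂ ⊕ s₂₃ ⊕ k₃ ⊕ s₃₄ ⊕ k₄ ⊕ s₄₁ ⊕ k₁ ⊕ m) ⊕ (m′ ⊕ l₂ ⊕ l) ⊕ Z)) ↭-refl

  -- The path from u on s₁₂ to p on l₃ replaces s₂₃; the second corner moves to u, the third to p, and the cyclic order of the legs is kept.
  cross-over : ∀ {e₁ e₂ e₃ e₄ s′ u s″ m p m′ qs} (S : Sun e₁ e₂ e₃ e₄) → s₁₂ S ≡ s′ ++ u ∷ s″ → l₃ S ≡ m ++ p ∷ m′ →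
               Chain (E H) u qs p → Unique (qs ++ circ S ++ legs S ++ Z) → Sun e₁ e₂ e₃ e₄
  cross-over {s′ = s′} {u} {s″} {m} {p} {m′} {qs} record
    { k₁ = k₁ ; k₂ = k₂ ; k₃ = k₃ ; k₄ = k₄ ; s₁₂ = _ ; s₂₃ = s₂₃ ; s₃₄ = s₃₄ ; s₄₁ = s₄₁ ; l₁ = l₁ ; l₂ = l₂ ; l₃ = _ ; l₄ = l₄
    ; c₁₂ = c₁₂ ; c₂₃ = c₂₃ ; c₃₄ = c₃₄ ; c₄₁ = c₄₁ ; t₁ = t₁ ; t₂ = t₂ ; t₃ = t₃ ; t₄ = t₄
    ; e₁∈ = e₁∈ ; e₂∈ = e₂∈ ; e₃∈ = e₃∈ ; e₄∈ = e₄∈ } refl refl q uq = record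
    -- Leg 2 now runs from `u` along `s″` through the old corner `k₂`, and the piece `m` of leg 3,
    -- reversed, begins side 34.
    { c₁₂ = proj₁ (split s′ c₁₂) ; c₂₃ = q ; c₃₄ = join (flip-chain (proj₁ (split m t₃))) c₃₄ ; c₄₁ = c₄₁
    ; t₁ = t₁ ; t₂ = join (proj₂ (split s′ c₁₂)) t₂ ; t₃ = proj₂ (split m t₃) ; t₄ = t₄
    ; e₁∈ = e₁∈ ; e₂∈ = e₂∈ ; e₃∈ = e₃∈ ; e₄∈ = e₄∈
    ; unique = unique-resp-↭
        (++⁺ʳ _ (prep k₁ (++⁺ˡ s′ (prep u (++⁺ˡ qs (prep p (++⁺ʳ _ (++⁺ʳ _ (↭-sym (↭-reverse m))))))))))
        (proj₁ (proj₂ (unique-++⁻ s₂₃ (unique-resp-↭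
          (perm [ k₁ ] [ k₂ ] [ k₃ ] (k₄ ∷ s₄₁) s′ [ u ] s″ s₂₃ s₃₄ l₁ l₂ m [ p ] m′ l₄ qs Z) uq)))) }
    where
    perm : ∀ k₁ k₂ k₃ r s′ u s″ s₂₃ s₃₄ l₁ l₂ m p m′ l₄ q Z →
      q ++ (k₁ ++ (s′ ++ u ++ s″) ++ k₂ ++ s₂₃ ++ k₃ ++ s₃₄ ++ r) ++ (l₁ ++ l₂ ++ (m ++ p ++ m′) ++ l₄) ++ Z ↭
      s₂₃ ++ (k₁ ++ s′ ++ u ++ q ++ p ++ (m ++ k₃ ++ s₃₄) ++ r) ++ (l₁ ++ (s″ ++ k₂ ++ l₂) ++ m′ ++ l₄) ++ Z
    perm = solve 17 (λ k₁ k₂ k₃ r s′ u s″ s₂₃ s₃₄ l₁ l₂ m p m′ l₄ q Z →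
      (q ⊕ (k₁ ⊕ (s′ ⊕ u ⊕ s″) ⊕ k₂ ⊕ s₂₃ ⊕ k₃ ⊕ s₃₄ ⊕ r) ⊕ (l₁ ⊕ l₂ ⊕ (m ⊕ p ⊕ m′) ⊕ l₄) ⊕ Z) ⊜
      (s₂₃ ⊕ (k₁ ⊕ s′ ⊕ u ⊕ q ⊕ p ⊕ (m ⊕ k₃ ⊕ s₃₄) ⊕ r) ⊕ (l₁ ⊕ (s″ ⊕ k₂ ⊕ l₂) ⊕ m′ ⊕ l₄) ⊕ Z)) ↭-refl

-- Shortening a residual trail

split-first : ∀ {A : List ℕ} {ws} → Any (_∈ A) ws → ∃[ qs ] ∃[ p ] ∃[ rest ] (ws ≡ qs ++ p ∷ rest × All (_∉ A) qs × p ∈ A)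
split-first (here {x = w} {xs = ws} w∈) = [] , w , ws , refl , [] , w∈
split-first {A} (there {x = w} any-ws) with w ∈? A | split-first any-ws
... | yes w∈ | _ = [] , w , _ , refl , [] , w∈
... | no w∉ | qs , p , rest , refl , off , p∈ = w ∷ qs , p , rest , refl , w∉ ∷ off , p∈

module Augment {H : Graph} (cubH : Cubic H) (Z : List ℕ) (Target : ℕ → Set) (Z∋target : ∀ {z} → Target z → z ∈ Z) where
  open WF (proj₁ cubH)
  open Suns cubH Z
  open Sun

  -- The conditions bind the inner vertices `ws` only: the start may lie on the circuit, and the end
  -- lies in `Z`.
  record Trail {e₁ e₂ e₃ e₄} (S : Sun e₁ e₂ e₃ e₄) (x : ℕ) (ws : List ℕ) (z : ℕ) : Set where
    field
      chain   : Chain (Res S) x ws z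
      simple  : Unique ws
      off-Z   : All (_∉ Z) ws
      off-S   : All (_∉ circ S) ws
      target  : Target z
  open Trail

  Fwd-≗ : ∀ {e₁ e₂ e₃ e₄ f₁ f₂ f₃ f₄} (S : Sun e₁ e₂ e₃ e₄) (S′ : Sun f₁ f₂ f₃ f₄) → Set
  Fwd-≗ S S′ = ∀ {u v} → (Fwd S u v → Fwd S′ u v) × (Fwd S′ u v → Fwd S u v)

  retrail : ∀ {e₁ e₂ e₃ e₄ f₁ f₂ f₃ f₄} {S : Sun e₁ e₂ e₃ e₄} {S′ : Sun f₁ f₂ f₃ f₄} → circ S ↭ circ S′ → Fwd-≗ S S′ →
            ∀ {x ws z} → Trail S x ws z → Trail S′ x ws z
  retrail σ f tr = record
    { chain = chain-map (λ (e , d) → e , Sum.map (proj₁ f) (λ ¬q → ¬q ∘ proj₂ f) d) (chain tr)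
    ; simple = simple tr ; off-Z = off-Z tr
    ; off-S = All.map (λ v∉ m → v∉ (∈-resp-↭ (↭-sym σ) m)) (off-S tr) ; target = target tr }

  rot-trail : ∀ {e₁ e₂ e₃ e₄ x ws z} {S : Sun e₁ e₂ e₃ e₄} → Trail S x ws z → Trail (rot S) x ws z
  rot-trail {S = S} = retrail (rot-circ S) (to , from)
    where
    to : ∀ {A B C D : Set} → A ⊎ B ⊎ C ⊎ D → B ⊎ C ⊎ D ⊎ A
    to (inj₁ a) = inj₂ (inj₂ (inj₂ a))
    to (inj₂ (inj₁ b)) = inj₁ b
    to (inj₂ (inj₂ (inj₁ c))) = inj₂ (inj₁ c)
    to (inj₂ (inj₂ (inj₂ d))) = inj₂ (inj₂ (inj₁ d))
    from : ∀ {A B C D : Set} → B ⊎ C ⊎ D ⊎ A → A ⊎ B ⊎ C ⊎ D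
    from (inj₁ b) = inj₂ (inj₁ b)
    from (inj₂ (inj₁ c)) = inj₂ (inj₂ (inj₁ c))
    from (inj₂ (inj₂ (inj₁ d))) = inj₂ (inj₂ (inj₂ d))
    from (inj₂ (inj₂ (inj₂ a))) = inj₁ a

  mirror-trail : ∀ {e₁ e₂ e₃ e₄ x ws z} {S : Sun e₁ e₂ e₃ e₄} → Trail S x ws z → Trail (mirror S) x ws z
  mirror-trail {S = S} = retrail (mirror-circ S) (σ , σ)
    where
    σ : ∀ {A B C D : Set} → A ⊎ B ⊎ C ⊎ D → B ⊎ A ⊎ D ⊎ C
    σ (inj₁ a) = inj₂ (inj₁ a)
    σ (inj₂ (inj₁ b)) = inj₁ b
    σ (inj₂ (inj₂ (inj₁ c))) = inj₂ (inj₂ (inj₂ c))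
    σ (inj₂ (inj₂ (inj₂ d))) = inj₂ (inj₂ (inj₁ d))

  -- What the rest of a trail needs to survive a rerouting: a leg edge that is new points to a
  -- vertex of the old circuit, and one that is lost starts on the new circuit. A residual step
  -- whose target avoids both circuits therefore stays residual.
  record Advance {e₁ e₂ e₃ e₄} (S S′ : Sun e₁ e₂ e₃ e₄) (p : ℕ) : Set where
    field
      hit : p ∈ circ S′
      fwd : ∀ {u v} → Fwd S′ u v → Fwd S u v ⊎ v ∈ circ S
      bwd : ∀ {u v} → Fwd S u v → Fwd S′ u v ⊎ u ∈ circ S′

  -- The trail beyond `p` may meet the new circuit again, so it is restarted at its last visit. As
  -- `p` itself is on that circuit, at least `p` drops out of the interior, which is what makes the
  -- induction descend.
  resume : ∀ {e₁ e₂ e₃ e₄} {S S′ : Sun e₁ e₂ e₃ e₄} {x qs p ws z} → Advance S S′ p → Trail S x (qs ++ p ∷ ws) z →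
           ∃₂ λ x′ ws′ → x′ ∈ circ S′ × Trail S′ x′ ws′ z × length ws′ ≤ length ws
  resume {S = S} {S′} {x} {qs} {p} {ws} {z} adv tr with last-visit (circ S′) (here (Advance.hit adv)) (proj₂ (split qs (chain tr)))
  ... | record { start = x′ ; rest = ws′ ; start∈ = start∈ ; chain = c ; off = off ; pre = pre ; suffix = refl } =
    x′ , ws′ , start∈ ,
    record
      { chain = chain-mapᵗ {T = λ v → v ∉ circ S × v ∉ circ S′} step (All.zip (tailOf (off-S tr) , off))
                  ((λ m → circ∌Z S m (Z∋target (target tr))) , λ m → circ∌Z S′ m (Z∋target (target tr))) c
      ; simple = proj₁ (proj₂ (unique-++⁻ pre (unique-∷⁻ (proj₁ (proj₂ (unique-++⁻ qs (simple tr)))))))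
      ; off-Z = tailOf (off-Z tr) ; off-S = off ; target = target tr } ,
    ≤-trans (m≤n+m (length ws′) (length pre)) (≤-reflexive (sym (length-++ pre)))
    where
    tailOf : ∀ {P : ℕ → Set} → All P (qs ++ p ∷ pre ++ ws′) → All P ws′
    tailOf al = All.++⁻ʳ pre (All.tail (All.++⁻ʳ qs al))
    step : ∀ {u v} → (v ∉ circ S × v ∉ circ S′) → Res S u v → Res S′ u v
    step {u} {v} (v∉ , v∉′) (e , inj₁ back) with Advance.bwd adv back
    ... | inj₁ q = e , inj₁ q
    ... | inj₂ m = contradiction m v∉′
    step {u} {v} (v∉ , v∉′) (e , inj₂ ¬q) = e , inj₂ λ q → [ ¬q , v∉ ]′ (Advance.fwd adv q)

  module _ {e₁ e₂ e₃ e₄ u p : ℕ} {s′ s″ m m′ qs : List ℕ} where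

    -- Leg 1 only shrinks; its lost edges start at `k₁` or in `m`, which now belong to side 41.
    shift-advance : (S : Sun e₁ e₂ e₃ e₄) (eq₁ : s₁₂ S ≡ s′ ++ u ∷ s″) (eq₂ : l₁ S ≡ m ++ p ∷ m′)
                    (q : Chain (E H) u qs p) (uq : Unique (qs ++ circ S ++ legs S ++ Z)) → Advance S (shift-corner S eq₁ eq₂ q uq) p
    shift-advance S@record { s₁₂ = _ ; l₁ = _ } refl refl q uq = record
      { hit = here refl
      ; fwd = λ { (inj₁ k) → inj₁ (inj₁ (link-++⁺ʳ m k)) ; (inj₂ k) → inj₁ (inj₂ k) }
      ; bwd = λ { (inj₁ k) → back (link-++⁻ m k) ; (inj₂ k) → inj₁ (inj₂ k) } }
      where
      S′ = shift-corner S refl refl q uq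
      back : ∀ {u v} → Link (k₁ S) m p u v ⊎ Link p m′ e₁ u v → Fwd S′ u v ⊎ u ∈ circ S′
      back (inj₁ k) = inj₂ (there (∈-++⁺ʳ (reverse qs ++ _) (there (∈-++⁺ʳ (s₂₃ S) (there (∈-++⁺ʳ (s₃₄ S) (there (∈-++⁺ʳ (s₄₁ S) (link-src m k)))))))))
      back (inj₂ k) = inj₁ (inj₁ k)

    -- The new edges of leg 2 run along the old circuit from `u` to `k₂`; the lost edges of leg 3
    -- start at `k₃` or in `m`, which now belong to side 34.
    cross-advance : (S : Sun e₁ e₂ e₃ e₄) (eq₁ : s₁₂ S ≡ s′ ++ u ∷ s″) (eq₂ : l₃ S ≡ m ++ p ∷ m′)
                    (q : Chain (E H) u qs p) (uq : Unique (qs ++ circ S ++ legs S ++ Z)) → Advance S (cross-over S eq₁ eq₂ q uq) p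
    cross-advance S@record { s₁₂ = _ ; l₃ = _ } refl refl q uq = record
      { hit = onto (here refl)
      ; fwd = λ { (inj₁ k) → inj₁ (inj₁ k) ; (inj₂ (inj₁ k)) → leg₂ (link-++⁻ s″ k)
                ; (inj₂ (inj₂ (inj₁ k))) → inj₁ (inj₂ (inj₂ (inj₁ (link-++⁺ʳ m k)))) ; (inj₂ (inj₂ (inj₂ k))) → inj₁ (inj₂ (inj₂ (inj₂ k))) }
      ; bwd = λ { (inj₁ k) → inj₁ (inj₁ k) ; (inj₂ (inj₁ k)) → inj₁ (inj₂ (inj₁ (link-++⁺ʳ s″ k)))
                ; (inj₂ (inj₂ (inj₁ k))) → back (link-++⁻ m k) ; (inj₂ (inj₂ (inj₂ k))) → inj₁ (inj₂ (inj₂ (inj₂ k))) } }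
      where
      S′ = cross-over S refl refl q uq
      onto : ∀ {v} → v ∈ p ∷ (reverse m ++ k₃ S ∷ s₃₄ S) ++ k₄ S ∷ s₄₁ S → v ∈ circ S′
      onto v∈ = there (∈-++⁺ʳ s′ (there (∈-++⁺ʳ qs v∈)))
      leg₂ : ∀ {v w} → Link u s″ (k₂ S) v w ⊎ Link (k₂ S) (l₂ S) e₂ v w → Fwd S v w ⊎ w ∈ circ S
      leg₂ (inj₂ k) = inj₁ (inj₂ (inj₁ k))
      leg₂ (inj₁ k) with ∈-++⁻ s″ (link-tgt s″ k)
      ... | inj₁ w∈ = inj₂ (there (∈-++⁺ˡ (∈-++⁺ʳ s′ (there w∈))))
      ... | inj₂ (here refl) = inj₂ (there (∈-++⁺ʳ (s′ ++ u ∷ s″) (here refl)))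
      back : ∀ {v w} → Link (k₃ S) m p v w ⊎ Link p m′ e₃ v w → Fwd S′ v w ⊎ v ∈ circ S′
      back (inj₂ k) = inj₁ (inj₂ (inj₂ (inj₁ k)))
      back (inj₁ k) with link-src m k
      ... | here refl = inj₂ (onto (there (∈-++⁺ˡ (∈-++⁺ʳ (reverse m) (here refl)))))
      ... | there v∈ = inj₂ (onto (there (∈-++⁺ˡ (∈-++⁺ˡ (∈-reverse v∈)))))

  circ-unique : ∀ {e₁ e₂ e₃ e₄} (S : Sun e₁ e₂ e₃ e₄) → Unique (circ S)
  circ-unique S = proj₁ (unique-++⁻ (circ S) (unique S))

  -- The three neighbours of a corner are two on the circuit and one on its leg, and the leg edge is
  -- not residual in the outward direction. A trail therefore starts strictly inside a side.
  no-exit-at-corner : ∀ {e₁ e₂ e₃ e₄ q} (S : Sun e₁ e₂ e₃ e₄) → q ∉ circ S → ¬ Res S (k₁ S) q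
  no-exit-at-corner {e₁} {q = q} S q∉ (e , d) = [ on-circ₁ , [ on-circ₂ , on-leg d ]′ ]′
    (cubic-saturated cubH (chain-first (c₁₂ S)) (chain-first (flip-chain (c₄₁ S))) (chain-first (t₁ S)) n₁≢n₂ n₁≢n₃ n₂≢n₃ e)
    where
    n₁ = first (s₁₂ S) (k₂ S)
    n₂ = first (reverse (s₄₁ S)) (k₄ S)
    n₃ = first (l₁ S) e₁
    A = s₁₂ S ++ [ k₂ S ]
    B = k₄ S ∷ s₄₁ S
    regroup : ∀ k₁ s₁₂ k₂ s₂₃ k₃ s₃₄ B → k₁ ++ s₁₂ ++ k₂ ++ s₂₃ ++ k₃ ++ s₃₄ ++ B ↭ (s₁₂ ++ k₂) ++ B ++ k₁ ++ s₂₃ ++ k₃ ++ s₃₄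
    regroup = solve 7 (λ k₁ s₁₂ k₂ s₂₃ k₃ s₃₄ B →
      (k₁ ⊕ s₁₂ ⊕ k₂ ⊕ s₂₃ ⊕ k₃ ⊕ s₃₄ ⊕ B) ⊜ ((s₁₂ ⊕ k₂) ⊕ B ⊕ k₁ ⊕ s₂₃ ⊕ k₃ ⊕ s₃₄)) ↭-refl
    σ = regroup [ k₁ S ] (s₁₂ S) [ k₂ S ] (s₂₃ S) [ k₃ S ] (s₃₄ S) B
    n₁∈ : n₁ ∈ A
    n₁∈ = first-∈ (s₁₂ S) (k₂ S)
    n₂∈ : n₂ ∈ B
    n₂∈ with ∈-++⁻ (reverse (s₄₁ S)) (first-∈ (reverse (s₄₁ S)) (k₄ S))
    ... | inj₁ m = there (∈-reverse⁻ m)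
    ... | inj₂ (here eq) = here eq
    n₁∈circ : n₁ ∈ circ S
    n₁∈circ = ∈-resp-↭ (↭-sym σ) (∈-++⁺ˡ n₁∈)
    n₂∈circ : n₂ ∈ circ S
    n₂∈circ = ∈-resp-↭ (↭-sym σ) (∈-++⁺ʳ A (∈-++⁺ˡ n₂∈))
    n₃-fwd : Fwd S (k₁ S) n₃
    n₃-fwd = inj₁ (link-first (k₁ S) (l₁ S) e₁)
    off-circ : ∀ {u v} → Fwd S u v → v ∉ circ S
    off-circ f m = [ circ∌legs S m , circ∌Z S m ]′ (fwd-tgt S f)
    n₁≢n₂ : n₁ ≢ n₂
    n₁≢n₂ eq = proj₂ (proj₂ (unique-++⁻ A (unique-resp-↭ σ (circ-unique S)))) (n₁∈ , ∈-++⁺ˡ (subst (_∈ B) (sym eq) n₂∈))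
    n₁≢n₃ : n₁ ≢ n₃
    n₁≢n₃ eq = off-circ n₃-fwd (subst (_∈ circ S) eq n₁∈circ)
    n₂≢n₃ : n₂ ≢ n₃
    n₂≢n₃ eq = off-circ n₃-fwd (subst (_∈ circ S) eq n₂∈circ)
    on-circ₁ : q ≡ n₁ → ⊥
    on-circ₁ eq = q∉ (subst (_∈ circ S) (sym eq) n₁∈circ)
    on-circ₂ : q ≡ n₂ → ⊥
    on-circ₂ eq = q∉ (subst (_∈ circ S) (sym eq) n₂∈circ)
    on-leg : Fwd S q (k₁ S) ⊎ ¬ Fwd S (k₁ S) q → q ≡ n₃ → ⊥
    on-leg (inj₁ back) _ = off-circ back (here refl)
    on-leg (inj₂ ¬q) eq = ¬q (subst (Fwd S (k₁ S)) (sym eq) n₃-fwd)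

  trail-first : ∀ {e₁ e₂ e₃ e₄ x ws z} {S : Sun e₁ e₂ e₃ e₄} → Trail S x ws z → first ws z ∉ circ S
  trail-first {ws = []} {S = S} tr m = circ∌Z S m (Z∋target (target tr))
  trail-first {ws = w ∷ ws} tr = All.head (off-S tr)

  fresh-detour : ∀ {e₁ e₂ e₃ e₄ qs} (S : Sun e₁ e₂ e₃ e₄) → Unique qs → All (_∉ circ S) qs → All (_∉ legs S) qs → All (_∉ Z) qs →
                 Unique (qs ++ circ S ++ legs S ++ Z)
  fresh-detour S u c l z = Unique.++⁺ u (unique S) λ (m , m′) →
    [ All.lookup c m , (λ m″ → [ All.lookup l m , All.lookup z m ]′ (∈-++⁻ (legs S) m″)) ]′ (∈-++⁻ (circ S) m′)

  -- `Good` says that the ends carry the cyclic order of the four-circuit of `G`. Both reroutings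
  -- keep the ends, so closure under the two symmetries is all the induction asks of it; `no-leap`
  -- is its terminal case.
  module _ (Good : ℕ → ℕ → ℕ → ℕ → Set)
           (rot-good : ∀ {e₁ e₂ e₃ e₄} → Good e₁ e₂ e₃ e₄ → Good e₂ e₃ e₄ e₁)
           (mirror-good : ∀ {e₁ e₂ e₃ e₄} → Good e₁ e₂ e₃ e₄ → Good e₂ e₁ e₄ e₃)
           (no-leap : ∀ {e₁ e₂ e₃ e₄ s′ u s″ qs z} → Good e₁ e₂ e₃ e₄ → (S : Sun e₁ e₂ e₃ e₄) → s₁₂ S ≡ s′ ++ u ∷ s″ →
                      Chain (E H) u qs z → Unique (qs ++ circ S ++ legs S ++ Z) → Target z → ⊥) where

    -- The case reached after rotation. A trail missing the legs yields a leap; otherwise the first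
    -- leg it meets decides the rerouting.
    near : ∀ n {e₁ e₂ e₃ e₄} → Good e₁ e₂ e₃ e₄ → (S : Sun e₁ e₂ e₃ e₄) → ∀ {x ws z} → length ws < n → x ∈ k₁ S ∷ s₁₂ S → Trail S x ws z → ⊥

    -- Induction on the length of the trail; the sun varies.
    no-trail : ∀ n {e₁ e₂ e₃ e₄} → Good e₁ e₂ e₃ e₄ → (S : Sun e₁ e₂ e₃ e₄) → ∀ {x ws z} → length ws < n → x ∈ circ S → Trail S x ws z → ⊥
    no-trail n g S lt x∈ tr with ∈-++⁻ (k₁ S ∷ s₁₂ S) x∈
    ... | inj₁ m = near n g S lt m tr
    ... | inj₂ m with ∈-++⁻ (k₂ S ∷ s₂₃ S) m
    ...   | inj₁ m = near n (rot-good g) (rot S) lt m (rot-trail tr)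
    ...   | inj₂ m with ∈-++⁻ (k₃ S ∷ s₃₄ S) m
    ...     | inj₁ m = near n (rot-good (rot-good g)) (rot (rot S)) lt m (rot-trail (rot-trail tr))
    ...     | inj₂ m = near n (rot-good (rot-good (rot-good g))) (rot (rot (rot S))) lt m (rot-trail (rot-trail (rot-trail tr)))

    onto-leg : ∀ n {e₁ e₂ e₃ e₄} → Good e₁ e₂ e₃ e₄ → (S : Sun e₁ e₂ e₃ e₄) → ∀ {s′ u s″ qs p ws z} → s₁₂ S ≡ s′ ++ u ∷ s″ →
               length (qs ++ p ∷ ws) < suc n → Trail S u (qs ++ p ∷ ws) z → All (_∉ legs S) qs → p ∈ l₁ S ⊎ p ∈ l₃ S → ⊥
    onto-leg n g S {qs = qs} {p} {ws} eq lt tr off p∈ = continue p∈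
      where
      q : Chain (E H) _ qs p
      q = chain-map proj₁ (proj₁ (split qs (chain tr)))
      uq : Unique (qs ++ circ S ++ legs S ++ Z)
      uq = fresh-detour S (proj₁ (unique-++⁻ qs (simple tr))) (All.++⁻ˡ qs (off-S tr)) off (All.++⁻ˡ qs (off-Z tr))
      -- The vertex `p` counts for the missing one: `ws` is shorter than `qs ++ p ∷ ws`.
      lt′ : ∀ {k} → k ≤ length ws → k < n
      lt′ le = ≤-trans (s≤s le) (≤-trans (≤-trans (m≤n+m _ (length qs)) (≤-reflexive (sym (length-++ qs)))) (s≤s⁻¹ lt))
      continue : p ∈ l₁ S ⊎ p ∈ l₃ S → ⊥
      continue (inj₁ m) with ∈-∃++ m
      ... | a , b , eq′ with resume (shift-advance S eq eq′ q uq) tr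
      ...   | x′ , ws′ , x′∈ , tr′ , le = no-trail n g (shift-corner S eq eq′ q uq) (lt′ le) x′∈ tr′
      continue (inj₂ m) with ∈-∃++ m
      ... | a , b , eq′ with resume (cross-advance S eq eq′ q uq) tr
      ...   | x′ , ws′ , x′∈ , tr′ , le = no-trail n g (cross-over S eq eq′ q uq) (lt′ le) x′∈ tr′

    -- Reflection turns legs 2 and 4 into legs 1 and 3 and leaves `u` on side 12, with the pieces
    -- before and after it exchanged.
    onto-mirror-leg : ∀ n {e₁ e₂ e₃ e₄} → Good e₁ e₂ e₃ e₄ → (S : Sun e₁ e₂ e₃ e₄) → ∀ {s′ u s″ qs p ws z} → s₁₂ S ≡ s′ ++ u ∷ s″ →
                      length (qs ++ p ∷ ws) < suc n → Trail S u (qs ++ p ∷ ws) z → All (_∉ legs S) qs → p ∈ l₂ S ⊎ p ∈ l₄ S → ⊥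
    onto-mirror-leg n g S {s′} {u} {s″} eq lt tr off = onto-leg n (mirror-good g) (mirror S) reversed lt (mirror-trail tr)
        (All.map (λ v∉ m → v∉ (∈-resp-↭ (swaps (l₂ S) (l₁ S) (l₄ S) (l₃ S)) m)) off)
      where
      reversed : reverse (s₁₂ S) ≡ reverse s″ ++ u ∷ reverse s′
      reversed = trans (cong reverse eq) (trans (reverse-++ s′ (u ∷ s″))
        (trans (cong (_++ reverse s′) (unfold-reverse u s″)) (++-assoc (reverse s″) [ u ] (reverse s′))))

    near (suc n) g S lt (here refl) tr = no-exit-at-corner S (trail-first tr) (chain-first (chain tr))
    near (suc n) g S {x} {ws} lt (there x∈) tr with ∈-∃++ x∈ | any? (_∈? legs S) ws
    ... | s′ , s″ , eq | no never = no-leap g S eq (chain-map proj₁ (chain tr))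
          (fresh-detour S (simple tr) (off-S tr) (All.¬Any⇒All¬ _ never) (off-Z tr)) (target tr)
    ... | s′ , s″ , eq | yes hit with split-first hit
    ...   | qs , p , rest , refl , off , p∈ with ∈-++⁻ (l₁ S) p∈
    ...     | inj₁ m = onto-leg n g S eq lt tr off (inj₁ m)
    ...     | inj₂ m with ∈-++⁻ (l₂ S) m
    ...       | inj₁ m = onto-mirror-leg n g S eq lt tr off (inj₁ m)
    ...       | inj₂ m with ∈-++⁻ (l₃ S) m
    ...         | inj₁ m = onto-leg n g S eq lt tr off (inj₂ m)
    ...         | inj₂ m = onto-mirror-leg n g S eq lt tr off (inj₂ m)

-- Existence of a residual trail

link-edge : ∀ {R k l e u v} → Chain R k l e → Link k l e u v → R u v
link-edge (edge r) (refl , refl) = r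
link-edge (r ◅ c) (inj₁ (refl , refl)) = r
link-edge (r ◅ c) (inj₂ q) = link-edge c q

link-spread : ∀ {A i} l {e u v} → (∀ {u v} → Link i l e u v → u ∈ A → v ∈ A) → i ∈ A → Link i l e u v → u ∈ A
link-spread [] cl i∈ (refl , _) = i∈
link-spread (j ∷ l) cl i∈ (inj₁ (refl , _)) = i∈
link-spread (j ∷ l) cl i∈ (inj₂ q) = link-spread l (cl ∘ inj₂) (cl (inj₁ (refl , refl)) i∈) q

-- Once the leg is in `A` it stays there, so it crosses into `A` at most once; if it never does, the
-- pair is a mere default.
entrance : ∀ (A : List ℕ) k l e → (∀ {u v} → Link k l e u v → u ∈ A → v ∈ A) →
           ∃[ p ] (∀ {u v} → Link k l e u v → u ∉ A → v ∈ A → (u , v) ≡ p)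
entrance A k [] e cl = (k , e) , λ { (refl , refl) _ _ → refl }
entrance A k (i ∷ l) e cl with i ∈? A
... | yes i∈ = (k , i) , λ
  { (inj₁ (refl , refl)) _ _ → refl
  ; (inj₂ q) u∉ _ → contradiction (link-spread l (cl ∘ inj₂) i∈ q) u∉ }
... | no i∉ with entrance A i l e (cl ∘ inj₂)
...   | p , h = p , λ
  { (inj₁ (refl , refl)) _ v∈ → contradiction v∈ i∉
  ; (inj₂ q) u∉ v∈ → h q u∉ v∈ }

module Search {H : Graph} (cubH : Cubic H) (Z : List ℕ) (Target : ℕ → Set) (Z∋target : ∀ {z} → Target z → z ∈ Z)
              (Z⊆V : Z ⊆ V H) {e₁ e₂ e₃ e₄ : ℕ} (S : Suns.Sun cubH Z e₁ e₂ e₃ e₄) where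
  open WF (proj₁ cubH)
  open Suns cubH Z
  open Sun S
  open Augment cubH Z Target Z∋target
  open Trail using () renaming (chain to trail-chain; simple to trail-simple; off-Z to trail-off-Z; off-S to trail-off-S; target to trail-target)

  around : Chain (E H) k₁ (s₁₂ ++ k₂ ∷ s₂₃ ++ k₃ ∷ s₃₄ ++ k₄ ∷ s₄₁) k₁
  around = join c₁₂ (join c₂₃ (join c₃₄ c₄₁))

  circ⊆V : circ ⊆ V H
  circ⊆V = All.lookup (chain-V around)

  circ-isCircuit : IsCircuit H circ
  circ-isCircuit = circ-unique S , s≤s (long s₁₂ (long s₂₃ z≤n)) , (λ _ → circ⊆V) , chain⇒consec around
    where
    long : ∀ s {x r n} → n ≤ length r → suc n ≤ length (s ++ x ∷ r)
    long [] le = s≤s le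
    long (_ ∷ s) le = ≤-trans (long s le) (n≤1+n _)

  fwd-edge : ∀ {u v} → Fwd u v → E H u v
  fwd-edge (inj₁ q) = link-edge t₁ q
  fwd-edge (inj₂ (inj₁ q)) = link-edge t₂ q
  fwd-edge (inj₂ (inj₂ (inj₁ q))) = link-edge t₃ q
  fwd-edge (inj₂ (inj₂ (inj₂ q))) = link-edge t₄ q

  Closed : List ℕ → Set
  Closed A = ∀ {u v} → Res u v → v ∈ A → u ∈ A

  -- Every edge entering a closed set is a leg edge, and each leg enters it once: the set is cut off by at most four edges.
  closed-small-cut : CyclicallyConnected 5 H → ∀ A → Z ⊆ A → (∀ {v} → v ∈ circ → v ∉ A) → Closed A →
                     ∃[ cs ] (IsCircuit H cs × All (_∈ Z) cs) → ⊥
  closed-small-cut (_ , cyc) A Z⊆A circ∌A closedA (cs , isC , cs⊆Z) =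
    <-irrefl refl (≤-trans (cyc X (circ , circ-isCircuit , All.tabulate (X-true ∘ circ∌A))
                                  (cs , isC , All.map (X-false ∘ Z⊆A) cs⊆Z))
                           (cut-≤ (proj₁ cubH) X (p₁ ∷ p₂ ∷ p₃ ∷ p₄ ∷ []) cover))
    where
    X : ℕ → Bool
    X v = not (does (v ∈? A))
    X-true : ∀ {v} → v ∉ A → X v ≡ true
    X-true {v} v∉ = cong not (dec-false (v ∈? A) v∉)
    X-false : ∀ {v} → v ∈ A → X v ≡ false
    X-false {v} v∈ = cong not (dec-true (v ∈? A) v∈)
    out : ∀ {v} → X v ≡ true → v ∉ A
    out eq v∈ with trans (sym eq) (X-false v∈)
    ... | ()
    into : ∀ {v} → X v ≡ false → v ∈ A
    into {v} eq with v ∈? A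
    ... | yes v∈ = v∈
    into () | no _
    -- The step from `v` back to `u` is residual, so closedness carries membership outwards along
    -- the leg.
    propagate : ∀ {u v} → Fwd u v → u ∈ A → v ∈ A
    propagate f = closedA (E-sym (fwd-edge f) , inj₁ f)
    x₁ = entrance A k₁ l₁ e₁ (propagate ∘ inj₁)
    x₂ = entrance A k₂ l₂ e₂ (propagate ∘ inj₂ ∘ inj₁)
    x₃ = entrance A k₃ l₃ e₃ (propagate ∘ inj₂ ∘ inj₂ ∘ inj₁)
    x₄ = entrance A k₄ l₄ e₄ (propagate ∘ inj₂ ∘ inj₂ ∘ inj₂)
    p₁ = proj₁ x₁
    p₂ = proj₁ x₂
    p₃ = proj₁ x₃
    p₄ = proj₁ x₄
    cover : ∀ {u v} → X u ≡ true → X v ≡ false → E H u v → (u , v) ∈ p₁ ∷ p₂ ∷ p₃ ∷ p₄ ∷ []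
    cover {u} {v} xu xv e with fwd? u v
    ... | yes (inj₁ q) = here (proj₂ x₁ q (out xu) (into xv))
    ... | yes (inj₂ (inj₁ q)) = there (here (proj₂ x₂ q (out xu) (into xv)))
    ... | yes (inj₂ (inj₂ (inj₁ q))) = there (there (here (proj₂ x₃ q (out xu) (into xv))))
    ... | yes (inj₂ (inj₂ (inj₂ q))) = there (there (there (here (proj₂ x₄ q (out xu) (into xv)))))
    -- An edge that is not a forward leg edge would be a residual step into `A` from outside.
    ... | no ¬q = contradiction (closedA (e , inj₂ ¬q) (into xv)) (out xu)

  module _ (enter : ∀ {x z} → x ∉ Z → z ∈ Z → Res x z → Target z) where

    -- Keeping the interior of the trail inside `A` guarantees that a vertex outside `A` can be put
    -- in front of it without repetition.
    Reached : List ℕ → ℕ → Set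
    Reached A v = v ∈ Z ⊎ (v ∉ circ × v ∉ Z × ∃₂ λ ws z → Trail S v ws z × v ∉ ws × ws ⊆ A)

    extend : ∀ {A x y} → x ∉ Z → Reached A y → y ∈ A → Res x y → ∃₂ λ ws z → Trail S x ws z × ws ⊆ A
    extend x∉ (inj₁ y∈Z) _ r = [] , _ ,
      record { chain = edge r ; simple = [] ; off-Z = [] ; off-S = [] ; target = enter x∉ y∈Z r } , λ ()
    extend x∉ (inj₂ (y∉c , y∉Z , ws , z , tr , y∉ws , ws⊆)) y∈ r = _ ∷ ws , z ,
      record { chain = r ◅ trail-chain tr ; simple = unique-∷⁺ y∉ws (trail-simple tr) ; off-Z = y∉Z ∷ trail-off-Z tr
             ; off-S = y∉c ∷ trail-off-S tr ; target = trail-target tr } , λ { (here refl) → y∈ ; (there m) → ws⊆ m }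

    -- A search backwards from `Z`. Each round adds a vertex of `H` to `A`, so the fuel cannot run
    -- out; the search ends when the new vertex is on the circuit or when no residual step enters
    -- `A`.
    search : ∀ fuel A → length (V H) < fuel + length A → Unique A → Z ⊆ A → A ⊆ V H → (∀ {v} → v ∈ circ → v ∉ A) →
             (∀ {v} → v ∈ A → Reached A v) →
             (∃[ x ] ∃₂ λ ws z → x ∈ circ × Trail S x ws z) ⊎ (∃[ B ] (Z ⊆ B × (∀ {v} → v ∈ circ → v ∉ B) × Closed B))
    search zero A lt u _ A⊆V _ _ = contradiction (unique-⊆⇒length≤ u A⊆V) (λ le → <-irrefl refl (≤-trans lt le))
    search (suc fuel) A lt u Z⊆A A⊆V circ∌A reached
      with any? (λ x → ¬? (x ∈? A) ×-dec any? (λ y → res? x y) A) (V H)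
    ... | no none = inj₂ (A , Z⊆A , circ∌A , λ {x} r y∈ → decidable-stable (x ∈? A) λ x∉ → none (lose (E-src (proj₁ r)) (x∉ , lose y∈ r)))
    ... | yes some with find some
    ...   | x , x∈V , x∉A , some-y with find some-y
    ...     | y , y∈A , r with extend (x∉A ∘ Z⊆A) (reached y∈A) y∈A r
    ...       | ws , z , tr , ws⊆A with x ∈? circ
    ...         | yes x∈ = inj₁ (x , ws , z , x∈ , tr)
    ...         | no x∉ = search fuel (x ∷ A) (≤-trans lt (≤-reflexive (sym (+-suc fuel (length A))))) (unique-∷⁺ x∉A u) (there ∘ Z⊆A)
                  (λ { (here refl) → x∈V ; (there m) → A⊆V m }) (λ { v∈ (here refl) → x∉ v∈ ; v∈ (there m) → circ∌A v∈ m })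
                  λ { (here refl) → inj₂ (x∉ , x∉A ∘ Z⊆A , ws , z , tr , (λ m → x∉A (ws⊆A m)) , there ∘ ws⊆A)
                    ; (there m) → weaken (reached m) }
      where
      weaken : ∀ {x v} → Reached A v → Reached (x ∷ A) v
      weaken (inj₁ m) = inj₁ m
      weaken (inj₂ (a , b , ws , z , tr , c , d)) = inj₂ (a , b , ws , z , tr , c , there ∘ d)

    exists-trail : CyclicallyConnected 5 H → ∃[ cs ] (IsCircuit H cs × All (_∈ Z) cs) → ∃[ x ] ∃₂ λ ws z → x ∈ circ × Trail S x ws z
    exists-trail cyc C
      with search (suc (length (V H))) Z (s≤s (m≤m+n _ _)) (proj₁ (proj₂ (unique-++⁻ legs (proj₁ (proj₂ (unique-++⁻ circ unique))))))
             id Z⊆V circ∌Z inj₁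
    ... | inj₁ found = found
    ... | inj₂ (B , Z⊆B , circ∌B , closedB) = ⊥-elim (closed-small-cut cyc B Z⊆B circ∌B closedB C)

-- The image of an induced subgraph

map-unique⁺ : ∀ (f : ℕ → ℕ) {xs} → (∀ {u v} → u ∈ xs → v ∈ xs → f u ≡ f v → u ≡ v) → Unique xs → Unique (map f xs)
map-unique⁺ f inj [] = []
map-unique⁺ f {x ∷ xs} inj (x∉ ∷ u) = All.map⁺ (All.tabulate λ y∈ eq → All.lookup x∉ y∈ (inj (here refl) (there y∈) eq))
  ∷ map-unique⁺ f (λ u∈ v∈ → inj (there u∈) (there v∈)) u

module Region {F G H : Graph} (cubG : Cubic G) (cubH : Cubic H) (e : Embedding F G H) where
  open Emb (proj₁ cubG) e
  open WF (proj₁ cubG)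
  private module H = WF (proj₁ cubH)

  threadOf : ℕ × ℕ → Thread
  threadOf (a , b) = thread a (I a b) b

  Distinct : ℕ × ℕ → ℕ × ℕ → Set
  Distinct (a , b) (c , d) = DistinctEdges a b c d

  mids-unique : ∀ {ps} → All (uncurry (E G)) ps → AllPairs Distinct ps → Unique (mids (map threadOf ps))
  mids-unique [] [] = []
  mids-unique {(a , b) ∷ ps} (ab ∷ es) (d ∷ ds) = Unique.++⁺ (I-unique ab) (mids-unique es ds) disjoint
    where
    disjoint : Disjoint (I a b) (mids (map threadOf ps))
    disjoint (m , m′) with ∈-mids⁻ _ m′
    ... | t , t∈ , mt with ∈-map⁻ threadOf t∈
    ...   | p , p∈ , refl = I-disjoint ab (All.lookup es p∈) (All.lookup d p∈) m mt

  edge? : ∀ p → Dec (proj₁ p < proj₂ p × E G (proj₁ p) (proj₂ p))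
  edge? (a , b) = (a <? b) ×-dec E-dec G a b

  -- Ordering the ends lists each edge once, so that its inner vertices occur only once in `region`.
  pairsOn : List ℕ → List (ℕ × ℕ)
  pairsOn K = filter edge? (cartesianProduct K K)

  threadsOn : List ℕ → List Thread
  threadsOn K = map threadOf (pairsOn K)

  region : List ℕ → List ℕ
  region K = map η K ++ mids (threadsOn K)

  pairsOn-∈⁻ : ∀ {K a b} → (a , b) ∈ pairsOn K → a ∈ K × b ∈ K × a < b × E G a b
  pairsOn-∈⁻ {K} p∈ with ∈-filter⁻ edge? {xs = cartesianProduct K K} p∈
  ... | m , lt , ab with ∈-cartesianProduct⁻ K K m
  ...   | a∈ , b∈ = a∈ , b∈ , lt , ab

  threadsOn-∈⁻ : ∀ {K t} → t ∈ threadsOn K → src t ∈ K × tgt t ∈ K × E G (src t) (tgt t) × mid t ≡ I (src t) (tgt t)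
  threadsOn-∈⁻ t∈ with ∈-map⁻ threadOf t∈
  ... | p , p∈ , refl with pairsOn-∈⁻ p∈
  ...   | a∈ , b∈ , _ , ab = a∈ , b∈ , ab , refl

  threadsOn-∈⁺ : ∀ {K a b} → a ∈ K → b ∈ K → E G a b → threadOf (a , b) ∈ threadsOn K ⊎ threadOf (b , a) ∈ threadsOn K
  threadsOn-∈⁺ {a = a} {b} a∈ b∈ ab with <-cmp a b
  ... | tri< lt _ _ = inj₁ (∈-map⁺ threadOf (∈-filter⁺ edge? (∈-cartesianProduct⁺ a∈ b∈) (lt , ab)))
  ... | tri≈ _ eq _ = contradiction eq (E-irrefl ab)
  ... | tri> _ _ gt = inj₂ (∈-map⁺ threadOf (∈-filter⁺ edge? (∈-cartesianProduct⁺ b∈ a∈) (gt , E-sym ab)))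

  pairsOn-distinct : ∀ {K} → Unique K → AllPairs Distinct (pairsOn K)
  pairsOn-distinct {K} u = go (All.tabulate λ m → proj₁ (proj₂ (proj₂ (pairsOn-∈⁻ {K} m))))
                              (Unique.filter⁺ edge? (Unique.cartesianProduct⁺ u u))
    where
    go : ∀ {ps} → All (λ p → proj₁ p < proj₂ p) ps → Unique ps → AllPairs Distinct ps
    go [] [] = []
    go {(a , b) ∷ ps} (lt ∷ lts) (n ∷ u) = All.zipWith distinct (n , lts) ∷ go lts u
      where
      distinct : ∀ {q} → (a , b) ≢ q × proj₁ q < proj₂ q → Distinct (a , b) q
      distinct (ne , lt′) = (λ { (refl , refl) → ne refl }) , λ { (refl , refl) → <-asym lt lt′ }

  I⊆region : ∀ {K a b v} → a ∈ K → b ∈ K → E G a b → v ∈ I a b → v ∈ mids (threadsOn K)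
  I⊆region a∈ b∈ ab v∈ with threadsOn-∈⁺ a∈ b∈ ab
  ... | inj₁ t∈ = ∈-mids⁺ t∈ v∈
  ... | inj₂ t∈ = ∈-mids⁺ t∈ (subst (_ ∈_) (sym (I-rev ab)) (∈-reverse v∈))

  path⊆region : ∀ {K a b v} → a ∈ K → b ∈ K → E G a b → v ∈ I a b ++ [ η b ] → v ∈ region K
  path⊆region {K} {a} {b} a∈ b∈ ab v∈ with ∈-++⁻ (I a b) v∈
  ... | inj₁ m = ∈-++⁺ʳ (map η K) (I⊆region a∈ b∈ ab m)
  ... | inj₂ (here refl) = ∈-++⁺ˡ (∈-map⁺ η b∈)

  region-∈⁻ : ∀ K {v} → v ∈ region K → (∃[ w ] (w ∈ K × v ≡ η w)) ⊎ (∃₂ λ a b → a ∈ K × b ∈ K × E G a b × v ∈ I a b)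
  region-∈⁻ K v∈ with ∈-++⁻ (map η K) v∈
  ... | inj₁ m = inj₁ (∈-map⁻ η m)
  ... | inj₂ m with ∈-mids⁻ (threadsOn K) m
  ...   | t , t∈ , mt with threadsOn-∈⁻ t∈
  ...     | a∈ , b∈ , ab , eq = inj₂ (src t , tgt t , a∈ , b∈ , ab , subst (_ ∈_) eq mt)

  region-mono : ∀ {K K′} → K ⊆ K′ → region K ⊆ region K′
  region-mono {K} {K′} sub v∈ with region-∈⁻ K v∈
  ... | inj₁ (w , w∈ , refl) = ∈-++⁺ˡ (∈-map⁺ η (sub w∈))
  ... | inj₂ (a , b , a∈ , b∈ , ab , m) = ∈-++⁺ʳ (map η K′) (I⊆region (sub a∈) (sub b∈) ab m)

  region⊆V : ∀ {K} → K ⊆ V G → region K ⊆ V H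
  region⊆V {K} sub v∈ with region-∈⁻ K v∈
  ... | inj₁ (w , w∈ , refl) = η-in w (sub w∈)
  ... | inj₂ (a , b , a∈ , b∈ , ab , m) = All.lookup (H.chain-V (I-chain ab)) (there m)

  -- At a branch vertex the images of two edges leave by different vertices; at an inner vertex the
  -- two neighbours along its path differ because the path is simple.
  region-two : ∀ {K} → (∀ {v} → v ∈ K → ∃₂ λ n₁ n₂ → n₁ ≢ n₂ × E G v n₁ × E G v n₂ × n₁ ∈ K × n₂ ∈ K) →
               ∀ {v} → v ∈ region K → ∃₂ λ n₁ n₂ → n₁ ≢ n₂ × E H v n₁ × E H v n₂ × n₁ ∈ region K × n₂ ∈ region K
  region-two {K} two v∈ with region-∈⁻ K v∈
  ... | inj₁ (w , w∈ , refl) with two w∈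
  ...   | a , b , a≢b , wa , wb , a∈ , b∈ =
          first (I w a) (η a) , first (I w b) (η b) , a≢b ∘ first-injective wa wb , chain-first (I-chain wa) , chain-first (I-chain wb) ,
          path⊆region w∈ a∈ wa (first-∈ (I w a) (η a)) , path⊆region w∈ b∈ wb (first-∈ (I w b) (η b))
  region-two {K} two {v} v∈ | inj₂ (a , b , a∈ , b∈ , ab , m) with ∈-∃++ m
  ... | pre , post , eq = n₁ , n₂ , n₁≢n₂ , chain-first (chain-reverse H.E-sym (proj₁ parts)) , chain-first (proj₂ parts) ,
      n₁∈region n₁∈ , path⊆region a∈ b∈ ab (subst (λ l → n₂ ∈ l ++ [ η b ]) (sym eq) (subst (n₂ ∈_) (sym (++-assoc pre (v ∷ post) [ η b ])) (∈-++⁺ʳ pre (there n₂∈))))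
    where
    n₁ = first (reverse pre) (η a)
    n₂ = first post (η b)
    parts = split pre (subst (λ l → Chain (E H) (η a) l (η b)) eq (I-chain ab))
    n₁∈ : n₁ ∈ η a ∷ pre
    n₁∈ with ∈-++⁻ (reverse pre) (first-∈ (reverse pre) (η a))
    ... | inj₁ m = there (∈-reverse⁻ m)
    ... | inj₂ (here r) = here r
    n₂∈ : n₂ ∈ post ++ [ η b ]
    n₂∈ = first-∈ post (η b)
    uniq : Unique ((η a ∷ pre) ++ v ∷ post ++ [ η b ])
    uniq = subst Unique (cong (η a ∷_) (trans (cong (_++ [ η b ]) eq) (++-assoc pre (v ∷ post) [ η b ]))) (P-unique ab)
    n₁≢n₂ : n₁ ≢ n₂
    n₁≢n₂ r = proj₂ (proj₂ (unique-++⁻ (η a ∷ pre) uniq)) (n₁∈ , there (subst (_∈ post ++ [ η b ]) (sym r) n₂∈))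
    n₁∈region : n₁ ∈ η a ∷ pre → n₁ ∈ region K
    n₁∈region (here r) = subst (_∈ region K) (sym r) (∈-++⁺ˡ (∈-map⁺ η a∈))
    n₁∈region (there m) = ∈-++⁺ʳ (map η K) (I⊆region a∈ b∈ ab (subst (n₁ ∈_) (sym eq) (∈-++⁺ˡ m)))

  -- Minimum degree two passes from the core to its image, and the circuit is then found in `H`
  -- itself, so no circuit of `G` has to be transported.
  circuit-in-region : ∀ {W} → Unique W → 1 ≤ length W → length W ≤ edgesIn (proj₁ cubG) W → ∃[ cs ] (IsCircuit H cs × All (_∈ region W) cs)
  circuit-in-region {W} u ne dense with core (proj₁ cubG) (length W) W ≤-refl u ne dense
  ... | K , K⊆W , (v , v∈) , two with min-degree-two⇒circuit (proj₁ cubH) (region-two two) (∈-++⁺ˡ (∈-map⁺ η v∈))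
  ...   | cs , isC , cs⊆ = cs , isC , All.map (region-mono K⊆W) cs⊆

-- The sun of an embedding

link-reverse : ∀ {k} l {e u v} → Link k l e u v → Link e (reverse l) k v u
link-reverse [] (refl , refl) = refl , refl
link-reverse (i ∷ l) q rewrite unfold-reverse i l with q
... | inj₁ (refl , refl) = link-++⁺ʳ (reverse l) (refl , refl)
... | inj₂ r = link-++⁺ˡ (reverse l) (link-reverse l r)

unique-⊆⇒↭ : ∀ {xs ys : List ℕ} → Unique xs → xs ⊆ ys → ∃[ zs ] (ys ↭ xs ++ zs)
unique-⊆⇒↭ {[]} {ys} _ _ = ys , ↭-refl
unique-⊆⇒↭ {x ∷ xs} u sub with ∈-∃++ (sub (here refl))
... | ls , rs , refl with unique-⊆⇒↭ {xs} {ls ++ rs} (unique-∷⁻ u) rest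
  where
  rest : xs ⊆ ls ++ rs
  rest y∈ with ∈-resp-↭ (shift x ls rs) (sub (there y∈))
  ... | here refl = contradiction y∈ (Unique.Unique[x∷xs]⇒x∉xs u)
  ... | there m = m
...   | zs , σ = zs , ↭-trans (shift x ls rs) (prep x σ)

record Corner (G : Graph) (W : List ℕ) (p v n d : ℕ) : Set where
  field
    to-prev : E G v p
    to-next : E G v n
    to-leg  : E G v d
    only    : ∀ w → E G v w → w ≡ p ⊎ w ≡ n ⊎ w ≡ d
    leg∈    : d ∈ W

corner-swap : ∀ {G W p v n d} → Corner G W p v n d → Corner G W n v p d
corner-swap q = record { to-prev = to-next ; to-next = to-prev ; to-leg = to-leg ; leg∈ = leg∈ ; only = λ w vw → turn (only w vw) }
  where
  open Corner q
  turn : ∀ {A B C : Set} → A ⊎ B ⊎ C → B ⊎ A ⊎ C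
  turn (inj₁ a) = inj₂ (inj₁ a)
  turn (inj₂ (inj₁ b)) = inj₁ b
  turn (inj₂ (inj₂ c)) = inj₂ (inj₂ c)

-- A labelling of the square that may start anywhere and run either way. `C` stays fixed, so sides
-- are recorded as edges of `C` and corners only up to permutation.
record Ring (G : Graph) (C W : List ℕ) (a₁ a₂ a₃ a₄ d₁ d₂ d₃ d₄ : ℕ) : Set where
  field
    C-↭ : a₁ ∷ a₂ ∷ a₃ ∷ a₄ ∷ [] ↭ C
    q₁ : Corner G W a₄ a₁ a₂ d₁
    q₂ : Corner G W a₁ a₂ a₃ d₂
    q₃ : Corner G W a₂ a₃ a₄ d₃
    q₄ : Corner G W a₃ a₄ a₁ d₄
    on₁₂ : CircuitEdge C a₁ a₂
    on₂₃ : CircuitEdge C a₂ a₃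
    on₃₄ : CircuitEdge C a₃ a₄
    on₄₁ : CircuitEdge C a₄ a₁

module _ {G : Graph} {C W : List ℕ} {a₁ a₂ a₃ a₄ d₁ d₂ d₃ d₄ : ℕ} (r : Ring G C W a₁ a₂ a₃ a₄ d₁ d₂ d₃ d₄) where
  open Ring r

  rot-ring : Ring G C W a₂ a₃ a₄ a₁ d₂ d₃ d₄ d₁
  rot-ring = record
    { C-↭ = ↭-trans (cycle [ a₁ ] [ a₂ ] [ a₃ ] [ a₄ ]) C-↭ ; q₁ = q₂ ; q₂ = q₃ ; q₃ = q₄ ; q₄ = q₁
    ; on₁₂ = on₂₃ ; on₂₃ = on₃₄ ; on₃₄ = on₄₁ ; on₄₁ = on₁₂ }
    where
    cycle : ∀ a b c d → b ++ c ++ d ++ a ↭ a ++ b ++ c ++ d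
    cycle = solve 4 (λ a b c d → (b ⊕ c ⊕ d ⊕ a) ⊜ (a ⊕ b ⊕ c ⊕ d)) ↭-refl

  mirror-ring : Ring G C W a₂ a₁ a₄ a₃ d₂ d₁ d₄ d₃
  mirror-ring = record
    { C-↭ = ↭-trans (swap a₂ a₁ (swap a₄ a₃ ↭-refl)) C-↭
    ; q₁ = corner-swap q₂ ; q₂ = corner-swap q₁ ; q₃ = corner-swap q₄ ; q₄ = corner-swap q₃
    ; on₁₂ = seqEdge-sym (C ++ take 1 C) on₁₂ ; on₂₃ = seqEdge-sym (C ++ take 1 C) on₄₁
    ; on₃₄ = seqEdge-sym (C ++ take 1 C) on₃₄ ; on₄₁ = seqEdge-sym (C ++ take 1 C) on₂₃ }

-- The third neighbour of `v` could lie on the square only as the opposite corner `o`, and that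
-- chord would close the triangle `v`, `n`, `o`, against girth four.
third-corner : ∀ {G C W p v n o} → Cubic G → (∀ cs → IsCircuit G cs → 4 ≤ length cs) → V G ↭ C ++ W →
               E G v p → E G v n → E G n o → p ≢ n → v ≢ o → (∀ {w} → w ∈ C → w ≡ p ⊎ w ≡ v ⊎ w ≡ n ⊎ w ≡ o) →
               ∃[ d ] Corner G W p v n d
third-corner {G} {C} {W} {p} {v} {n} {o} cub girth σ vp vn on p≢n v≢o C⊆ with cubic-third cub vp vn p≢n
... | d , vd , d≢p , d≢n , only = d , record { to-prev = vp ; to-next = vn ; to-leg = vd ; only = only ; leg∈ = d∈W }
  where
  open WF (proj₁ cub)
  no-triangle : d ≢ o
  no-triangle refl with girth (v ∷ n ∷ o ∷ [])
    ( (E-irrefl vn ∷ v≢o ∷ []) ∷ (E-irrefl on ∷ []) ∷ [] ∷ []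
    , ≤-refl
    , (λ _ → λ { (here refl) → E-src vn ; (there (here refl)) → E-src on ; (there (there (here refl))) → E-tgt on })
    , vn , on , E-sym vd , tt )
  ... | s≤s (s≤s (s≤s ()))
  d∉C : d ∉ C
  d∉C m with C⊆ m
  ... | inj₁ eq = d≢p eq
  ... | inj₂ (inj₁ eq) = E-irrefl vd (sym eq)
  ... | inj₂ (inj₂ (inj₁ eq)) = d≢n eq
  ... | inj₂ (inj₂ (inj₂ eq)) = no-triangle eq
  d∈W : d ∈ W
  d∈W with ∈-++⁻ C (∈-resp-↭ σ (E-tgt vd))
  ... | inj₁ m = contradiction m d∉C
  ... | inj₂ m = m

square-ring : ∀ {G c₁ c₂ c₃ c₄ W} → Cubic G → (∀ cs → IsCircuit G cs → 4 ≤ length cs) →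
              IsCircuit G (c₁ ∷ c₂ ∷ c₃ ∷ c₄ ∷ []) → V G ↭ c₁ ∷ c₂ ∷ c₃ ∷ c₄ ∷ W →
              ∃₂ λ d₁ d₂ → ∃₂ λ d₃ d₄ → Ring G (c₁ ∷ c₂ ∷ c₃ ∷ c₄ ∷ []) W c₁ c₂ c₃ c₄ d₁ d₂ d₃ d₄
square-ring {G} {c₁} {c₂} {c₃} {c₄} cub girth
  (((n₁₂ ∷ n₁₃ ∷ n₁₄ ∷ []) ∷ (n₂₃ ∷ n₂₄ ∷ []) ∷ (n₃₄ ∷ []) ∷ [] ∷ []) , _ , _ , (e₁₂ , e₂₃ , e₃₄ , e₄₁ , _)) σ
  with third-corner cub girth σ e₁₄ e₁₂ e₂₃ (≢-sym n₂₄) n₁₃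
         (λ { (here eq) → inj₂ (inj₁ eq) ; (there (here eq)) → inj₂ (inj₂ (inj₁ eq)) ; (there (there (here eq))) → inj₂ (inj₂ (inj₂ eq)) ; (there (there (there (here eq)))) → inj₁ eq })
     | third-corner cub girth σ (E-sym e₁₂) e₂₃ e₃₄ n₁₃ n₂₄
         (λ { (here eq) → inj₁ eq ; (there (here eq)) → inj₂ (inj₁ eq) ; (there (there (here eq))) → inj₂ (inj₂ (inj₁ eq)) ; (there (there (there (here eq)))) → inj₂ (inj₂ (inj₂ eq)) })
     | third-corner cub girth σ (E-sym e₂₃) e₃₄ e₄₁ n₂₄ (≢-sym n₁₃)
         (λ { (here eq) → inj₂ (inj₂ (inj₂ eq)) ; (there (here eq)) → inj₁ eq ; (there (there (here eq))) → inj₂ (inj₁ eq) ; (there (there (there (here eq)))) → inj₂ (inj₂ (inj₁ eq)) })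
     | third-corner cub girth σ (E-sym e₃₄) e₄₁ e₁₂ (≢-sym n₁₃) (≢-sym n₂₄)
         (λ { (here eq) → inj₂ (inj₂ (inj₁ eq)) ; (there (here eq)) → inj₂ (inj₂ (inj₂ eq)) ; (there (there (here eq))) → inj₁ eq ; (there (there (there (here eq)))) → inj₂ (inj₁ eq) })
  where
  open WF (proj₁ cub)
  e₁₄ : E G c₁ c₄
  e₁₄ = E-sym e₄₁
... | d₁ , q₁ | d₂ , q₂ | d₃ , q₃ | d₄ , q₄ = d₁ , d₂ , d₃ , d₄ , record
  { C-↭ = ↭-refl ; q₁ = q₁ ; q₂ = q₂ ; q₃ = q₃ ; q₄ = q₄
  ; on₁₂ = inj₁ (inj₁ (refl , refl)) ; on₂₃ = inj₂ (inj₁ (inj₁ (refl , refl)))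
  ; on₃₄ = inj₂ (inj₂ (inj₁ (inj₁ (refl , refl)))) ; on₄₁ = inj₂ (inj₂ (inj₂ (inj₁ (inj₁ (refl , refl))))) }

module Initial {F G H : Graph} (cubG : Cubic G) (cubH : Cubic H) (e : Embedding F G H) {C W : List ℕ} (V-↭ : V G ↭ C ++ W)
               {a₁ a₂ a₃ a₄ d₁ d₂ d₃ d₄ : ℕ} (ring : Ring G C W a₁ a₂ a₃ a₄ d₁ d₂ d₃ d₄) where
  open Emb (proj₁ cubG) e
  open WF (proj₁ cubG)
  open Region cubG cubH e
  open Ring ring
  open Corner
  private module H = WF (proj₁ cubH)

  Z : List ℕ
  Z = region W

  open Suns cubH Z

  σ : V G ↭ a₁ ∷ a₂ ∷ a₃ ∷ a₄ ∷ W
  σ = ↭-trans V-↭ (++⁺ʳ W (↭-sym C-↭))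

  private
    corners : List ℕ
    corners = a₁ ∷ a₂ ∷ a₃ ∷ a₄ ∷ []
    all-unique : Unique (corners ++ W)
    all-unique = unique-resp-↭ σ uniqueV
    corners-unique : Unique corners
    corners-unique = proj₁ (unique-++⁻ corners all-unique)
    W-unique : Unique W
    W-unique = proj₁ (proj₂ (unique-++⁻ corners all-unique))
    ∉W : ∀ {a} → a ∈ corners → a ∉ W
    ∉W m m′ = proj₂ (proj₂ (unique-++⁻ corners all-unique)) (m , m′)
    W⊆V : W ⊆ V G
    W⊆V m = ∈-resp-↭ (↭-sym σ) (∈-++⁺ʳ corners m)

    cycleEdges legEdges : List (ℕ × ℕ)
    cycleEdges = (a₁ , a₂) ∷ (a₂ , a₃) ∷ (a₃ , a₄) ∷ (a₄ , a₁) ∷ []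
    legEdges = (a₁ , d₁) ∷ (a₂ , d₂) ∷ (a₃ , d₃) ∷ (a₄ , d₄) ∷ []

    apart₁ : ∀ {a b c d} → a ≢ c → a ≢ d → DistinctEdges a b c d
    apart₁ ac ad = ac ∘ proj₁ , ad ∘ proj₁

    m₁ : a₁ ∈ corners
    m₁ = here refl
    m₂ : a₂ ∈ corners
    m₂ = there (here refl)
    m₃ : a₃ ∈ corners
    m₃ = there (there (here refl))
    m₄ : a₄ ∈ corners
    m₄ = there (there (there (here refl)))

    ≢W : ∀ {a d} → a ∈ corners → d ∈ W → a ≢ d
    ≢W a∈ d∈ refl = ∉W a∈ d∈

    cycle-distinct : Unique corners → AllPairs Distinct cycleEdges
    cycle-distinct ((n₁₂ ∷ n₁₃ ∷ n₁₄ ∷ []) ∷ (n₂₃ ∷ n₂₄ ∷ []) ∷ (n₃₄ ∷ []) ∷ [] ∷ []) =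
      (apart₁ n₁₂ n₁₃ ∷ apart₁ n₁₃ n₁₄ ∷ (n₁₄ ∘ proj₁ , n₂₄ ∘ proj₂) ∷ []) ∷
      (apart₁ n₂₃ n₂₄ ∷ apart₁ n₂₄ (≢-sym n₁₂) ∷ []) ∷ (apart₁ n₃₄ (≢-sym n₁₃) ∷ []) ∷ [] ∷ []

    leg-distinct : Unique corners → AllPairs Distinct legEdges
    leg-distinct ((n₁₂ ∷ n₁₃ ∷ n₁₄ ∷ []) ∷ (n₂₃ ∷ n₂₄ ∷ []) ∷ (n₃₄ ∷ []) ∷ [] ∷ []) =
      (apart₁ n₁₂ (≢W m₁ (leg∈ q₂)) ∷ apart₁ n₁₃ (≢W m₁ (leg∈ q₃)) ∷ apart₁ n₁₄ (≢W m₁ (leg∈ q₄)) ∷ []) ∷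
      (apart₁ n₂₃ (≢W m₂ (leg∈ q₃)) ∷ apart₁ n₂₄ (≢W m₂ (leg∈ q₄)) ∷ []) ∷
      (apart₁ n₃₄ (≢W m₃ (leg∈ q₄)) ∷ []) ∷ [] ∷ []

    cycle-ends : All (λ p → proj₁ p ∈ corners × proj₂ p ∈ corners) cycleEdges
    cycle-ends = (m₁ , m₂) ∷ (m₂ , m₃) ∷ (m₃ , m₄) ∷ (m₄ , m₁) ∷ []

    leg-ends : All (λ p → proj₁ p ∈ corners × proj₂ p ∈ W) legEdges
    leg-ends = (m₁ , leg∈ q₁) ∷ (m₂ , leg∈ q₂) ∷ (m₃ , leg∈ q₃) ∷ (m₄ , leg∈ q₄) ∷ []

    region-ends : All (λ p → proj₁ p ∈ W × proj₂ p ∈ W) (pairsOn W)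
    region-ends = All.tabulate λ {p} m → let a∈ , b∈ , _ = pairsOn-∈⁻ {W} m in a∈ , b∈

    all-pairs : List (ℕ × ℕ)
    all-pairs = cycleEdges ++ legEdges ++ pairsOn W

    all-distinct : AllPairs Distinct all-pairs
    all-distinct = AllPairs.++⁺ (cycle-distinct corners-unique)
      (AllPairs.++⁺ (leg-distinct corners-unique) (pairsOn-distinct W-unique)
        (All.map (λ (a∈ , _) → All.map (λ (c∈ , d∈) → apart₁ (≢W a∈ c∈) (≢W a∈ d∈)) region-ends) leg-ends))
      (All.map (λ (a∈ , b∈) → All.++⁺ (All.map (λ (_ , d∈) → to-W a∈ b∈ d∈) leg-ends) (All.map (λ (_ , d∈) → to-W a∈ b∈ d∈) region-ends)) cycle-ends)
      where
      to-W : ∀ {a b c d} → a ∈ corners → b ∈ corners → d ∈ W → DistinctEdges a b c d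
      to-W a∈ b∈ d∈ = ≢W b∈ d∈ ∘ proj₂ , ≢W a∈ d∈ ∘ proj₁

    all-edges : All (uncurry (E G)) all-pairs
    all-edges = to-next q₁ ∷ to-next q₂ ∷ to-next q₃ ∷ to-next q₄ ∷ to-leg q₁ ∷ to-leg q₂ ∷ to-leg q₃ ∷ to-leg q₄ ∷
      All.tabulate λ {p} m → let _ , _ , _ , ab = pairsOn-∈⁻ {W} m in ab

    total-unique : Unique (map η (corners ++ W) ++ mids (map threadOf all-pairs))
    total-unique = Unique.++⁺ (map-unique⁺ η (λ u∈ v∈ → η-inj _ _ (back u∈) (back v∈)) all-unique) (mids-unique all-edges all-distinct) disjoint
      where
      back : corners ++ W ⊆ V G
      back = ∈-resp-↭ (↭-sym σ)
      disjoint : Disjoint (map η (corners ++ W)) (mids (map threadOf all-pairs))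
      disjoint (m , m′) with ∈-map⁻ η m | ∈-mids⁻ (map threadOf all-pairs) m′
      ... | w , w∈ , refl | t , t∈ , mt with ∈-map⁻ threadOf t∈
      ...   | p , p∈ , refl = I-η (All.lookup all-edges p∈) (back w∈) mt

  d∈Z : ∀ {d} → d ∈ W → η d ∈ Z
  d∈Z d∈ = ∈-++⁺ˡ (∈-map⁺ η d∈)

  sun : Sun (η d₁) (η d₂) (η d₃) (η d₄)
  sun = record
    { c₁₂ = I-chain (to-next q₁) ; c₂₃ = I-chain (to-next q₂) ; c₃₄ = I-chain (to-next q₃) ; c₄₁ = I-chain (to-next q₄)
    ; t₁ = I-chain (to-leg q₁) ; t₂ = I-chain (to-leg q₂) ; t₃ = I-chain (to-leg q₃) ; t₄ = I-chain (to-leg q₄)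
    ; e₁∈ = d∈Z (leg∈ q₁) ; e₂∈ = d∈Z (leg∈ q₂) ; e₃∈ = d∈Z (leg∈ q₃) ; e₄∈ = d∈Z (leg∈ q₄)
    ; unique = unique-resp-↭ (gather [ η a₁ ] [ η a₂ ] [ η a₃ ] [ η a₄ ] (map η W) (I a₁ a₂) (I a₂ a₃) (I a₃ a₄) (I a₄ a₁)
        (I a₁ d₁) (I a₂ d₂) (I a₃ d₃) (I a₄ d₄) (mids (threadsOn W))) total-unique }
    where
    gather : ∀ k₁ k₂ k₃ k₄ w s₁₂ s₂₃ s₃₄ s₄₁ l₁ l₂ l₃ l₄ r →
      (k₁ ++ k₂ ++ k₃ ++ k₄ ++ w) ++ s₁₂ ++ s₂₃ ++ s₃₄ ++ s₄₁ ++ l₁ ++ l₂ ++ l₃ ++ l₄ ++ r ↭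
      (k₁ ++ s₁₂ ++ k₂ ++ s₂₃ ++ k₃ ++ s₃₄ ++ k₄ ++ s₄₁) ++ (l₁ ++ l₂ ++ l₃ ++ l₄) ++ w ++ r
    gather = solve 14 (λ k₁ k₂ k₃ k₄ w s₁₂ s₂₃ s₃₄ s₄₁ l₁ l₂ l₃ l₄ r →
      ((k₁ ⊕ k₂ ⊕ k₃ ⊕ k₄ ⊕ w) ⊕ s₁₂ ⊕ s₂₃ ⊕ s₃₄ ⊕ s₄₁ ⊕ l₁ ⊕ l₂ ⊕ l₃ ⊕ l₄ ⊕ r) ⊜
      ((k₁ ⊕ s₁₂ ⊕ k₂ ⊕ s₂₃ ⊕ k₃ ⊕ s₃₄ ⊕ k₄ ⊕ s₄₁) ⊕ (l₁ ⊕ l₂ ⊕ l₃ ⊕ l₄) ⊕ w ⊕ r)) ↭-refl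

  Target : ℕ → Set
  Target z = z ∈ mids (threadsOn W)

  -- The end of its leg is the only neighbour of a corner in `W`. Seen from that end, the first
  -- vertex of the image is the source of the last edge of the leg.
  leg-fwd : ∀ {p v n d b q} → Corner G W p v n d → p ∈ corners → n ∈ corners → b ∈ W → E G b v → first (I b v) (η v) ≡ q →
            b ≡ d × Link (η v) (I v d) (η d) q (η d)
  leg-fwd {v = v} {d = d} {q = x} q p∈ n∈ b∈ bv eq with only q _ (E-sym bv)
  ... | inj₁ refl = contradiction b∈ (∉W p∈)
  ... | inj₂ (inj₁ refl) = contradiction b∈ (∉W n∈)
  ... | inj₂ (inj₂ refl) = refl , subst₂ (λ l x → Link (η v) l (η d) x (η d)) (sym (I-rev bv)) eq (link-reverse (I d v) (link-first (η d) (I d v) (η v)))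

  leg-enters : ∀ {x w b} → b ∈ corners → w ∈ W → E G w b → first (I w b) (η b) ≡ x → Sun.Fwd sun x (η w)
  leg-enters (here refl) w∈ wb eq with leg-fwd q₁ m₄ m₂ w∈ wb eq
  ... | refl , f = inj₁ f
  leg-enters (there (here refl)) w∈ wb eq with leg-fwd q₂ m₁ m₃ w∈ wb eq
  ... | refl , f = inj₂ (inj₁ f)
  leg-enters (there (there (here refl))) w∈ wb eq with leg-fwd q₃ m₂ m₄ w∈ wb eq
  ... | refl , f = inj₂ (inj₂ (inj₁ f))
  leg-enters (there (there (there (here refl)))) w∈ wb eq with leg-fwd q₄ m₃ m₁ w∈ wb eq
  ... | refl , f = inj₂ (inj₂ (inj₂ f))

  -- An edge inside `W` would put `x` in `Z`. On the image of an edge to a corner the step would be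
  -- a forward leg edge, hence not residual, and no leg edge starts in `Z`.
  no-branch-entry : ∀ {x w b} → x ∉ Z → w ∈ W → Sun.Res sun x (η w) → E G w b → first (I w b) (η b) ≡ x → b ∈ corners ⊎ b ∈ W → ⊥
  no-branch-entry x∉ w∈ r wb eq (inj₂ b∈) = x∉ (subst (_∈ Z) eq (path⊆region w∈ b∈ wb (first-∈ (I _ _) (η _))))
  no-branch-entry x∉ w∈ (_ , inj₁ f) wb eq (inj₁ b∈) =
    [ (λ m → Sun.circ∌Z sun m (d∈Z w∈)) , (λ m → Sun.legs∌Z sun m (d∈Z w∈)) ]′ (Sun.fwd-src sun f)
  no-branch-entry x∉ w∈ (_ , inj₂ ¬f) wb eq (inj₁ b∈) = ¬f (leg-enters b∈ w∈ wb eq)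

  -- A vertex η w with w ∉ C has its three edges in Z or on the legs, so a residual step enters Z at an inner vertex of a thread.
  enter : ∀ {x z} → x ∉ Z → z ∈ Z → Sun.Res sun x z → Target z
  enter {x} {z} x∉ z∈ r = [ (λ m → ⊥-elim (at-branch (∈-map⁻ η m))) , id ]′ (∈-++⁻ (map η W) z∈)
    where
    at-branch : ∃[ w ] (w ∈ W × z ≡ η w) → ⊥
    at-branch (w , w∈ , refl) =
      let b , wb , eq = branch-neighbour (proj₂ cubG) cubH (W⊆V w∈) (H.E-sym (proj₁ r))
      in no-branch-entry x∉ w∈ r wb eq (∈-++⁻ corners (∈-resp-↭ σ (E-tgt wb)))

-- Embedding a leap

override : List (ℕ × ℕ) → (ℕ → ℕ) → ℕ → ℕ
override [] f v = f v
override ((a , k) ∷ ps) f v = if does (v ≟ a) then k else override ps f v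

override-hit : ∀ {ps f a k} → Unique (map proj₁ ps) → (a , k) ∈ ps → override ps f a ≡ k
override-hit {(a , k) ∷ ps} _ (here refl) rewrite dec-true (a ≟ a) refl = refl
override-hit {(b , _) ∷ ps} {a = a} (b∉ ∷ u) (there m)
  rewrite dec-false (a ≟ b) (λ { refl → All.lookup b∉ (∈-map⁺ proj₁ m) refl }) = override-hit u m

override-miss : ∀ ps {f v} → v ∉ map proj₁ ps → override ps f v ≡ f v
override-miss [] _ = refl
override-miss ((a , k) ∷ ps) {v = v} v∉ rewrite dec-false (v ≟ a) (v∉ ∘ here) = override-miss ps (v∉ ∘ there)

map-cong-∈ : ∀ {f g : ℕ → ℕ} xs → (∀ {v} → v ∈ xs → f v ≡ g v) → map f xs ≡ map g xs
map-cong-∈ [] _ = refl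
map-cong-∈ (x ∷ xs) h = cong₂ _∷_ (h (here refl)) (map-cong-∈ xs (h ∘ there))

module Leap {F G H : Graph} (wfF : WellFormed F) (cubG : Cubic G) (cubH : Cubic H) (F⊆G : Subgraph F G) (e : Embedding F G H)
            {C W : List ℕ} (V-↭ : V G ↭ C ++ W) (C∌F : All (λ c → ¬ (c ∈ V F)) C)
            {a₁ a₂ a₃ a₄ d₁ d₂ d₃ d₄ : ℕ} (ring : Ring G C W a₁ a₂ a₃ a₄ d₁ d₂ d₃ d₄)
            (S : Suns.Sun cubH (Region.region cubG cubH e W) (Embedding.η e d₁) (Embedding.η e d₂) (Embedding.η e d₃) (Embedding.η e d₄))
            {s′ s″ qs m m′ : List ℕ} {u z : ℕ} {t : Thread} {R₁ R₂ : List Thread}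
            (s₁₂≡ : Suns.Sun.s₁₂ S ≡ s′ ++ u ∷ s″) (q : Chain (E H) u qs z)
            (uq : Unique (qs ++ Suns.Sun.circ S ++ Suns.Sun.legs S ++ Region.region cubG cubH e W))
            (R≡ : Region.threadsOn cubG cubH e W ≡ R₁ ++ t ∷ R₂) (mid≡ : mid t ≡ m ++ z ∷ m′) where
  open Emb (proj₁ cubG) e hiding (fixV; fixE)
  open WF (proj₁ cubG)
  open Region cubG cubH e
  open Ring ring
  open Corner
  open Suns cubH (region W)
  open Sun S hiding (unique)
  private
    module H = WF (proj₁ cubH)
    module F = WF wfF

  c d : ℕ
  c = src t
  d = tgt t

  t∈ : t ∈ threadsOn W
  t∈ = subst (t ∈_) (sym R≡) (∈-++⁺ʳ R₁ (here refl))

  c∈W : c ∈ W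
  c∈W = proj₁ (threadsOn-∈⁻ {W} t∈)

  d∈W : d ∈ W
  d∈W = proj₁ (proj₂ (threadsOn-∈⁻ {W} t∈))

  cd : E G c d
  cd = proj₁ (proj₂ (proj₂ (threadsOn-∈⁻ {W} t∈)))

  mid≡I : mid t ≡ I c d
  mid≡I = proj₂ (proj₂ (proj₂ (threadsOn-∈⁻ {W} t∈)))

  open Plus (proj₁ cubG) a₁ a₂ c d (to-next q₁) cd

  corners : List ℕ
  corners = a₁ ∷ a₂ ∷ a₃ ∷ a₄ ∷ []

  σ : V G ↭ corners ++ W
  σ = ↭-trans V-↭ (++⁺ʳ W (↭-sym C-↭))

  corner∈V : ∀ {a} → a ∈ corners → a ∈ V G
  corner∈V a∈ = ∈-resp-↭ (↭-sym σ) (∈-++⁺ˡ a∈)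

  W⊆V : W ⊆ V G
  W⊆V m = ∈-resp-↭ (↭-sym σ) (∈-++⁺ʳ corners m)

  corners∌W : ∀ {a} → a ∈ corners → a ∉ W
  corners∌W m m′ = proj₂ (proj₂ (unique-++⁻ corners (unique-resp-↭ σ uniqueV))) (m , m′)

  corners∌F : ∀ {a} → a ∈ corners → a ∉ V F
  corners∌F a∈ = All.lookup C∌F (∈-resp-↭ C-↭ a∈)

  x∉F : x ∉ V F
  x∉F m = x-fresh (proj₁ F⊆G x m) refl

  y∉F : y ∉ V F
  y∉F m = y-fresh (proj₁ F⊆G y m) refl

  i₁ : a₁ ∈ corners
  i₁ = here refl
  i₂ : a₂ ∈ corners
  i₂ = there (here refl)
  i₃ : a₃ ∈ corners
  i₃ = there (there (here refl))
  i₄ : a₄ ∈ corners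
  i₄ = there (there (there (here refl)))

  -- The corners are sent to those of the current sun, since rerouting may have moved them; the
  -- vertices in `W` keep their images.
  moved : List (ℕ × ℕ)
  moved = (x , u) ∷ (y , z) ∷ (a₁ , k₁) ∷ (a₂ , k₂) ∷ (a₃ , k₃) ∷ (a₄ , k₄) ∷ []

  η⁺ : ℕ → ℕ
  η⁺ = override moved η

  moved-unique : Unique (map proj₁ moved)
  moved-unique = unique-∷⁺ (λ { (here eq) → x≢y eq ; (there m) → x-fresh (corner∈V m) refl })
    (unique-∷⁺ (λ m → y-fresh (corner∈V m) refl) (proj₁ (unique-++⁻ corners (unique-resp-↭ σ uniqueV))))

  hit : ∀ {a k} → (a , k) ∈ moved → η⁺ a ≡ k
  hit = override-hit {moved} {η} moved-unique

  ηx : η⁺ x ≡ u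
  ηx = hit (here refl)
  ηy : η⁺ y ≡ z
  ηy = hit (there (here refl))
  η₁ : η⁺ a₁ ≡ k₁
  η₁ = hit (there (there (here refl)))
  η₂ : η⁺ a₂ ≡ k₂
  η₂ = hit (there (there (there (here refl))))
  η₃ : η⁺ a₃ ≡ k₃
  η₃ = hit (there (there (there (there (here refl)))))
  η₄ : η⁺ a₄ ≡ k₄
  η₄ = hit (there (there (there (there (there (here refl))))))

  ηW : ∀ {w} → w ∈ W → η⁺ w ≡ η w
  ηW w∈ = override-miss moved {η} λ
    { (here eq) → x-fresh (W⊆V w∈) eq ; (there (here eq)) → y-fresh (W⊆V w∈) eq ; (there (there m)) → corners∌W m w∈ }

  special : List Thread
  special = thread a₁ s′ x ∷ thread x s″ a₂ ∷ thread a₂ s₂₃ a₃ ∷ thread a₃ s₃₄ a₄ ∷ thread a₄ s₄₁ a₁ ∷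
            thread a₁ l₁ d₁ ∷ thread a₂ l₂ d₂ ∷ thread a₃ l₃ d₃ ∷ thread a₄ l₄ d₄ ∷
            thread x qs y ∷ thread c m y ∷ thread y m′ d ∷ []

  threads⁺ : List Thread
  threads⁺ = special ++ R₁ ++ R₂

  vertices-↭ : map η⁺ (V G⁺) ↭ u ∷ z ∷ k₁ ∷ k₂ ∷ k₃ ∷ k₄ ∷ map η W
  vertices-↭ = subst (map η⁺ (V G⁺) ↭_)
    (cong₂ _∷_ ηx (cong₂ _∷_ ηy (cong₂ _∷_ η₁ (cong₂ _∷_ η₂ (cong₂ _∷_ η₃ (cong₂ _∷_ η₄ (map-cong-∈ W ηW)))))))
    (prep _ (prep _ (map⁺ η⁺ σ)))

  -- This is `uq` rearranged: `u` leaves its side and `z` its thread to become branch vertices, and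
  -- no vertex is added or lost.
  unique⁺ : Unique (map η⁺ (V G⁺) ++ mids threads⁺)
  unique⁺ = unique-resp-↭ (↭-sym (++⁺ʳ (mids threads⁺) vertices-↭))
    (subst (λ r → Unique ((u ∷ z ∷ k₁ ∷ k₂ ∷ k₃ ∷ k₄ ∷ map η W) ++ s′ ++ s″ ++ s₂₃ ++ s₃₄ ++ s₄₁ ++ l₁ ++ l₂ ++ l₃ ++ l₄ ++ qs ++ m ++ m′ ++ r))
      (sym (mids-++ R₁ R₂))
      (unique-resp-↭ (regroup [ k₁ ] [ k₂ ] [ k₃ ] [ k₄ ] [ u ] [ z ] s′ s″ s₂₃ s₃₄ s₄₁ l₁ l₂ l₃ l₄ qs m m′ (map η W) (mids R₁) (mids R₂))
        (subst₂ (λ s r → Unique (qs ++ (k₁ ∷ s ++ k₂ ∷ s₂₃ ++ k₃ ∷ s₃₄ ++ k₄ ∷ s₄₁) ++ legs ++ map η W ++ r)) s₁₂≡ mids≡ uq)))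
    where
    mids≡ : mids (threadsOn W) ≡ mids R₁ ++ (m ++ z ∷ m′) ++ mids R₂
    mids≡ = trans (cong mids R≡) (trans (mids-++ R₁ (t ∷ R₂)) (cong (λ l → mids R₁ ++ l ++ mids R₂) mid≡))
    regroup : ∀ k₁ k₂ k₃ k₄ u z s′ s″ s₂₃ s₃₄ s₄₁ l₁ l₂ l₃ l₄ q m m′ w r₁ r₂ →
      q ++ (k₁ ++ (s′ ++ u ++ s″) ++ k₂ ++ s₂₃ ++ k₃ ++ s₃₄ ++ k₄ ++ s₄₁) ++ (l₁ ++ l₂ ++ l₃ ++ l₄) ++ w ++ r₁ ++ (m ++ z ++ m′) ++ r₂ ↭
      (u ++ z ++ k₁ ++ k₂ ++ k₃ ++ k₄ ++ w) ++ s′ ++ s″ ++ s₂₃ ++ s₃₄ ++ s₄₁ ++ l₁ ++ l₂ ++ l₃ ++ l₄ ++ q ++ m ++ m′ ++ r₁ ++ r₂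
    regroup = solve 21 (λ k₁ k₂ k₃ k₄ u z s′ s″ s₂₃ s₃₄ s₄₁ l₁ l₂ l₃ l₄ q m m′ w r₁ r₂ →
      (q ⊕ (k₁ ⊕ (s′ ⊕ u ⊕ s″) ⊕ k₂ ⊕ s₂₃ ⊕ k₃ ⊕ s₃₄ ⊕ k₄ ⊕ s₄₁) ⊕ (l₁ ⊕ l₂ ⊕ l₃ ⊕ l₄) ⊕ w ⊕ r₁ ⊕ (m ⊕ z ⊕ m′) ⊕ r₂) ⊜
      ((u ⊕ z ⊕ k₁ ⊕ k₂ ⊕ k₃ ⊕ k₄ ⊕ w) ⊕ s′ ⊕ s″ ⊕ s₂₃ ⊕ s₃₄ ⊕ s₄₁ ⊕ l₁ ⊕ l₂ ⊕ l₃ ⊕ l₄ ⊕ q ⊕ m ⊕ m′ ⊕ r₁ ⊕ r₂)) ↭-refl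

  rest-∈ : ∀ {r} → r ∈ R₁ ++ R₂ → r ∈ threadsOn W
  rest-∈ {r} r∈ = subst (r ∈_) (sym R≡) ([ ∈-++⁺ˡ , (λ m → ∈-++⁺ʳ R₁ (there m)) ]′ (∈-++⁻ R₁ r∈))

  ChainOf : Thread → Set
  ChainOf r = Chain (E H) (η⁺ (src r)) (mid r) (η⁺ (tgt r))

  at : ∀ p r {p′ l r′} → η⁺ p ≡ p′ → η⁺ r ≡ r′ → Chain (E H) p′ l r′ → ChainOf (thread p l r)
  at p r {l = l} p≡ r≡ = subst₂ (λ v w → Chain (E H) v l w) (sym p≡) (sym r≡)

  special-chains : All ChainOf special
  special-chains = at a₁ x η₁ ηx (proj₁ s-parts) ∷ at x a₂ ηx η₂ (proj₂ s-parts) ∷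
    at a₂ a₃ η₂ η₃ c₂₃ ∷ at a₃ a₄ η₃ η₄ c₃₄ ∷ at a₄ a₁ η₄ η₁ c₄₁ ∷
    at a₁ d₁ η₁ (ηW (leg∈ q₁)) t₁ ∷ at a₂ d₂ η₂ (ηW (leg∈ q₂)) t₂ ∷ at a₃ d₃ η₃ (ηW (leg∈ q₃)) t₃ ∷ at a₄ d₄ η₄ (ηW (leg∈ q₄)) t₄ ∷
    at x y ηx ηy q ∷ at c y (ηW c∈W) ηy (proj₁ m-parts) ∷ at y d ηy (ηW d∈W) (proj₂ m-parts) ∷ []
    where
    s-parts : Chain (E H) k₁ s′ u × Chain (E H) u s″ k₂
    s-parts = split s′ (subst (λ l → Chain (E H) k₁ l k₂) s₁₂≡ c₁₂)
    m-parts : Chain (E H) (η c) m z × Chain (E H) z m′ (η d)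
    m-parts = split m (subst (λ l → Chain (E H) (η c) l (η d)) (trans (sym mid≡I) mid≡) (I-chain cd))

  rest-chain : ∀ {r} → src r ∈ W × tgt r ∈ W × E G (src r) (tgt r) × mid r ≡ I (src r) (tgt r) → ChainOf r
  rest-chain {r} (a∈ , b∈ , ab , refl) = at (src r) (tgt r) (ηW a∈) (ηW b∈) (I-chain ab)

  chains⁺ : ∀ {r} → r ∈ threads⁺ → ChainOf r
  chains⁺ r∈ = [ All.lookup special-chains , (λ m → rest-chain (threadsOn-∈⁻ {W} (rest-∈ m))) ]′ (∈-++⁻ special r∈)

  FixedBy : Thread → Set
  FixedBy r = E F (src r) (tgt r) → mid r ≡ []

  special-fixed : All FixedBy special
  special-fixed = by-src (corners∌F i₁) ∷ by-src x∉F ∷ by-src (corners∌F i₂) ∷ by-src (corners∌F i₃) ∷ by-src (corners∌F i₄) ∷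
    by-src (corners∌F i₁) ∷ by-src (corners∌F i₂) ∷ by-src (corners∌F i₃) ∷ by-src (corners∌F i₄) ∷
    by-src x∉F ∷ by-tgt y∉F ∷ by-src y∉F ∷ []
    where
    by-src : ∀ {a b} {l : List ℕ} → a ∉ V F → E F a b → l ≡ []
    by-src ∉F f = contradiction (F.E-src f) ∉F
    by-tgt : ∀ {a b} {l : List ℕ} → b ∉ V F → E F a b → l ≡ []
    by-tgt ∉F f = contradiction (F.E-tgt f) ∉F

  F-edge-bare : ∀ {a b} → E F a b → I a b ≡ []
  F-edge-bare f = cong inside (Embedding.fixE e _ _ f)

  fixed⁺ : ∀ {r} → r ∈ threads⁺ → FixedBy r
  fixed⁺ r∈ = [ All.lookup special-fixed , (λ m f → trans (proj₂ (proj₂ (proj₂ (threadsOn-∈⁻ {W} (rest-∈ m))))) (F-edge-bare f)) ]′ (∈-++⁻ special r∈)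

  -- The image of an edge of `F` is that edge alone, while `z` is an inner vertex of the image of
  -- `cd`.
  cd∉F : ¬ E F c d
  cd∉F f = nonempty m (trans (sym mid≡) (trans mid≡I (F-edge-bare f)))
    where
    nonempty : ∀ (l : List ℕ) {l′} → l ++ z ∷ l′ ≢ []
    nonempty [] ()
    nonempty (_ ∷ _) ()

  pair-turn : ∀ {a b v w} → Pair a b v w → Pair b a v w
  pair-turn (inj₁ p) = inj₂ p
  pair-turn (inj₂ p) = inj₁ p

  pair-swap : ∀ {a b v w} → Pair a b v w → Pair a b w v
  pair-swap (inj₁ (p , q)) = inj₂ (q , p)
  pair-swap (inj₂ (p , q)) = inj₁ (q , p)

  Covered : ℕ → ℕ → Set
  Covered v w = ∃[ l ] (thread v l w ∈ threads⁺ ⊎ thread w l v ∈ threads⁺)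

  covered-sym : ∀ {v w} → Covered v w → Covered w v
  covered-sym (l , s) = l , Sum.swap s

  cover-pair : ∀ {a l b v w} → thread a l b ∈ threads⁺ → Pair a b v w → Covered v w
  cover-pair r∈ (inj₁ (refl , refl)) = _ , inj₁ r∈
  cover-pair r∈ (inj₂ (refl , refl)) = _ , inj₂ r∈

  cover-corner : ∀ {v w} → v ∈ corners → E G v w → ¬ Pair a₁ a₂ v w → Covered v w
  cover-corner (here refl) vw np with only q₁ _ vw
  ... | inj₁ refl = _ , inj₂ (there (there (there (there (here refl)))))
  ... | inj₂ (inj₁ refl) = contradiction (inj₁ (refl , refl)) np
  ... | inj₂ (inj₂ refl) = _ , inj₁ (there (there (there (there (there (here refl))))))
  cover-corner (there (here refl)) vw np with only q₂ _ vw
  ... | inj₁ refl = contradiction (inj₂ (refl , refl)) np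
  ... | inj₂ (inj₁ refl) = _ , inj₁ (there (there (here refl)))
  ... | inj₂ (inj₂ refl) = _ , inj₁ (there (there (there (there (there (there (here refl)))))))
  cover-corner (there (there (here refl))) vw np with only q₃ _ vw
  ... | inj₁ refl = _ , inj₂ (there (there (here refl)))
  ... | inj₂ (inj₁ refl) = _ , inj₁ (there (there (there (here refl))))
  ... | inj₂ (inj₂ refl) = _ , inj₁ (there (there (there (there (there (there (there (here refl))))))))
  cover-corner (there (there (there (here refl)))) vw np with only q₄ _ vw
  ... | inj₁ refl = _ , inj₂ (there (there (there (here refl))))
  ... | inj₂ (inj₁ refl) = _ , inj₁ (there (there (there (there (here refl)))))
  ... | inj₂ (inj₂ refl) = _ , inj₁ (there (there (there (there (there (there (there (there (here refl)))))))))

  keep : ∀ {r} → r ∈ threadsOn W → ¬ (src r ≡ c × tgt r ≡ d) → r ∈ threads⁺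
  keep {r} r∈ ne with ∈-++⁻ R₁ (subst (r ∈_) R≡ r∈)
  ... | inj₁ m = ∈-++⁺ʳ special (∈-++⁺ˡ m)
  ... | inj₂ (here refl) = contradiction (refl , refl) ne
  ... | inj₂ (there m) = ∈-++⁺ʳ special (∈-++⁺ʳ R₁ m)

  cover-off : ∀ {v w} → v ∈ W → w ∈ W → E G v w → ¬ Pair c d v w → Covered v w
  cover-off {v} {w} v∈ w∈ vw np with threadsOn-∈⁺ v∈ w∈ vw
  ... | inj₁ r∈ = I v w , inj₁ (keep r∈ (np ∘ inj₁))
  ... | inj₂ r∈ = I w v , inj₂ (keep r∈ λ (p , r) → np (inj₂ (r , p)))

  cover-old : ∀ {v w} → v ∈ corners ⊎ v ∈ W → w ∈ corners ⊎ w ∈ W → E G v w → ¬ Pair a₁ a₂ v w → ¬ Pair c d v w → Covered v w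
  cover-old (inj₁ v∈) _ vw n₁ n₂ = cover-corner v∈ vw n₁
  cover-old (inj₂ v∈) (inj₁ w∈) vw n₁ n₂ = covered-sym (cover-corner w∈ (E-sym vw) (n₁ ∘ pair-swap))
  cover-old (inj₂ v∈) (inj₂ w∈) vw n₁ n₂ = cover-off v∈ w∈ vw n₂

  side : ∀ {v} → v ∈ V G → v ∈ corners ⊎ v ∈ W
  side v∈ = ∈-++⁻ corners (∈-resp-↭ σ v∈)

  cover⁺ : ∀ {v w} → E G⁺ v w → Covered v w
  cover⁺ vw with plus-edge⁻ vw
  ... | old p n₁ n₂ = cover-old (side (E-src p)) (side (E-tgt p)) p n₁ n₂
  ... | xa p = cover-pair (here refl) (pair-turn p)
  ... | xb p = cover-pair (there (here refl)) p
  ... | yc p = cover-pair (there (there (there (there (there (there (there (there (there (there (here refl))))))))))) (pair-turn p)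
  ... | yd p = cover-pair (there (there (there (there (there (there (there (there (there (there (there (here refl)))))))))))) p
  ... | xy p = cover-pair (there (there (there (there (there (there (there (there (there (here refl)))))))))) p

  η⁺-in : ∀ v → v ∈ V G⁺ → η⁺ v ∈ V H
  η⁺-in v v∈ = All.lookup values (∈-resp-↭ vertices-↭ (∈-map⁺ η⁺ v∈))
    where
    start : ∀ {p l r} → Chain (E H) p l r → p ∈ V H
    start ch = All.head (H.chain-V ch)
    values : All (_∈ V H) (u ∷ z ∷ k₁ ∷ k₂ ∷ k₃ ∷ k₄ ∷ map η W)
    values = start q ∷ start (chain-reverse H.E-sym q) ∷ start c₁₂ ∷ start c₂₃ ∷ start c₃₄ ∷ start c₄₁ ∷
      All.map⁺ (All.tabulate λ w∈ → η-in _ (W⊆V w∈))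

  F-off-corners : ∀ {v} → v ∈ V F → v ∈ W
  F-off-corners v∈ = [ (λ a∈ → contradiction v∈ (corners∌F a∈)) , id ]′ (side (proj₁ F⊆G _ v∈))

  leap-model : Model F G⁺ H
  leap-model = record
    { η = η⁺ ; threads = threads⁺ ; unique = unique⁺ ; chains = chains⁺ ; cover = cover⁺ ; η-in = η⁺-in
    ; fixV = λ v v∈ → trans (ηW (F-off-corners v∈)) (Embedding.fixV e v v∈) ; fixE = fixed⁺ }

  -- Neither deleted edge is in `F`: the first has its ends on `C`, and for the second there is
  -- `cd∉F`.
  F⊆G⁺ : Subgraph F G⁺
  F⊆G⁺ = (λ v v∈ → there (there (proj₁ F⊆G v v∈))) , λ v w f → plus-edge⁺ (proj₂ F⊆G v w f)
    (λ { (inj₁ (refl , _)) → corners∌F i₁ (F.E-src f) ; (inj₂ (_ , refl)) → corners∌F i₁ (F.E-tgt f) })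
    (λ { (inj₁ (refl , refl)) → cd∉F f ; (inj₂ (refl , refl)) → cd∉F (F.E-sym f) })

  leap-embedding : Embedding F G⁺ H
  leap-embedding = embed wfF plus-wellFormed (proj₁ cubH) F⊆G⁺ leap-model

-- Assembling the contradiction

module Argument {F G H : Graph} (wfF : WellFormed F) (cubG : Cubic G) (cubH : Cubic H) (F⊆G : Subgraph F G) (e : Embedding F G H)
                {C W : List ℕ} (V-↭ : V G ↭ C ++ W) (C∌F : All (λ c → ¬ (c ∈ V F)) C) (𝓛 : Graph → Set)
                (members : ∀ L → 𝓛 L → Cubic L × Subgraph F L)
                (leaps : ∀ a b c d → CircuitEdge C a b → E G c d → ¬ E F c d → ¬ (c ∈ C) → ¬ (d ∈ C) →
                         Σ Graph (λ L → 𝓛 L × FContains F (plus G a b c d) L))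
                (avoids : ∀ L → 𝓛 L → ¬ FContains F H L) where
  open Embedding e using (η)
  open Region cubG cubH e
  open Suns cubH (region W)
  open Sun

  -- The ends remember a labelling of `C`, from which the edge `a₁a₂` to be subdivided is recovered
  -- once a leap appears.
  data Good : ℕ → ℕ → ℕ → ℕ → Set where
    good : ∀ {a₁ a₂ a₃ a₄ d₁ d₂ d₃ d₄} → Ring G C W a₁ a₂ a₃ a₄ d₁ d₂ d₃ d₄ → Good (η d₁) (η d₂) (η d₃) (η d₄)

  rot-good : ∀ {e₁ e₂ e₃ e₄} → Good e₁ e₂ e₃ e₄ → Good e₂ e₃ e₄ e₁
  rot-good (good r) = good (rot-ring r)

  mirror-good : ∀ {e₁ e₂ e₃ e₄} → Good e₁ e₂ e₃ e₄ → Good e₂ e₁ e₄ e₃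
  mirror-good (good r) = good (mirror-ring r)

  W∌C : ∀ {c} → c ∈ W → c ∉ C
  W∌C m m′ = proj₂ (proj₂ (unique-++⁻ C (unique-resp-↭ V-↭ (WF.uniqueV (proj₁ cubG))))) (m′ , m)

  no-leap : ∀ {e₁ e₂ e₃ e₄ s′ u s″ qs z} → Good e₁ e₂ e₃ e₄ → (S : Sun e₁ e₂ e₃ e₄) → s₁₂ S ≡ s′ ++ u ∷ s″ →
            Chain (E H) u qs z → Unique (qs ++ circ S ++ legs S ++ region W) → z ∈ mids (threadsOn W) → ⊥
  no-leap (good ring) S s₁₂≡ q uq z∈ with ∈-mids⁻ (threadsOn W) z∈
  ... | t , t∈ , mt with ∈-∃++ t∈ | ∈-∃++ mt
  ...   | R₁ , R₂ , R≡ | m , m′ , mid≡ = conclude (leaps _ _ c d (Ring.on₁₂ ring) cd cd∉F (W∌C c∈W) (W∌C d∈W))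
    where
    open Leap wfF cubG cubH F⊆G e V-↭ C∌F ring S s₁₂≡ q uq R≡ mid≡
    conclude : Σ Graph (λ L → 𝓛 L × FContains F (plus G _ _ c d) L) → ⊥
    conclude (L , L∈ , inner) = avoids L L∈
      (compose wfF (proj₁ (proj₁ (members L L∈))) (Plus.plus-wellFormed (proj₁ cubG) _ _ c d (Corner.to-next (Ring.q₁ ring)) cd)
        (proj₂ (members L L∈)) inner leap-embedding)

  contradictory : ∀ {a₁ a₂ a₃ a₄ d₁ d₂ d₃ d₄} → Ring G C W a₁ a₂ a₃ a₄ d₁ d₂ d₃ d₄ → 8 ≤ length (V G) → CyclicallyConnected 5 H → ⊥
  contradictory {a₁} {a₂} {a₃} {a₄} ring big cyc = finish (exists-trail enter cyc circuit)
    where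
    open Initial cubG cubH e V-↭ ring using (sun; enter; σ)
    open Ring ring
    open Corner using (to-next)
    Z∋ : ∀ {z} → z ∈ mids (threadsOn W) → z ∈ region W
    Z∋ m = ∈-++⁺ʳ (map η W) m
    W⊆V : W ⊆ V G
    W⊆V m = ∈-resp-↭ (↭-sym V-↭) (∈-++⁺ʳ C m)
    open Search cubH (region W) (_∈ mids (threadsOn W)) Z∋ (region⊆V W⊆V) sun
    open Augment cubH (region W) (_∈ mids (threadsOn W)) Z∋
    dense : length W ≤ edgesIn (proj₁ cubG) W × 1 ≤ length W
    dense = off-square-dense (proj₁ cubG) (proj₂ cubG) σ (to-next q₁) (to-next q₂) (to-next q₃) (to-next q₄) big
    circuit : ∃[ cs ] (IsCircuit H cs × All (_∈ region W) cs)
    circuit = circuit-in-region (proj₁ (proj₂ (unique-++⁻ C (unique-resp-↭ V-↭ (WF.uniqueV (proj₁ cubG)))))) (proj₂ dense) (proj₁ dense)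
    finish : ∃[ x ] ∃₂ (λ ws z → x ∈ circ sun × Trail sun x ws z) → ⊥
    finish (x , ws , z , x∈ , tr) = no-trail Good rot-good mirror-good no-leap (suc (length ws)) (good ring) sun ≤-refl x∈ tr

theorem9p2 : (G F H : Graph) (C : List ℕ) (𝓛 : Graph → Set) →
    Cubic G → CyclicallyConnected 4 G → 8 ≤ length (V G) →
    WellFormed F → Subgraph F G → (∀ v → v ∈ V F → 2 ≤ deg F v) →
    IsCircuit G C → length C ≡ 4 → All (λ c → ¬ (c ∈ V F)) C →
    (∀ L → 𝓛 L → Cubic L × Subgraph F L) →
    (∀ a b c d → CircuitEdge C a b → E G c d → ¬ E F c d → ¬ (c ∈ C) → ¬ (d ∈ C) →
       Σ Graph (λ L → 𝓛 L × FContains F (plus G a b c d) L)) →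
    Cubic H → CyclicallyConnected 5 H → Subgraph F H →
    (∀ L → 𝓛 L → ¬ FContains F H L) →
    ¬ FContains F H G
theorem9p2 G F H C@(_ ∷ _ ∷ _ ∷ _ ∷ []) 𝓛 cubG (girth , _) big wfF F⊆G _ isC@(uC , _ , C⊆V , _) refl C∌F members leaps cubH cyc _ avoids e
  with unique-⊆⇒↭ uC (C⊆V _)
... | W , σ with square-ring cubG girth isC σ
...   | _ , _ , _ , _ , ring = Argument.contradictory wfF cubG cubH F⊆G e σ C∌F 𝓛 members leaps avoids ring big cyc
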